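{- Let $G=(V,E)$ be a finite connected undirected graph with maximum degree $\Delta$ and diameter $D$, let $k$ be an integer with $1<k<|V|$, and let $0<\varepsilon<1$. The mixing time $\tau(\varepsilon)$ of the PSRW random walk on $G^{(k-1)}$ satisfies $$\tau(\varepsilon)\le \tfrac12\,(k-1)!\,(k-1)\,\Delta^{k}\,(D+k-2)\,|V|\,\bigl((k-1)\ln|V|+\ln(k-1)+\ln\Delta+\ln\varepsilon^{ -1}\bigr),$$ and hence, for fixed $\varepsilon$, it is $O\bigl((k-1)!\,(k-1)^2\,\Delta^{k}(D+k)\,|V|\ln|V|\bigr)$.
   Context: Graphs are simple. A connected $j$-subgraph of $G$ is a connected vertex-induced subgraph of $G$ with exactly $j$ nodes. The $j$-state graph $G^{(j)}=(V^{(j)},E^{(j)})$ has as node set $V^{(j)}$ the set of all connected $j$-subgraphs of $G$; two nodes $H,F$ are adjacent iff their vertex sets satisfy $|V_H\cap V_F|=j-1$. By convention $G^{(1)}=G$. For $H\in V^{(j)}$, $d(H)$ is the degree of $H$ in $G^{(j)}$. PSRW (pairwise subgraph random walk) samples $k$-subgraphs using the standard random walk on the $(k-1)$-state graph $G^{(k-1)}$, made lazy: from $v\in V^{(k-1)}$, with probability $1/2$ stay at $v$, otherwise move to a uniformly random neighbor of $v$ in $G^{(k-1)}$. Its stationary distribution is $\pi(v)=d(v)/(2|E^{(k-1)}|)$. Mixing time: for a Markov chain on a finite set $\Omega$ with transition matrix $\mathbf P$ and stationary distribution $\pi$, let $\tau_x(\varepsilon)$ be the least $t\in\mathbb N$ such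 that $\frac12\sum_{y\in\Omega}|(\mathbf P^{\ell})_{x,y}-\pi_y|\le\varepsilon$ for all $\ell\ge t$, and let $\tau(\varepsilon)=\max_{x\in\Omega}\tau_x(\varepsilon)$. -}

module Defs where

open import Data.Nat.Base as ℕ using (ℕ; zero; suc)
import Data.Nat.Properties as ℕ
open import Data.Integer.Base as ℤ using (+_; -[1+_])
import Data.Integer.Properties as ℤ
open import Data.Bool.Base using (if_then_else_)
open import Data.Fin.Base using (Fin)
import Data.Fin.Properties as Fin
open import Data.Fin.Subset using (Subset; _∈_; _∩_; inside; outside) renaming (∣_∣ to ∣_∣ˢ)
open import Data.Fin.Subset.Properties using (_∈?_; ∩-comm; ∩-idem)
open import Data.List.Base
  using (List; []; _∷_; _++_; allFin; cartesianProduct; filter; foldr; length; lookup; map)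
open import Data.List.Membership.Propositional using () renaming (_∈_ to _∈ˡ_)
open import Data.List.Membership.Propositional.Properties using (∈-allFin; ∈-lookup)
open import Data.List.Relation.Unary.All as All using ()
open import Data.List.Relation.Unary.All.Properties using (all-filter)
open import Data.List.Relation.Unary.Any using (here; there)
open import Data.Product using (_×_; _,_; proj₁; proj₂; ∃; ∃-syntax)
open import Data.Rational.Base
open import Data.Rational.Properties
open import Data.Rational.Solver using (module +-*-Solver)
import Data.Rational.Unnormalised.Base as ℚᵘ
import Data.Rational.Unnormalised.Properties as ℚᵘ
open import Data.Sum using (_⊎_; inj₁; inj₂; [_,_]′)
open import Data.Vec.Base using ([]; _∷_)
open import Level using (0ℓ)
open import Relation.Binary.Construct.Closure.ReflexiveTransitive as Star using (Star)
open import Relation.Binary.Core using (Rel)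
open import Relation.Binary.Definitions using (Decidable; Symmetric)
open import Relation.Binary.PropositionalEquality
  using (_≡_; _≢_; refl; sym; trans; cong; cong₂; subst; subst₂)
open import Relation.Nullary using (¬_; Dec; does; yes; no; contradiction; _×-dec_; _⊎-dec_; _→-dec_)
open import Relation.Nullary.Decidable using (map′)
import Algebra.Properties.CommutativeMonoid.Sum +-0-commutativeMonoid as Sum

open +-*-Solver using (solve; _:=_; _:+_; _:*_; _:-_; :-_; con)

ℕ→ℚ : ℕ → ℚ
ℕ→ℚ n = + n / 1

-- Total reciprocal, with recip 0 = 0.
recip : ℚ → ℚ
recip q with q ≟ 0ℚ
... | yes _   = 0ℚ
... | no  q≢0 = (1/ q) {{≢-nonZero q≢0}}

module RationalLemmas where
  ≤≡ : ∀ {p q r} → q ≡ r → p ≤ q → p ≤ r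
  ≤≡ refl p≤q = p≤q

  ≡≤ : ∀ {p q r} → q ≡ r → q ≤ p → r ≤ p
  ≡≤ refl q≤p = q≤p

  ∣≡∣≤ : ∀ {p q r} → q ≡ r → ∣ q ∣ ≤ p → ∣ r ∣ ≤ p
  ∣≡∣≤ refl q≤p = q≤p

  *-recip : ∀ {q} → q ≢ 0ℚ → q * recip q ≡ 1ℚ
  *-recip {q} q≢0 with q ≟ 0ℚ
  ... | yes q≡0 = contradiction q≡0 q≢0
  ... | no  q≢0 = *-inverseʳ q {{≢-nonZero q≢0}}

  >⇒≢ : ∀ {q} → 0ℚ < q → q ≢ 0ℚ
  >⇒≢ 0<q q≡0 = <⇒≢ 0<q (sym q≡0)

  recip>0 : ∀ {q} → 0ℚ < q → 0ℚ < recip q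
  recip>0 {q} 0<q with q ≟ 0ℚ
  ... | yes q≡0 = contradiction q≡0 (>⇒≢ 0<q)
  ... | no  q≢0 = positive⁻¹ _ {{1/pos⇒pos q {{positive 0<q}}}}

  *-mono-≤₀ : ∀ {p q r s} → 0ℚ ≤ p → 0ℚ ≤ r → p ≤ q → r ≤ s → p * r ≤ q * s
  *-mono-≤₀ {p} {q} {r} {s} 0≤p 0≤r p≤q r≤s = ≤-trans
    (*-monoʳ-≤-nonNeg r {{nonNegative 0≤r}} p≤q)
    (*-monoˡ-≤-nonNeg q {{nonNegative (≤-trans 0≤p p≤q)}} r≤s)

  *-nonneg : ∀ {p q} → 0ℚ ≤ p → 0ℚ ≤ q → 0ℚ ≤ p * q
  *-nonneg 0≤p 0≤q = *-mono-≤₀ ≤-refl ≤-refl 0≤p 0≤q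

  *-pos : ∀ {p q} → 0ℚ < p → 0ℚ < q → 0ℚ < p * q
  *-pos {p} {q} 0<p 0<q = positive⁻¹ _ {{pos*pos⇒pos p {{positive 0<p}} q {{positive 0<q}}}}

  recip-antimono : ∀ {p q} → 0ℚ < p → p ≤ q → recip q ≤ recip p
  recip-antimono {p} {q} 0<p p≤q = subst₂ _≤_ lhs rhs
    (*-monoʳ-≤-nonNeg (recip p * recip q)
      {{nonNegative (<⇒≤ (*-pos (recip>0 0<p) (recip>0 0<q)))}} p≤q)
    where
    0<q = <-≤-trans 0<p p≤q
    lhs : p * (recip p * recip q) ≡ recip q
    lhs = trans (sym (*-assoc p _ _))
      (trans (cong (_* recip q) (*-recip (>⇒≢ 0<p))) (*-identityˡ _))
    rhs : q * (recip p * recip q) ≡ recip p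
    rhs = trans (solve 3 (λ a b c → a :* (b :* c) := b :* (a :* c)) refl q (recip p) (recip q))
      (trans (cong (recip p *_) (*-recip (>⇒≢ 0<q))) (*-identityʳ _))

  -- a/p − b/q = (aq − bp)/(pq)
  recip-sub : ∀ a b {p q} → 0ℚ < p → 0ℚ < q →
    a * recip p - b * recip q ≡ (a * q - b * p) * (recip p * recip q)
  recip-sub a b {p} {q} 0<p 0<q = sym (trans
    (solve 6 (λ a b p q p' q' →
      (a :* q :- b :* p) :* (p' :* q') := a :* p' :* (q :* q') :- b :* q' :* (p :* p')) refl
      a b p q (recip p) (recip q))
    (cong₂ _-_ {a * recip p * (q * recip q)} {a * recip p} {b * recip q * (p * recip p)} {b * recip q}
      (trans (cong (a * recip p *_) (*-recip (>⇒≢ 0<q))) (*-identityʳ (a * recip p)))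
      (trans (cong (b * recip q *_) (*-recip (>⇒≢ 0<p))) (*-identityʳ (b * recip q)))))

  p-q≤r : ∀ {p q r} → p ≤ r + q → p - q ≤ r
  p-q≤r {p} {q} {r} p≤ = subst (p - q ≤_)
    (solve 2 (λ r q → r :+ q :- q := r) refl r q) (+-monoˡ-≤ (- q) p≤)

  ∣∣≤ : ∀ {p r} → p ≤ r → - p ≤ r → ∣ p ∣ ≤ r
  ∣∣≤ {p} p≤r -p≤r = [ (λ eq → ≡≤ (sym eq) p≤r)
                     , (λ eq → ≡≤ (sym eq) -p≤r) ]′ (∣p∣≡p∨∣p∣≡-p p)

  p≤∣p∣ : ∀ p → p ≤ ∣ p ∣
  p≤∣p∣ p with ≤-total 0ℚ p
  ... | inj₁ 0≤p = ≤-reflexive (sym (0≤p⇒∣p∣≡p 0≤p))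
  ... | inj₂ p≤0 = ≤-trans p≤0 (0≤∣p∣ p)

  -[p-q] : ∀ p q → - (p - q) ≡ q - p
  -[p-q] = solve 2 (λ p q → :- (p :- q) := q :- p) refl

  ∣-∣-comm : ∀ p q → ∣ p - q ∣ ≡ ∣ q - p ∣
  ∣-∣-comm p q = trans (sym (∣-p∣≡∣p∣ (p - q))) (cong ∣_∣ (-[p-q] p q))

  ∣-∣-triangle : ∀ p q r → ∣ p - r ∣ ≤ ∣ p - q ∣ + ∣ q - r ∣
  ∣-∣-triangle p q r = ∣≡∣≤
    (solve 3 (λ p q r → p :- q :+ (q :- r) := p :- r) refl p q r)
    (∣p+q∣≤∣p∣+∣q∣ (p - q) (q - r))

  ∣+-+∣ : ∀ p q r s → ∣ (p + r) - (q + s) ∣ ≤ ∣ p - q ∣ + ∣ r - s ∣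
  ∣+-+∣ p q r s = ∣≡∣≤
    (solve 4 (λ p q r s → p :- q :+ (r :- s) := p :+ r :- (q :+ s)) refl p q r s)
    (∣p+q∣≤∣p∣+∣q∣ (p - q) (r - s))

  ⊔-lipschitz : ∀ c p q → ∣ (p ⊔ c) - (q ⊔ c) ∣ ≤ ∣ p - q ∣
  ⊔-lipschitz c p q = ∣∣≤ (one-side p q)
    (subst₂ _≤_ (sym (-[p-q] (p ⊔ c) (q ⊔ c))) (∣-∣-comm q p) (one-side q p))
    where
    one-side : ∀ p q → (p ⊔ c) - (q ⊔ c) ≤ ∣ p - q ∣
    one-side p q = p-q≤r (⊔-lub
      (≤-trans (subst (_≤ ∣ p - q ∣ + q) (solve 2 (λ p q → p :- q :+ q := p) refl p q)
                 (+-monoˡ-≤ q (p≤∣p∣ (p - q))))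
               (+-monoʳ-≤ ∣ p - q ∣ (p≤p⊔q q c)))
      (≤-trans (p≤q⊔p q c)
               (subst (_≤ ∣ p - q ∣ + (q ⊔ c)) (+-identityˡ (q ⊔ c))
                 (+-monoˡ-≤ (q ⊔ c) (0≤∣p∣ (p - q))))))

  half+half : ∀ p → ½ * p + ½ * p ≡ p
  half+half = solve 1 (λ p → con ½ :* p :+ con ½ :* p := p) refl

  half>0 : ∀ {p} → 0ℚ < p → 0ℚ < ½ * p
  half>0 = *-pos (positive⁻¹ ½)

  0≤1 : 0ℚ ≤ 1ℚ
  0≤1 = nonNegative⁻¹ 1ℚ

  0<1 : 0ℚ < 1ℚ
  0<1 = positive⁻¹ 1ℚ

  0≤½ : 0ℚ ≤ ½
  0≤½ = nonNegative⁻¹ ½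

open RationalLemmas

½^_ : ℕ → ℚ
½^ zero  = 1ℚ
½^ suc n = ½ * ½^ n

module DyadicLemmas where
  ½^-nonneg : ∀ n → 0ℚ ≤ ½^ n
  ½^-nonneg zero    = 0≤1
  ½^-nonneg (suc n) = *-nonneg 0≤½ (½^-nonneg n)

  ½^≤1 : ∀ n → ½^ n ≤ 1ℚ
  ½^≤1 zero    = ≤-refl
  ½^≤1 (suc n) = ≤-trans (*-mono-≤₀ 0≤½ (½^-nonneg n) (p≤p⊔q ½ 1ℚ) (½^≤1 n)) ≤-refl

  ½^-antimono : ∀ {m n} → m ℕ.≤ n → ½^ n ≤ ½^ m
  ½^-antimono {n = n} ℕ.z≤n = ½^≤1 n
  ½^-antimono (ℕ.s≤s m≤n)   = *-monoˡ-≤-nonNeg ½ (½^-antimono m≤n)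

  ℕ→ℚ-suc : ∀ n → ℕ→ℚ (suc n) ≡ 1ℚ + ℕ→ℚ n
  ℕ→ℚ-suc n = toℚᵘ-injective (ℚᵘ.≃-trans (toℚᵘ-fromℚᵘ (ℚᵘ.mkℚᵘ (+ suc n) 0))
    (ℚᵘ.≃-sym (ℚᵘ.≃-trans (toℚᵘ-homo-+ 1ℚ (ℕ→ℚ n))
      (ℚᵘ.≃-trans (ℚᵘ.+-congʳ ℚᵘ.1ℚᵘ (toℚᵘ-fromℚᵘ (ℚᵘ.mkℚᵘ (+ n) 0)))
        (ℚᵘ.*≡* (cong (ℤ._* ℤ.1ℤ) (cong (ℤ._+_ ℤ.1ℤ) (ℤ.*-identityʳ (+ n)))))))))

  ℕ→ℚ*½^≤1 : ∀ n → ℕ→ℚ n * ½^ n ≤ 1ℚ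
  ℕ→ℚ*½^≤1 zero    = 0≤1
  ℕ→ℚ*½^≤1 (suc n) = subst (_≤ 1ℚ)
    (trans (solve 2 (λ a b → con ½ :* (b :+ a :* b) := (con 1ℚ :+ a) :* (con ½ :* b))
             refl (ℕ→ℚ n) (½^ n))
           (cong (_* ½^ suc n) (sym (ℕ→ℚ-suc n))))
    (*-monoˡ-≤-nonNeg ½ (+-mono-≤ (½^≤1 n) (ℕ→ℚ*½^≤1 n)))

  p≤∣↥p∣ : ∀ p → p ≤ ℕ→ℚ ℤ.∣ ↥ p ∣
  p≤∣↥p∣ p@(mkℚ n d _) = toℚᵘ-cancel-≤ (ℚᵘ.≤-trans (ℚᵘ.*≤* (bound n))
      (ℚᵘ.≤-reflexive (ℚᵘ.≃-sym (toℚᵘ-fromℚᵘ (ℚᵘ.mkℚᵘ (+ ℤ.∣ n ∣) 0)))))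
    where
    bound : ∀ n → n ℤ.* + 1 ℤ.≤ + ℤ.∣ n ∣ ℤ.* + suc d
    bound (+ n) = ℤ.*-monoˡ-≤-nonNeg (+ n) (ℤ.+≤+ (ℕ.s≤s ℕ.z≤n))
    bound -[1+ n ] = ℤ.-≤+

  ∃½^≤ : ∀ {K δ} → 0ℚ ≤ K → 0ℚ < δ → ∃[ N ] K * ½^ N ≤ δ
  ∃½^≤ {K} {δ} 0≤K 0<δ = N , subst₂ _≤_ lhs (*-identityʳ δ)
      (*-monoˡ-≤-nonNeg δ {{nonNegative (<⇒≤ 0<δ)}}
        (≤-trans (*-monoʳ-≤-nonNeg (½^ N) {{nonNegative (½^-nonneg N)}} (p≤∣↥p∣ q))
                 (ℕ→ℚ*½^≤1 N)))
    where
    q = K * recip δ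
    N = ℤ.∣ ↥ q ∣
    lhs : δ * (q * ½^ N) ≡ K * ½^ N
    lhs = trans (solve 4 (λ d k r p → d :* (k :* r :* p) := (k :* p) :* (d :* r)) refl
                  δ K (recip δ) (½^ N))
      (trans (cong (K * ½^ N *_) (*-recip (>⇒≢ 0<δ))) (*-identityʳ _))

open DyadicLemmas

Cauchy : (ℕ → ℚ) → Set
Cauchy x = ∀ δ → 0ℚ < δ → ∃[ N ] (∀ m n → N ℕ.≤ m → N ℕ.≤ n → ∣ x m - x n ∣ ≤ δ)

-- Reals are represented by Cauchy sequences; distinct sequences may denote the same real.
record ℝ : Set where
  constructor real
  field
    seq    : ℕ → ℚ
    cauchy : Cauchy seq

open ℝ public

infix 4 _<ᴿ_ _≤ᴿ_

_<ᴿ_ : ℝ → ℝ → Set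
x <ᴿ y = ∃[ δ ] 0ℚ < δ × ∃[ N ] (∀ n → N ℕ.≤ n → seq x n + δ ≤ seq y n)

-- For Cauchy sequences this says: for every δ > 0, eventually seq x n ≤ seq y n + δ.
_≤ᴿ_ : ℝ → ℝ → Set
x ≤ᴿ y = ¬ (y <ᴿ x)

ℚ→ℝ : ℚ → ℝ
ℚ→ℝ q = real (λ _ → q) λ δ 0<δ → 0 , λ _ _ _ _ →
  subst (_≤ δ) (sym (cong ∣_∣ (+-inverseʳ q))) (<⇒≤ 0<δ)

ℕ→ℝ : ℕ → ℝ
ℕ→ℝ n = ℚ→ℝ (ℕ→ℚ n)

infixl 6 _+ᴿ_
infixl 7 _·_

_+ᴿ_ : ℝ → ℝ → ℝ
x +ᴿ y = real (λ n → seq x n + seq y n) λ δ 0<δ →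
  let (M , hM) = cauchy x (½ * δ) (half>0 0<δ)
      (N , hN) = cauchy y (½ * δ) (half>0 0<δ)
  in M ℕ.⊔ N , λ m n l l′ → ≤-trans (∣+-+∣ (seq x m) (seq x n) (seq y m) (seq y n))
       (≤≡ (half+half δ) (+-mono-≤
         (hM m n (ℕ.m⊔n≤o⇒m≤o M N l) (ℕ.m⊔n≤o⇒m≤o M N l′))
         (hN m n (ℕ.m⊔n≤o⇒n≤o M N l) (ℕ.m⊔n≤o⇒n≤o M N l′))))

module LipschitzLemmas where
  lipschitz-cauchy : ∀ (f : ℚ → ℚ) {L} → 0ℚ ≤ L → (∀ p q → ∣ f p - f q ∣ ≤ L * ∣ p - q ∣) →
    ∀ x → Cauchy x → Cauchy (λ n → f (x n))
  lipschitz-cauchy f {L} 0≤L lip x cx δ 0<δ =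
    let (N , h) = cx η (*-pos 0<δ (recip>0 0<1+L))
    in N , λ m n l l′ → ≤-trans (lip (x m) (x n))
         (≤-trans (*-monoˡ-≤-nonNeg L {{nonNegative 0≤L}} (h m n l l′)) Lη≤δ)
    where
    0<1+L : 0ℚ < 1ℚ + L
    0<1+L = subst (_< 1ℚ + L) (+-identityʳ 0ℚ) (+-mono-<-≤ 0<1 0≤L)
    η = δ * recip (1ℚ + L)
    L≤1+L : L ≤ 1ℚ + L
    L≤1+L = subst (_≤ 1ℚ + L) (+-identityˡ L) (+-monoˡ-≤ L 0≤1)
    Lη≤δ : L * η ≤ δ
    Lη≤δ = subst (L * η ≤_)
      (trans (solve 3 (λ a d r → a :* (d :* r) := d :* (a :* r)) refl (1ℚ + L) δ (recip (1ℚ + L)))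
        (trans (cong (δ *_) (*-recip (>⇒≢ 0<1+L))) (*-identityʳ δ)))
      (*-monoʳ-≤-nonNeg η {{nonNegative (<⇒≤ (*-pos 0<δ (recip>0 0<1+L)))}} L≤1+L)

open LipschitzLemmas

_·_ : ℚ → ℝ → ℝ
c · x = real (λ n → c * seq x n) (lipschitz-cauchy (c *_) (0≤∣p∣ c)
  (λ p q → ≤-reflexive (trans
    (cong ∣_∣ (solve 3 (λ c p q → c :* p :- c :* q := c :* (p :- q)) refl c p q))
    (∣p*q∣≡∣p∣*∣q∣ c (p - q)))) (seq x) (cauchy x))

-- Clamping below by the witness c of 0 < x changes only finitely many terms.
inverse : (x : ℝ) → ℚ→ℝ 0ℚ <ᴿ x → ℝ
inverse x (c , 0<c , _) = real (λ n → recip (seq x n ⊔ c))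
  (lipschitz-cauchy (λ p → recip (p ⊔ c)) {L} 0≤L lip (seq x) (cauchy x))
  where
  L = recip c * recip c
  0≤rc = <⇒≤ (recip>0 0<c)
  0≤L = *-nonneg 0≤rc 0≤rc
  lip : ∀ p q → ∣ recip (p ⊔ c) - recip (q ⊔ c) ∣ ≤ L * ∣ p - q ∣
  lip p q = begin
      ∣ recip a - recip b ∣                   ≡⟨ cong ∣_∣ step ⟩
      ∣ (b - a) * (recip a * recip b) ∣       ≡⟨ ∣p*q∣≡∣p∣*∣q∣ (b - a) _ ⟩
      ∣ b - a ∣ * ∣ recip a * recip b ∣       ≡⟨ cong (∣ b - a ∣ *_) (0≤p⇒∣p∣≡p (*-nonneg 0≤ra 0≤rb)) ⟩
      ∣ b - a ∣ * (recip a * recip b)         ≤⟨ *-mono-≤₀ (0≤∣p∣ (b - a)) (*-nonneg 0≤ra 0≤rb)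
                                                  (≤-trans (⊔-lipschitz c q p) (≤-reflexive (∣-∣-comm q p)))
                                                  (*-mono-≤₀ 0≤ra 0≤rb (recip-antimono 0<c (p≤q⊔p p c))
                                                                       (recip-antimono 0<c (p≤q⊔p q c))) ⟩
      ∣ p - q ∣ * L                           ≡⟨ *-comm ∣ p - q ∣ L ⟩
      L * ∣ p - q ∣                           ∎
    where
    open ≤-Reasoning
    a = p ⊔ c
    b = q ⊔ c
    0<a = <-≤-trans 0<c (p≤q⊔p p c)
    0<b = <-≤-trans 0<c (p≤q⊔p q c)
    0≤ra = <⇒≤ (recip>0 0<a)
    0≤rb = <⇒≤ (recip>0 0<b)
    step : recip a - recip b ≡ (b - a) * (recip a * recip b)
    step = trans (cong₂ _-_ (sym (*-identityˡ (recip a))) (sym (*-identityˡ (recip b))))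
      (trans (recip-sub 1ℚ 1ℚ 0<a 0<b)
        (cong (_* (recip a * recip b)) (cong₂ _-_ (*-identityˡ b) (*-identityˡ a))))

-- Left Riemann sum of ∫ ds/s over [ t , t + w ] with 2ᵐ equal steps.
riemann : ℕ → ℚ → ℚ → ℚ
riemann zero    t w = w * recip t
riemann (suc m) t w = riemann m t (½ * w) + riemann m (t + ½ * w) (½ * w)

module RiemannLemmas where
  1≤t⇒0<t : ∀ {t} → 1ℚ ≤ t → 0ℚ < t
  1≤t⇒0<t = <-≤-trans 0<1

  1≤t+ : ∀ {t w} → 1ℚ ≤ t → 0ℚ ≤ w → 1ℚ ≤ t + w
  1≤t+ 1≤t 0≤w = ≡≤ (+-identityʳ 1ℚ) (+-mono-≤ 1≤t 0≤w)

  t≤t+ : ∀ t {w} → 0ℚ ≤ w → t ≤ t + w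
  t≤t+ t 0≤w = ≡≤ (+-identityʳ t) (+-monoʳ-≤ t 0≤w)

  recip≤1 : ∀ {t} → 1ℚ ≤ t → recip t ≤ 1ℚ
  recip≤1 = recip-antimono 0<1

  half≥0 : ∀ {w} → 0ℚ ≤ w → 0ℚ ≤ ½ * w
  half≥0 = *-nonneg 0≤½

  split : ∀ w r → w * r ≡ (½ * w) * r + (½ * w) * r
  split = solve 2 (λ w r → w :* r := con ½ :* w :* r :+ con ½ :* w :* r) refl

  riemann-upper : ∀ m {t w} → 1ℚ ≤ t → 0ℚ ≤ w → riemann m t w ≤ w * recip t
  riemann-upper zero    _   _   = ≤-refl
  riemann-upper (suc m) {t} {w} 1≤t 0≤w = ≤≡ (sym (split w (recip t))) (+-mono-≤
    (riemann-upper m 1≤t (half≥0 0≤w))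
    (≤-trans (riemann-upper m (1≤t+ 1≤t (half≥0 0≤w)) (half≥0 0≤w))
      (*-monoˡ-≤-nonNeg (½ * w) {{nonNegative (half≥0 0≤w)}}
        (recip-antimono (1≤t⇒0<t 1≤t) (t≤t+ t (half≥0 0≤w))))))

  riemann-lower : ∀ m {t w} → 1ℚ ≤ t → 0ℚ ≤ w → w * recip (t + w) ≤ riemann m t w
  riemann-lower zero {t} {w} 1≤t 0≤w = *-monoˡ-≤-nonNeg w {{nonNegative 0≤w}}
    (recip-antimono (1≤t⇒0<t 1≤t) (t≤t+ t 0≤w))
  riemann-lower (suc m) {t} {w} 1≤t 0≤w = ≡≤ (sym (split w (recip (t + w)))) (+-mono-≤
    (≤-trans (*-monoˡ-≤-nonNeg (½ * w) {{nonNegative 0≤h}}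
        (recip-antimono (1≤t⇒0<t 1≤t+h)
          (subst (t + ½ * w ≤_) eq (t≤t+ (t + ½ * w) 0≤h))))
      (riemann-lower m 1≤t 0≤h))
    (≡≤ (cong (λ z → (½ * w) * recip z) eq) (riemann-lower m 1≤t+h 0≤h)))
    where
    0≤h = half≥0 0≤w
    1≤t+h = 1≤t+ 1≤t 0≤h
    eq : t + ½ * w + ½ * w ≡ t + w
    eq = trans (+-assoc t _ _) (cong (_+_ t) (half+half w))

  riemann-refine : ∀ p d {t w} → 1ℚ ≤ t → 0ℚ ≤ w →
    ∣ riemann (p ℕ.+ d) t w - riemann p t w ∣ ≤ w * w * ½^ p
  riemann-refine zero d {t} {w} 1≤t 0≤w = ≤≡ (sym (*-identityʳ (w * w))) (∣∣≤
    (≤-trans (p-q≤r (≤-trans (riemann-upper d 1≤t 0≤w) (≤-reflexive (sym (+-identityˡ _)))))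
             (*-nonneg 0≤w 0≤w))
    (subst (_≤ w * w) (sym (-[p-q] (riemann d t w) (w * recip t)))
      (≤-trans (+-monoʳ-≤ (w * recip t) (neg-antimono-≤ (riemann-lower d 1≤t 0≤w)))
        (≤-trans (≤-reflexive diff)
          (subst (w * w * (recip t * recip (t + w)) ≤_) (*-identityʳ (w * w))
            (*-monoˡ-≤-nonNeg (w * w) {{nonNegative (*-nonneg 0≤w 0≤w)}}
              (*-mono-≤₀ (<⇒≤ (recip>0 0<t)) (<⇒≤ (recip>0 0<t+w))
                (recip≤1 1≤t) (recip≤1 (1≤t+ 1≤t 0≤w)))))))))
    where
    0<t = 1≤t⇒0<t 1≤t
    0<t+w = 1≤t⇒0<t (1≤t+ 1≤t 0≤w)
    diff : w * recip t - w * recip (t + w) ≡ w * w * (recip t * recip (t + w))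
    diff = trans (recip-sub w w 0<t 0<t+w) (cong (_* (recip t * recip (t + w)))
      (solve 2 (λ w t → w :* (t :+ w) :- w :* t := w :* w) refl w t))
  riemann-refine (suc p) d {t} {w} 1≤t 0≤w = ≤-trans
    (∣+-+∣ (riemann (p ℕ.+ d) t h) (riemann p t h) (riemann (p ℕ.+ d) (t + h) h) (riemann p (t + h) h))
    (≤≡
      (solve 2 (λ w r → con ½ :* w :* (con ½ :* w) :* r :+ con ½ :* w :* (con ½ :* w) :* r
                        := w :* w :* (con ½ :* r)) refl w (½^ p))
      (+-mono-≤ (riemann-refine p d 1≤t 0≤h) (riemann-refine p d (1≤t+ 1≤t 0≤h) 0≤h)))
    where
    h = ½ * w
    0≤h = half≥0 0≤w

  riemann-lipschitz : ∀ m {t w t′ w′} → 1ℚ ≤ t → 0ℚ ≤ w → 1ℚ ≤ t′ → 0ℚ ≤ w′ →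
    w * t′ - w′ * t ≡ w - w′ → ∣ riemann m t w - riemann m t′ w′ ∣ ≤ ∣ w - w′ ∣
  riemann-lipschitz zero {t} {w} {t′} {w′} 1≤t 0≤w 1≤t′ 0≤w′ inv = begin
      ∣ w * recip t - w′ * recip t′ ∣                     ≡⟨ cong ∣_∣ (recip-sub w w′ 0<t 0<t′) ⟩
      ∣ (w * t′ - w′ * t) * (recip t * recip t′) ∣        ≡⟨ cong (λ z → ∣ z * (recip t * recip t′) ∣) inv ⟩
      ∣ (w - w′) * (recip t * recip t′) ∣                 ≡⟨ ∣p*q∣≡∣p∣*∣q∣ (w - w′) _ ⟩
      ∣ w - w′ ∣ * ∣ recip t * recip t′ ∣                 ≡⟨ cong (∣ w - w′ ∣ *_) (0≤p⇒∣p∣≡p (*-nonneg 0≤rt 0≤rt′)) ⟩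
      ∣ w - w′ ∣ * (recip t * recip t′)                   ≤⟨ *-monoˡ-≤-nonNeg ∣ w - w′ ∣ {{∣-∣-nonNeg (w - w′)}}
                                                              (*-mono-≤₀ 0≤rt 0≤rt′ (recip≤1 1≤t) (recip≤1 1≤t′)) ⟩
      ∣ w - w′ ∣ * 1ℚ                                     ≡⟨ *-identityʳ _ ⟩
      ∣ w - w′ ∣                                          ∎
    where
    open ≤-Reasoning
    0<t = 1≤t⇒0<t 1≤t
    0<t′ = 1≤t⇒0<t 1≤t′
    0≤rt = <⇒≤ (recip>0 0<t)
    0≤rt′ = <⇒≤ (recip>0 0<t′)
  riemann-lipschitz (suc m) {t} {w} {t′} {w′} 1≤t 0≤w 1≤t′ 0≤w′ inv = ≤-trans
    (∣+-+∣ (riemann m t (½ * w)) (riemann m t′ (½ * w′))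
           (riemann m (t + ½ * w) (½ * w)) (riemann m (t′ + ½ * w′) (½ * w′)))
    (≤≡ sum (+-mono-≤
      (riemann-lipschitz m 1≤t (half≥0 0≤w) 1≤t′ (half≥0 0≤w′) left)
      (riemann-lipschitz m (1≤t+ 1≤t (half≥0 0≤w)) (half≥0 0≤w)
                           (1≤t+ 1≤t′ (half≥0 0≤w′)) (half≥0 0≤w′) right)))
    where
    halves : ½ * (w - w′) ≡ ½ * w - ½ * w′
    halves = solve 2 (λ w w' → con ½ :* (w :- w') := con ½ :* w :- con ½ :* w') refl w w′
    left : ½ * w * t′ - ½ * w′ * t ≡ ½ * w - ½ * w′
    left = trans
      (solve 4 (λ w w' t t' → con ½ :* w :* t' :- con ½ :* w' :* t
                              := con ½ :* (w :* t' :- w' :* t)) refl w w′ t t′)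
      (trans (cong (½ *_) inv) halves)
    right : ½ * w * (t′ + ½ * w′) - ½ * w′ * (t + ½ * w) ≡ ½ * w - ½ * w′
    right = trans
      (solve 4 (λ w w' t t' → con ½ :* w :* (t' :+ con ½ :* w') :- con ½ :* w' :* (t :+ con ½ :* w)
                              := con ½ :* (w :* t' :- w' :* t)) refl w w′ t t′)
      (trans (cong (½ *_) inv) halves)
    sum : ∣ ½ * w - ½ * w′ ∣ + ∣ ½ * w - ½ * w′ ∣ ≡ ∣ w - w′ ∣
    sum = trans (cong₂ _+_ eq eq) (half+half ∣ w - w′ ∣)
      where
      eq : ∣ ½ * w - ½ * w′ ∣ ≡ ½ * ∣ w - w′ ∣
      eq = trans (cong ∣_∣ (sym halves)) (∣p*q∣≡∣p∣*∣q∣ ½ (w - w′))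

  width : ℚ → ℚ
  width q = (q ⊔ 1ℚ) - 1ℚ

  0≤width : ∀ q → 0ℚ ≤ width q
  0≤width q = +-monoˡ-≤ (- 1ℚ) (p≤q⊔p q 1ℚ)

  width-lipschitz : ∀ p q → ∣ width p - width q ∣ ≤ ∣ p - q ∣
  width-lipschitz p q = ∣≡∣≤
    (solve 2 (λ a b → a :- b := a :- con 1ℚ :- (b :- con 1ℚ)) refl (p ⊔ 1ℚ) (q ⊔ 1ℚ))
    (⊔-lipschitz 1ℚ p q)

  ln-seq : (ℕ → ℚ) → ℕ → ℚ
  ln-seq x n = riemann n 1ℚ (width (x n))

  ln-cauchy : ∀ x → Cauchy x → Cauchy (ln-seq x)
  ln-cauchy x cx δ 0<δ = N , λ m n l l′ →
      ≤-trans (∣-∣-triangle (ln-seq x m) (riemann n 1ℚ (w m)) (ln-seq x n))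
        (≤≡ (half+half δ) (+-mono-≤
          (refine m n (N≥₁ l) (N≥₃ l) (N≥₃ l′))
          (≤-trans (riemann-lipschitz n ≤-refl (0≤width (x m)) ≤-refl (0≤width (x n))
                     (cong₂ _-_ (*-identityʳ (w m)) (*-identityʳ (w n))))
            (≤-trans (width-lipschitz (x m) (x n)) (proj₂ C₂ m n (N≥₂ l) (N≥₂ l′))))))
    where
    w : ℕ → ℚ
    w n = width (x n)
    C₁ = cx 1ℚ 0<1
    C₂ = cx (½ * δ) (half>0 0<δ)
    N₁ = proj₁ C₁
    W = 1ℚ + w N₁
    0≤W : 0ℚ ≤ W
    0≤W = +-mono-≤ 0≤1 (0≤width (x N₁))
    C₃ = ∃½^≤ (*-nonneg 0≤W 0≤W) (half>0 0<δ)
    N₃ = proj₁ C₃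
    N = N₁ ℕ.⊔ proj₁ C₂ ℕ.⊔ N₃
    N≥₁ : ∀ {m} → N ℕ.≤ m → N₁ ℕ.≤ m
    N≥₁ l = ℕ.m⊔n≤o⇒m≤o N₁ _ (ℕ.m⊔n≤o⇒m≤o (N₁ ℕ.⊔ proj₁ C₂) N₃ l)
    N≥₂ : ∀ {m} → N ℕ.≤ m → proj₁ C₂ ℕ.≤ m
    N≥₂ l = ℕ.m⊔n≤o⇒n≤o N₁ _ (ℕ.m⊔n≤o⇒m≤o (N₁ ℕ.⊔ proj₁ C₂) N₃ l)
    N≥₃ : ∀ {m} → N ℕ.≤ m → N₃ ℕ.≤ m
    N≥₃ l = ℕ.m⊔n≤o⇒n≤o (N₁ ℕ.⊔ proj₁ C₂) N₃ l
    w≤W : ∀ m → N₁ ℕ.≤ m → w m ≤ W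
    w≤W m l = subst (_≤ W) (solve 2 (λ a b → a :- b :+ b := a) refl (w m) (w N₁))
      (+-monoˡ-≤ (w N₁) (≤-trans (p≤∣p∣ _)
        (≤-trans (width-lipschitz (x m) (x N₁)) (proj₂ C₁ m N₁ l ℕ.≤-refl))))
    small : ∀ m p → N₁ ℕ.≤ m → N₃ ℕ.≤ p → w m * w m * ½^ p ≤ ½ * δ
    small m p l l₃ = ≤-trans
      (*-mono-≤₀ (*-nonneg (0≤width (x m)) (0≤width (x m))) (½^-nonneg p)
        (*-mono-≤₀ (0≤width (x m)) (0≤width (x m)) (w≤W m l) (w≤W m l)) (½^-antimono l₃))
      (proj₂ C₃)
    refine : ∀ m n → N₁ ℕ.≤ m → N₃ ℕ.≤ m → N₃ ℕ.≤ n →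
      ∣ ln-seq x m - riemann n 1ℚ (w m) ∣ ≤ ½ * δ
    refine m n l l₃ l₃′ with ℕ.≤-total m n
    ... | inj₁ m≤n = subst (_≤ ½ * δ) (∣-∣-comm (riemann n 1ℚ (w m)) (ln-seq x m))
      (subst (λ k → ∣ riemann k 1ℚ (w m) - ln-seq x m ∣ ≤ ½ * δ) (ℕ.m+[n∸m]≡n m≤n)
        (≤-trans (riemann-refine m (n ℕ.∸ m) ≤-refl (0≤width (x m))) (small m m l l₃)))
    ... | inj₂ n≤m = subst (λ k → ∣ riemann k 1ℚ (w m) - riemann n 1ℚ (w m) ∣ ≤ ½ * δ)
      (ℕ.m+[n∸m]≡n n≤m)
      (≤-trans (riemann-refine n (m ℕ.∸ n) ≤-refl (0≤width (x m))) (small m n l l₃′))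

open RiemannLemmas

-- The natural logarithm of a real x ≥ 1, as the limit of Riemann sums for ∫₁ˣ ds/s.
-- Arguments below 1 are replaced by 1; use it only for x ≥ 1.
ln : ℝ → ℝ
ln x = real (ln-seq (seq x)) (ln-cauchy (seq x) (cauchy x))

∑ : ∀ {n} → (Fin n → ℚ) → ℚ
∑ = Sum.sum

record Graph (n : ℕ) : Set₁ where
  infix 4 _~_ _~?_
  field
    _~_      : Rel (Fin n) 0ℓ
    _~?_     : Decidable _~_
    ~-sym    : Symmetric _~_
    ~-irrefl : ∀ {u} → ¬ (u ~ u)

module _ {n} (G : Graph n) where
  open Graph G

  degree : Fin n → ℕ
  degree u = length (filter (u ~?_) (allFin n))

  maxDegree : ℕ
  maxDegree = foldr ℕ._⊔_ 0 (map degree (allFin n))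

  -- Each edge is counted once, at its pair (u , v) with u < v.
  edgeCount : ℕ
  edgeCount = length (filter (λ (u , v) → (u Fin.<? v) ×-dec (u ~? v))
                             (cartesianProduct (allFin n) (allFin n)))

  Connected : Set
  Connected = ∀ u v → Star _~_ u v

walkLength : ∀ {A : Set} {R : Rel A 0ℓ} {u v} → Star R u v → ℕ
walkLength = Star.fold (λ _ _ → ℕ) (λ _ → suc) 0

IsLeast : (ℕ → Set) → ℕ → Set
IsLeast P m = P m × (∀ k → P k → m ℕ.≤ k)

IsMax : ∀ {A : Set} → (A → ℕ → Set) → ℕ → Set
IsMax {A} Value m = (∀ a → ∃[ k ] Value a k × k ℕ.≤ m) × ∃[ a ] Value a m

module _ {n} (G : Graph n) where
  open Graph G

  IsDistance : Fin n × Fin n → ℕ → Set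
  IsDistance (u , v) = IsLeast (λ ℓ → ∃[ w ] walkLength {R = _~_} {u} {v} w ≡ ℓ)

  IsDiameter : ℕ → Set
  IsDiameter = IsMax IsDistance

-- Reachability is decided by Warshall's algorithm.
module Warshall {n} {R : Rel (Fin n) 0ℓ} (R? : Decidable R) where

  -- There is a walk from u to v whose interior vertices all lie in ws.
  Via : List (Fin n) → Rel (Fin n) 0ℓ
  Via []       u v = u ≡ v ⊎ R u v
  Via (w ∷ ws) u v = Via ws u v ⊎ (Via ws u w × Via ws w v)

  via? : ∀ ws → Decidable (Via ws)
  via? []       u v = (u Fin.≟ v) ⊎-dec R? u v
  via? (w ∷ ws) u v = via? ws u v ⊎-dec (via? ws u w ×-dec via? ws w v)

  via⇒star : ∀ ws {u v} → Via ws u v → Star R u v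
  via⇒star []       (inj₁ refl)    = Star.ε
  via⇒star []       (inj₂ r)       = r Star.◅ Star.ε
  via⇒star (w ∷ ws) (inj₁ p)       = via⇒star ws p
  via⇒star (w ∷ ws) (inj₂ (p , q)) = via⇒star ws p Star.◅◅ via⇒star ws q

  lift-base : ∀ ws {u v} → u ≡ v ⊎ R u v → Via ws u v
  lift-base []       b = b
  lift-base (w ∷ ws) b = inj₁ (lift-base ws b)

  to-head : ∀ w ws {u} → Via (w ∷ ws) u w → Via ws u w
  to-head w ws = [ (λ p → p) , proj₁ ]′

  from-head : ∀ w ws {v} → Via (w ∷ ws) w v → Via ws w v
  from-head w ws = [ (λ p → p) , proj₂ ]′

  join : ∀ {w} ws {u v} → w ∈ˡ ws → Via ws u w → Via ws w v → Via ws u v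
  join (x ∷ ws) (here refl) p q = inj₂ (to-head x ws p , from-head x ws q)
  join (x ∷ ws) (there w∈) (inj₁ p)       (inj₁ q)       = inj₁ (join ws w∈ p q)
  join (x ∷ ws) (there w∈) (inj₁ p)       (inj₂ (q , r)) = inj₂ (join ws w∈ p q , r)
  join (x ∷ ws) (there w∈) (inj₂ (p , q)) (inj₁ r)       = inj₂ (p , join ws w∈ q r)
  join (x ∷ ws) (there w∈) (inj₂ (p , _)) (inj₂ (_ , s)) = inj₂ (p , s)

  star⇒via : ∀ {u v} → Star R u v → Via (allFin n) u v
  star⇒via Star.ε                  = lift-base (allFin n) (inj₁ refl)
  star⇒via (Star._◅_ {j = w} r rs) =
    join (allFin n) (∈-allFin w) (lift-base (allFin n) (inj₂ r)) (star⇒via rs)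

  star? : Decidable (Star R)
  star? u v = map′ (via⇒star (allFin n)) star⇒via (via? (allFin n) u v)

subsets : ∀ n → List (Subset n)
subsets zero    = [] ∷ []
subsets (suc n) = map (outside ∷_) (subsets n) ++ map (inside ∷_) (subsets n)

module _ {n} (G : Graph n) where
  open Graph G

  InducedAdjacency : Subset n → Rel (Fin n) 0ℓ
  InducedAdjacency S u v = u ∈ S × v ∈ S × u ~ v

  ConnectedOn : Subset n → Set
  ConnectedOn S = ∀ u → u ∈ S → ∀ v → v ∈ S → Star (InducedAdjacency S) u v

  connectedOn? : ∀ S → Dec (ConnectedOn S)
  connectedOn? S = Fin.all? λ u → (u ∈? S) →-dec Fin.all? λ v → (v ∈? S) →-dec
    Warshall.star? (λ a b → (a ∈? S) ×-dec (b ∈? S) ×-dec (a ~? b)) u v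

  IsConnectedSubgraph : ℕ → Subset n → Set
  IsConnectedSubgraph j S = ∣ S ∣ˢ ≡ j × ConnectedOn S

  isConnectedSubgraph? : ∀ j S → Dec (IsConnectedSubgraph j S)
  isConnectedSubgraph? j S = (∣ S ∣ˢ ℕ.≟ j) ×-dec connectedOn? S

  -- An induced subgraph is determined by its vertex set; the list has no repetitions.
  connectedSubgraphs : ℕ → List (Subset n)
  connectedSubgraphs j = filter (isConnectedSubgraph? j) (subsets n)

  -- Vertex i stands for the i-th connected j-subgraph.  Adjacency |S ∩ T| = j − 1 is
  -- written without subtraction.
  overlapGraph : ∀ j → Graph (length (connectedSubgraphs j))
  overlapGraph j = record
    { _~_      = λ a b → suc ∣ S a ∩ S b ∣ˢ ≡ j
    ; _~?_     = λ a b → suc ∣ S a ∩ S b ∣ˢ ℕ.≟ j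
    ; ~-sym    = λ {a} {b} → trans (cong (λ T → suc ∣ T ∣ˢ) (∩-comm (S b) (S a)))
    ; ~-irrefl = λ {a} eq → ℕ.1+n≢n (trans eq (sym (trans (cong ∣_∣ˢ (∩-idem (S a))) (size a))))
    }
    where
    S : Fin (length (connectedSubgraphs j)) → Subset n
    S = lookup (connectedSubgraphs j)
    size : ∀ a → ∣ S a ∣ˢ ≡ j
    size a = proj₁ (All.lookup (all-filter (isConnectedSubgraph? j) (subsets n)) (∈-lookup a))

  -- By convention the 1-state graph is G itself; the overlap rule for j = 1 would
  -- instead make all pairs of distinct vertices adjacent.
  stateCount : ℕ → ℕ
  stateCount 1 = n
  stateCount j = length (connectedSubgraphs j)

  stateGraph : ∀ j → Graph (stateCount j)
  stateGraph 0               = overlapGraph 0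
  stateGraph 1               = G
  stateGraph j@(suc (suc _)) = overlapGraph j

Matrix : ℕ → Set
Matrix N = Fin N → Fin N → ℚ

infixr 8 _^ᴹ_

_^ᴹ_ : ∀ {N} → Matrix N → ℕ → Matrix N
(P ^ᴹ zero)  x y = if does (x Fin.≟ y) then 1ℚ else 0ℚ
(P ^ᴹ suc ℓ) x y = ∑ λ z → P x z * (P ^ᴹ ℓ) z y

module _ {N} (P : Matrix N) (π : Fin N → ℚ) where

  totalVariation : Fin N → ℕ → ℚ
  totalVariation x ℓ = ½ * ∑ λ y → ∣ (P ^ᴹ ℓ) x y - π y ∣

  -- τₓ(ε) and τ(ε) are predicates because the comparison with a real ε is not decidable.
  IsMixingTimeFrom : ℝ → Fin N → ℕ → Set
  IsMixingTimeFrom ε x = IsLeast λ t → ∀ ℓ → t ℕ.≤ ℓ → ℚ→ℝ (totalVariation x ℓ) ≤ᴿ ε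

  IsMixingTime : ℝ → ℕ → Set
  IsMixingTime ε = IsMax (IsMixingTimeFrom ε)

module _ {n} (G : Graph n) where
  open Graph G

  lazyWalk : Matrix n
  lazyWalk u v =
    if does (u Fin.≟ v) then ½ else
    if does (u ~? v) then ½ * recip (ℕ→ℚ (degree G u)) else 0ℚ

  stationary : Fin n → ℚ
  stationary v = ℕ→ℚ (degree G v) * recip (ℕ→ℚ (2 ℕ.* edgeCount G))

IsPSRWMixingTime : ∀ {n} → Graph n → ℕ → ℝ → ℕ → Set
IsPSRWMixingTime G k = IsMixingTime (lazyWalk H) (stationary H)
  where H = stateGraph G (k ℕ.∸ 1)

{-# OPTIONS --safe #-}

-- For the lazy walk P on a connected graph with degree sum M in which any two vertices are joined
-- by a walk of length at most L, expanding the variance over pairs of vertices and applying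
-- Cauchy–Schwarz along a simple path gives the Poincaré inequality ‖f‖² ≤ M L ⟨(I − P)f, f⟩ for
-- f of mean zero.  As P is positive semidefinite, ‖Pf‖² ≤ (1 − 1/R)² ‖f‖² for every R ≥ M L, so
-- the distance to stationarity from any vertex after ℓ steps is at most ½ (1 − 1/R)^ℓ √M.
-- In G⁽ʲ⁾, j = k − 1, slide a connected j-set along a path of G by exchanging one vertex at a
-- time, and then fill in the target set: walks of length D + j − 1 suffice.  There are at most
-- n (j−1)! Δ^(j−1) states, of degree at most j² Δ, so that R = j! j Δ^j (D + j − 1) n will do; the
-- stated bound is larger by the factor Δ/2 ≥ 1.
-- Logarithms enter only through their left Riemann sums.  By the AM–GM inequality for the factors
-- 1 + w/t of a Riemann sum together with ℓ factors 1 − 1/R, the bound on ℓ turns into a bound on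
-- (1 − 1/R)^ℓ, without real exponentials.
module Submission where

-- All estimates stay in ℚ, without square roots or eigenvectors. Norms therefore occur squared, and
-- √M gives way to an integer X with M ≤ X². The choice X = n^j j Δ is the source of the logarithms
-- in the bound: ln X is exactly j ln n + ln j + ln Δ, and the target distance contributes ln ε⁻¹.
-- The mixing time is an integer, the bound a real number. If the bound y fails for τ = t + 1, all
-- that is known is R (ln X + ln ε⁻¹) ≤ y < t + 1, while the minimality of τ is contradicted only by
-- a small distance after t steps, one step short. The factor ½ of the total variation distance pays
-- for that step, because 1 - 1/R ≥ ½. Comparison with a real ε is undecidable. The existence of τ
-- is thus obtained under a double negation, and the bounds are proved by refuting the opposite
-- strict inequality. Each Riemann sum dominates the logarithm, so the refutation works at every
-- large index of the Cauchy sequences separately and no limit has to be taken.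

-- Order, powers and the embedding of ℕ in ℚ.

module RationalArithmetic where

  open import Data.Nat.Base as ℕ using (ℕ; zero; suc)
  import Data.Nat.Properties as ℕ
  open import Data.Rational.Base
  open import Data.Rational.Properties
  open import Data.Rational.Solver using (module +-*-Solver)
  open import Data.Sum using (inj₁; inj₂)
  open import Relation.Binary.PropositionalEquality using (_≡_; refl; sym; trans; cong; subst)
  open import Relation.Nullary using (yes; no; contradiction)
  open import Algebra.Bundles using (CommutativeRing)
  open import Algebra.Properties.CommutativeSemiring.Exp
    (CommutativeRing.commutativeSemiring +-*-commutativeRing) public using (_^_)
  open import Defs using (ℕ→ℚ; recip; module RationalLemmas; module DyadicLemmas)
  open RationalLemmas using (*-nonneg; *-mono-≤₀; *-recip; >⇒≢; 0≤1; 0<1)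
  open DyadicLemmas using (ℕ→ℚ-suc)
  open +-*-Solver using (solve; _:=_; _:+_; _:*_; _:-_; :-_; con)

  ≤-by : ∀ {p q} e → p + e ≡ q → 0ℚ ≤ e → p ≤ q
  ≤-by {p} e refl 0≤e = subst (_≤ p + e) (+-identityʳ p) (+-monoʳ-≤ p 0≤e)

  ≤⇒0≤- : ∀ {p q} → p ≤ q → 0ℚ ≤ q - p
  ≤⇒0≤- {p} {q} p≤q = subst (_≤ q - p) (+-inverseʳ p) (+-monoˡ-≤ (- p) p≤q)

  square-nonneg : ∀ p → 0ℚ ≤ p * p
  square-nonneg p with ≤-total 0ℚ p
  ... | inj₁ 0≤p = *-nonneg 0≤p 0≤p
  ... | inj₂ p≤0 = subst (0ℚ ≤_) (solve 1 (λ p → (:- p) :* (:- p) := p :* p) refl p)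
                     (*-nonneg (neg-antimono-≤ p≤0) (neg-antimono-≤ p≤0))

  +-nonneg : ∀ {p q} → 0ℚ ≤ p → 0ℚ ≤ q → 0ℚ ≤ p + q
  +-nonneg = +-mono-≤

  square-cancel-≤ : ∀ {p q} → 0ℚ ≤ q → p * p ≤ q * q → p ≤ q
  square-cancel-≤ {p} {q} 0≤q pp≤qq with ≤-total p q
  ... | inj₁ p≤q = p≤q
  ... | inj₂ q≤p with p ≤? q
  ...   | yes p≤q = p≤q
  ...   | no  p≰q = contradiction (<-≤-trans strict pp≤qq) (<-irrefl refl)
    where
    q<p = ≰⇒> p≰q
    strict : q * q < p * p
    strict = ≤-<-trans (*-monoˡ-≤-nonNeg q {{nonNegative 0≤q}} q≤p)
               (*-monoˡ-<-pos p {{positive (≤-<-trans 0≤q q<p)}} q<p)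

  recip-nonneg : ∀ {q} → 0ℚ ≤ q → 0ℚ ≤ recip q
  recip-nonneg {q} 0≤q with q ≟ 0ℚ
  ... | yes _ = ≤-refl
  ... | no q≢0 = <⇒≤ (positive⁻¹ _ {{1/pos⇒pos q {{nonNeg∧nonZero⇒pos q {{nonNegative 0≤q}} {{≢-nonZero q≢0}}}}}})

  ^-nonneg : ∀ {p} n → 0ℚ ≤ p → 0ℚ ≤ p ^ n
  ^-nonneg zero    _   = 0≤1
  ^-nonneg (suc n) 0≤p = *-nonneg 0≤p (^-nonneg n 0≤p)

  ^-mono-≤ : ∀ {p q} n → 0ℚ ≤ p → p ≤ q → p ^ n ≤ q ^ n
  ^-mono-≤ zero    _   _   = ≤-refl
  ^-mono-≤ (suc n) 0≤p p≤q = *-mono-≤₀ 0≤p (^-nonneg n 0≤p) p≤q (^-mono-≤ n 0≤p p≤q)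

  1^n≡1 : ∀ n → 1ℚ ^ n ≡ 1ℚ
  1^n≡1 zero    = refl
  1^n≡1 (suc n) = trans (*-identityˡ (1ℚ ^ n)) (1^n≡1 n)

  ^≤1 : ∀ {p} n → 0ℚ ≤ p → p ≤ 1ℚ → p ^ n ≤ 1ℚ
  ^≤1 {p} n 0≤p p≤1 = subst (p ^ n ≤_) (1^n≡1 n) (^-mono-≤ n 0≤p p≤1)

  ℕ→ℚ-nonneg : ∀ n → 0ℚ ≤ ℕ→ℚ n
  ℕ→ℚ-nonneg zero    = ≤-refl
  ℕ→ℚ-nonneg (suc n) = subst (0ℚ ≤_) (sym (ℕ→ℚ-suc n)) (+-nonneg 0≤1 (ℕ→ℚ-nonneg n))

  ℕ→ℚ-pos : ∀ {n} → 0 ℕ.< n → 0ℚ < ℕ→ℚ n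
  ℕ→ℚ-pos {suc n} _ = subst (0ℚ <_) (sym (ℕ→ℚ-suc n)) (+-mono-<-≤ 0<1 (ℕ→ℚ-nonneg n))

  ℕ→ℚ-+ : ∀ m n → ℕ→ℚ (m ℕ.+ n) ≡ ℕ→ℚ m + ℕ→ℚ n
  ℕ→ℚ-+ zero    n = sym (+-identityˡ (ℕ→ℚ n))
  ℕ→ℚ-+ (suc m) n = trans (ℕ→ℚ-suc (m ℕ.+ n)) (trans (cong (1ℚ +_) (ℕ→ℚ-+ m n))
    (trans (sym (+-assoc 1ℚ (ℕ→ℚ m) (ℕ→ℚ n))) (cong (_+ ℕ→ℚ n) (sym (ℕ→ℚ-suc m)))))

  ℕ→ℚ-* : ∀ m n → ℕ→ℚ (m ℕ.* n) ≡ ℕ→ℚ m * ℕ→ℚ n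
  ℕ→ℚ-* zero    n = sym (*-zeroˡ (ℕ→ℚ n))
  ℕ→ℚ-* (suc m) n = trans (ℕ→ℚ-+ n (m ℕ.* n)) (trans (cong (ℕ→ℚ n +_) (ℕ→ℚ-* m n))
    (trans (solve 2 (λ a b → b :+ a :* b := (con 1ℚ :+ a) :* b) refl (ℕ→ℚ m) (ℕ→ℚ n))
      (cong (_* ℕ→ℚ n) (sym (ℕ→ℚ-suc m)))))

  ℕ→ℚ-^ : ∀ m n → ℕ→ℚ (m ℕ.^ n) ≡ ℕ→ℚ m ^ n
  ℕ→ℚ-^ m zero    = refl
  ℕ→ℚ-^ m (suc n) = trans (ℕ→ℚ-* m (m ℕ.^ n)) (cong (ℕ→ℚ m *_) (ℕ→ℚ-^ m n))

  ℕ→ℚ-mono-≤ : ∀ {m n} → m ℕ.≤ n → ℕ→ℚ m ≤ ℕ→ℚ n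
  ℕ→ℚ-mono-≤ {m} {n} m≤n = ≤-by (ℕ→ℚ (n ℕ.∸ m))
    (trans (sym (ℕ→ℚ-+ m (n ℕ.∸ m))) (cong ℕ→ℚ (ℕ.m+[n∸m]≡n m≤n))) (ℕ→ℚ-nonneg (n ℕ.∸ m))

  recip-cancel : ∀ {q} p → 0ℚ < q → q * (p * recip q) ≡ p
  recip-cancel {q} p 0<q = trans (solve 3 (λ q p r → q :* (p :* r) := p :* (q :* r)) refl q p (recip q))
    (trans (cong (p *_) (*-recip (>⇒≢ 0<q))) (*-identityʳ p))

-- AM-GM and a rational substitute for exponential bounds.

module LogarithmBounds where

  open import Data.Nat.Base as ℕ using (ℕ; zero; suc)
  import Data.Nat.Properties as ℕ
  open import Data.Rational.Base
  open import Data.Rational.Properties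
  open import Data.Rational.Solver using (module +-*-Solver)
  open import Data.Product using (_×_; _,_; ∃-syntax)
  open import Relation.Binary.PropositionalEquality using (_≡_; refl; sym; trans; cong; cong₂; subst; subst₂)
  open import Defs using (ℕ→ℚ; recip; riemann; module RationalLemmas; module DyadicLemmas; module RiemannLemmas)
  open RationalLemmas using (*-nonneg; *-recip; >⇒≢; recip>0; 0≤1; 0<1)
  open DyadicLemmas using (ℕ→ℚ-suc)
  open RiemannLemmas using (1≤t+; half≥0)
  open +-*-Solver using (solve; _:=_; _:+_; _:*_; _:-_; :-_; con)
  open RationalArithmetic

  -- This is AM-GM for `N` copies of `v` and one factor `(N + 1) u − N v`, whose mean is `u`. The
  -- induction step loses exactly `(N + 1) (u − v)²` times `v ^ N`.
  bernoulli : ∀ N {u v} → 0ℚ ≤ u → 0ℚ ≤ v →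
    v ^ N * (ℕ→ℚ (suc N) * u - ℕ→ℚ N * v) ≤ u ^ suc N
  bernoulli zero {u} {v} _ _ = ≤-reflexive
    (solve 2 (λ u v → con 1ℚ :* (con 1ℚ :* u :- con 0ℚ :* v) := u :* con 1ℚ) refl u v)
  bernoulli (suc N) {u} {v} 0≤u 0≤v = ≤-trans
    (≤-by (v ^ N * (ℕ→ℚ (suc N) * ((u - v) * (u - v)))) step
      (*-nonneg (^-nonneg N 0≤v) (*-nonneg (ℕ→ℚ-nonneg (suc N)) (square-nonneg (u - v)))))
    (*-monoˡ-≤-nonNeg u {{nonNegative 0≤u}} (bernoulli N 0≤u 0≤v))
    where
    step : v * v ^ N * (ℕ→ℚ (suc (suc N)) * u - ℕ→ℚ (suc N) * v)
             + v ^ N * (ℕ→ℚ (suc N) * ((u - v) * (u - v)))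
           ≡ u * (v ^ N * (ℕ→ℚ (suc N) * u - ℕ→ℚ N * v))
    step = trans
      (cong₂ (λ a b → v * v ^ N * (a * u - b * v) + v ^ N * (b * ((u - v) * (u - v))))
        (trans (ℕ→ℚ-suc (suc N)) (cong (1ℚ +_) (ℕ→ℚ-suc N))) (ℕ→ℚ-suc N))
      (trans
        (solve 4 (λ u v p n → v :* p :* ((con 1ℚ :+ (con 1ℚ :+ n)) :* u :- (con 1ℚ :+ n) :* v)
                    :+ p :* ((con 1ℚ :+ n) :* ((u :- v) :* (u :- v)))
                  := u :* (p :* ((con 1ℚ :+ n) :* u :- n :* v))) refl u v (v ^ N) (ℕ→ℚ N))
        (cong (λ b → u * (v ^ N * (b * u - ℕ→ℚ N * v))) (sym (ℕ→ℚ-suc N))))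

  -- The largest product of N nonnegative factors with sum s.
  maxProduct : ℕ → ℚ → ℚ
  maxProduct N s = (s * recip (ℕ→ℚ N)) ^ N

  maxProduct-nonneg : ∀ N {s} → 0ℚ ≤ s → 0ℚ ≤ maxProduct N s
  maxProduct-nonneg N 0≤s = ^-nonneg N (*-nonneg 0≤s (recip-nonneg (ℕ→ℚ-nonneg N)))

  -- An inequality rather than an equation because of `N = 0`, where `recip 0ℚ` is `0ℚ` and the left
  -- side vanishes.
  *-mean≤sum : ∀ N {s} → 0ℚ ≤ s → ℕ→ℚ N * (s * recip (ℕ→ℚ N)) ≤ s
  *-mean≤sum zero    {s} 0≤s = subst (_≤ s) (sym (*-zeroˡ (s * recip 0ℚ))) 0≤s
  *-mean≤sum (suc N) {s} 0≤s = ≤-reflexive (recip-cancel s (ℕ→ℚ-pos {suc N} (ℕ.s≤s ℕ.z≤n)))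

  -- Take `bernoulli` with `v` the old mean and `u` the new one: the added factor `y` is at most
  -- `(N + 1) u − N v`, since `N v ≤ s`.
  maxProduct-∷ : ∀ N {s y} → 0ℚ ≤ s → 0ℚ ≤ y → maxProduct N s * y ≤ maxProduct (suc N) (s + y)
  maxProduct-∷ N {s} {y} 0≤s 0≤y = ≤-trans
    (*-monoˡ-≤-nonNeg (v ^ N) {{nonNegative (^-nonneg N 0≤v)}}
      (≤-by (s - ℕ→ℚ N * v) eq (≤⇒0≤- (*-mean≤sum N 0≤s))))
    (bernoulli N 0≤u 0≤v)
    where
    v = s * recip (ℕ→ℚ N)
    u = (s + y) * recip (ℕ→ℚ (suc N))
    0≤v = *-nonneg 0≤s (recip-nonneg (ℕ→ℚ-nonneg N))
    0≤u = *-nonneg (+-nonneg 0≤s 0≤y) (recip-nonneg (ℕ→ℚ-nonneg (suc N)))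
    eq : y + (s - ℕ→ℚ N * v) ≡ ℕ→ℚ (suc N) * u - ℕ→ℚ N * v
    eq = trans (solve 3 (λ y s a → y :+ (s :- a) := s :+ y :- a) refl y s (ℕ→ℚ N * v))
      (cong (_- ℕ→ℚ N * v) (sym (recip-cancel (s + y) (ℕ→ℚ-pos {suc N} (ℕ.s≤s ℕ.z≤n)))))

  maxProduct≤1 : ∀ N {s} → 0ℚ ≤ s → s ≤ ℕ→ℚ N → maxProduct N s ≤ 1ℚ
  maxProduct≤1 zero    _   _   = ≤-refl
  maxProduct≤1 (suc N) {s} 0≤s s≤N = ^≤1 (suc N) (*-nonneg 0≤s 0≤r)
    (≤-trans (*-monoʳ-≤-nonNeg r {{nonNegative 0≤r}} s≤N) (≤-reflexive (*-recip (>⇒≢ 0<N))))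
    where
    0<N = ℕ→ℚ-pos {suc N} (ℕ.s≤s ℕ.z≤n)
    r = recip (ℕ→ℚ (suc N))
    0≤r = <⇒≤ (recip>0 0<N)

  infix 4 _≤exp_

  -- Rational stand-in for x ≤ exp σ: x is bounded by a product of K nonnegative factors with sum
  -- K + σ.  The bound is stated relative to N further factors with sum s, so that it composes.
  _≤exp_ : ℚ → ℚ → Set
  x ≤exp σ = ∃[ K ] 0ℚ ≤ ℕ→ℚ K + σ ×
    (∀ N s → 0ℚ ≤ s → maxProduct N s * x ≤ maxProduct (N ℕ.+ K) (s + (ℕ→ℚ K + σ)))

  -- The tangent bound `y ≤ exp (y − 1)`, witnessed by the single factor `y`. All other bounds of
  -- this kind are composed from it.
  ≤exp-factor : ∀ {y} → 0ℚ ≤ y → y ≤exp y - 1ℚ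
  ≤exp-factor {y} 0≤y = 1 , subst (0ℚ ≤_) (sym eq) 0≤y , λ N s 0≤s →
    subst₂ (λ k z → maxProduct N s * y ≤ maxProduct k (s + z)) (ℕ.+-comm 1 N) (sym eq)
      (maxProduct-∷ N 0≤s 0≤y)
    where
    eq : 1ℚ + (y - 1ℚ) ≡ y
    eq = solve 1 (λ y → con 1ℚ :+ (y :- con 1ℚ) := y) refl y

  ≤exp-1 : 1ℚ ≤exp 0ℚ
  ≤exp-1 = ≤exp-factor 0≤1

  ≤exp-* : ∀ {x y σ τ} → 0ℚ ≤ y → x ≤exp σ → y ≤exp τ → x * y ≤exp σ + τ
  ≤exp-* {x} {y} {σ} {τ} 0≤y (K , 0≤Kσ , hx) (L , 0≤Lτ , hy) =
    K ℕ.+ L , subst (0ℚ ≤_) eq (+-nonneg 0≤Kσ 0≤Lτ) , λ N s 0≤s → ≤-trans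
      (subst (_≤ maxProduct (N ℕ.+ K) (s + (ℕ→ℚ K + σ)) * y) (*-assoc (maxProduct N s) x y)
        (*-monoʳ-≤-nonNeg y {{nonNegative 0≤y}} (hx N s 0≤s)))
      (subst₂ (λ k z → maxProduct (N ℕ.+ K) (s + (ℕ→ℚ K + σ)) * y ≤ maxProduct k z)
        (ℕ.+-assoc N K L)
        (trans (+-assoc s (ℕ→ℚ K + σ) (ℕ→ℚ L + τ)) (cong (s +_) eq))
        (hy (N ℕ.+ K) (s + (ℕ→ℚ K + σ)) (+-nonneg 0≤s 0≤Kσ)))
    where
    eq : (ℕ→ℚ K + σ) + (ℕ→ℚ L + τ) ≡ ℕ→ℚ (K ℕ.+ L) + (σ + τ)
    eq = trans (solve 4 (λ k s l t → (k :+ s) :+ (l :+ t) := (k :+ l) :+ (s :+ t)) refl (ℕ→ℚ K) σ (ℕ→ℚ L) τ)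
      (cong (_+ (σ + τ)) (sym (ℕ→ℚ-+ K L)))

  ≤exp-^ : ∀ {x σ} n → 0ℚ ≤ x → x ≤exp σ → x ^ n ≤exp ℕ→ℚ n * σ
  ≤exp-^ {σ = σ} zero    _   _ = subst (1ℚ ≤exp_) (sym (*-zeroˡ σ)) ≤exp-1
  ≤exp-^ {x} {σ} (suc n) 0≤x h = subst (x ^ suc n ≤exp_)
    (trans (solve 2 (λ n s → s :+ n :* s := (con 1ℚ :+ n) :* s) refl (ℕ→ℚ n) σ)
      (cong (_* σ) (sym (ℕ→ℚ-suc n))))
    (≤exp-* (^-nonneg n 0≤x) h (≤exp-^ n 0≤x h))

  ≤exp-monoˡ : ∀ {x y σ} → y ≤ x → x ≤exp σ → y ≤exp σ
  ≤exp-monoˡ y≤x (K , 0≤Kσ , h) = K , 0≤Kσ , λ N s 0≤s → ≤-trans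
    (*-monoˡ-≤-nonNeg (maxProduct N s) {{nonNegative (maxProduct-nonneg N 0≤s)}} y≤x) (h N s 0≤s)

  -- With no further factors in front, `K > 0` factors of sum `K + σ` have mean at most 1, hence
  -- product at most 1. Here a bound on exponents turns back into a bound on numbers.
  ≤exp⇒≤1 : ∀ {x σ} → x ≤exp σ → σ ≤ 0ℚ → x ≤ 1ℚ
  ≤exp⇒≤1 {x} {σ} (K , 0≤Kσ , h) σ≤0 = subst (_≤ 1ℚ) (*-identityˡ x)
    (≤-trans (h 0 0ℚ ≤-refl) (maxProduct≤1 K (+-nonneg ≤-refl 0≤Kσ)
      (subst₂ _≤_ (sym (+-identityˡ (ℕ→ℚ K + σ))) (+-identityʳ (ℕ→ℚ K)) (+-monoʳ-≤ (ℕ→ℚ K) σ≤0))))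

  -- The quotient telescopes over the subdivision points `tᵢ` into factors `1 + h / tᵢ`, and
  -- `h / tᵢ` is the corresponding term of the left Riemann sum.
  ≤exp-riemann : ∀ m {t w} → 1ℚ ≤ t → 0ℚ ≤ w → (t + w) * recip t ≤exp riemann m t w
  ≤exp-riemann zero {t} {w} 1≤t 0≤w = subst ((t + w) * recip t ≤exp_) eq
      (≤exp-factor (*-nonneg (+-nonneg (<⇒≤ 0<t) 0≤w) (<⇒≤ (recip>0 0<t))))
    where
    0<t = <-≤-trans 0<1 1≤t
    eq : (t + w) * recip t - 1ℚ ≡ w * recip t
    eq = trans (solve 3 (λ t w r → (t :+ w) :* r :- con 1ℚ := w :* r :+ (t :* r :- con 1ℚ)) refl t w (recip t))
      (trans (cong (λ z → w * recip t + (z - 1ℚ)) (*-recip (>⇒≢ 0<t))) (+-identityʳ (w * recip t)))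
  ≤exp-riemann (suc m) {t} {w} 1≤t 0≤w = subst (_≤exp riemann (suc m) t w) eq
      (≤exp-* (*-nonneg (+-nonneg (<⇒≤ 0<m) (half≥0 0≤w)) (<⇒≤ (recip>0 0<m)))
        (≤exp-riemann m 1≤t (half≥0 0≤w))
        (≤exp-riemann m 1≤m (half≥0 0≤w)))
    where
    1≤m : 1ℚ ≤ t + ½ * w
    1≤m = 1≤t+ 1≤t (half≥0 0≤w)
    0<m = <-≤-trans 0<1 1≤m
    eq : (t + ½ * w) * recip t * ((t + ½ * w + ½ * w) * recip (t + ½ * w)) ≡ (t + w) * recip t
    eq = trans
      (solve 4 (λ t w r r' → (t :+ con ½ :* w) :* r :* ((t :+ con ½ :* w :+ con ½ :* w) :* r')
                          := (t :+ w) :* r :* ((t :+ con ½ :* w) :* r')) refl t w (recip t) (recip (t + ½ * w)))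
      (trans (cong ((t + w) * recip t *_) (*-recip (>⇒≢ 0<m))) (*-identityʳ ((t + w) * recip t)))

  -- Clamping the argument of the logarithm at 1 only enlarges the number that gets bounded, so no
  -- assumption `1 ≤ q` arises.
  ≤exp-width : ∀ m q → q ≤exp riemann m 1ℚ (RiemannLemmas.width q)
  ≤exp-width m q = ≤exp-monoˡ q≤ (≤exp-riemann m ≤-refl (RiemannLemmas.0≤width q))
    where
    q≤ : q ≤ (1ℚ + ((q ⊔ 1ℚ) - 1ℚ)) * 1ℚ
    q≤ = subst (q ≤_) (solve 1 (λ y → y := (con 1ℚ :+ (y :- con 1ℚ)) :* con 1ℚ) refl (q ⊔ 1ℚ)) (p≤p⊔q q 1ℚ)

-- Finite sums and double sums over ℚ.

module FiniteSums where

  open import Data.Bool.Base using (if_then_else_)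
  open import Data.Nat.Base using (zero; suc)
  open import Data.Fin.Base using (Fin; zero; suc)
  import Data.Fin.Properties as Fin
  open import Data.Rational.Base
  open import Data.Rational.Properties
  open import Relation.Binary.PropositionalEquality using (_≡_; refl; sym; trans; cong₂; subst)
  open import Relation.Nullary using (does)
  open import Algebra.Bundles using (CommutativeRing)
  import Algebra.Properties.Semiring.Sum (CommutativeRing.semiring +-*-commutativeRing) as Sum
  open import Defs using (∑)
  open RationalArithmetic

  ∑-cong : ∀ {n} {f g : Fin n → ℚ} → (∀ i → f i ≡ g i) → ∑ f ≡ ∑ g
  ∑-cong = Sum.sum-cong-≗

  ∑-+ : ∀ {n} (f g : Fin n → ℚ) → (∑ λ i → f i + g i) ≡ ∑ f + ∑ g
  ∑-+ = Sum.∑-distrib-+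

  ∑-*ˡ : ∀ {n} c (f : Fin n → ℚ) → c * ∑ f ≡ ∑ λ i → c * f i
  ∑-*ˡ = Sum.*-distribˡ-sum

  ∑-*ʳ : ∀ {n} c (f : Fin n → ℚ) → ∑ f * c ≡ ∑ λ i → f i * c
  ∑-*ʳ = Sum.*-distribʳ-sum

  ∑-swap : ∀ {m n} (f : Fin m → Fin n → ℚ) → (∑ λ i → ∑ λ j → f i j) ≡ ∑ λ j → ∑ λ i → f i j
  ∑-swap = Sum.∑-comm

  ∑-mono-≤ : ∀ {n} {f g : Fin n → ℚ} → (∀ i → f i ≤ g i) → ∑ f ≤ ∑ g
  ∑-mono-≤ {zero}  _   = ≤-refl
  ∑-mono-≤ {suc n} f≤g = +-mono-≤ (f≤g zero) (∑-mono-≤ (λ i → f≤g (suc i)))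

  ∑-zero : ∀ n → (∑ {n} λ _ → 0ℚ) ≡ 0ℚ
  ∑-zero = Sum.sum-replicate-zero

  ∑-nonneg : ∀ {n} {f : Fin n → ℚ} → (∀ i → 0ℚ ≤ f i) → 0ℚ ≤ ∑ f
  ∑-nonneg {n} {f} 0≤f = subst (_≤ ∑ f) (∑-zero n) (∑-mono-≤ 0≤f)

  ∑≥term : ∀ {n} {f : Fin n → ℚ} → (∀ i → 0ℚ ≤ f i) → ∀ i → f i ≤ ∑ f
  ∑≥term {suc n} {f} 0≤f zero    = ≤-by (∑ λ i → f (suc i)) refl (∑-nonneg (λ i → 0≤f (suc i)))
  ∑≥term {suc n} {f} 0≤f (suc i) = ≤-trans (∑≥term (λ j → 0≤f (suc j)) i)
    (≤-by (f zero) (+-comm (∑ λ i → f (suc i)) (f zero)) (0≤f zero))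

  δ : ∀ {n} → Fin n → Fin n → ℚ
  δ x y = if does (x Fin.≟ y) then 1ℚ else 0ℚ

  ∑-δ : ∀ {n} x (f : Fin n → ℚ) → (∑ λ y → δ x y * f y) ≡ f x
  ∑-δ {suc n} zero f = trans
    (cong₂ _+_ {1ℚ * f zero} {f zero} (*-identityˡ (f zero))
      (trans (∑-cong (λ y → *-zeroˡ (f (suc y)))) (∑-zero n)))
    (+-identityʳ (f zero))
  ∑-δ {suc n} (suc x) f = trans
    (cong₂ _+_ {0ℚ * f zero} {0ℚ} (*-zeroˡ (f zero)) (∑-δ x (λ y → f (suc y))))
    (+-identityˡ (f (suc x)))

  ∑₂ : ∀ {m n} → (Fin m → Fin n → ℚ) → ℚ
  ∑₂ f = ∑ λ x → ∑ λ y → f x y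

  ∑₂-cong : ∀ {m n} {f g : Fin m → Fin n → ℚ} → (∀ x y → f x y ≡ g x y) → ∑₂ f ≡ ∑₂ g
  ∑₂-cong eq = ∑-cong λ x → ∑-cong λ y → eq x y

  ∑₂-+ : ∀ {m n} (f g : Fin m → Fin n → ℚ) → ∑₂ (λ x y → f x y + g x y) ≡ ∑₂ f + ∑₂ g
  ∑₂-+ f g = trans (∑-cong λ x → ∑-+ (f x) (g x)) (∑-+ (λ x → ∑ (f x)) (λ x → ∑ (g x)))

  ∑₂-*ˡ : ∀ {m n} c (f : Fin m → Fin n → ℚ) → c * ∑₂ f ≡ ∑₂ λ x y → c * f x y
  ∑₂-*ˡ c f = trans (∑-*ˡ c (λ x → ∑ (f x))) (∑-cong λ x → ∑-*ˡ c (f x))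

  ∑₂-mono-≤ : ∀ {m n} {f g : Fin m → Fin n → ℚ} → (∀ x y → f x y ≤ g x y) → ∑₂ f ≤ ∑₂ g
  ∑₂-mono-≤ f≤g = ∑-mono-≤ λ x → ∑-mono-≤ λ y → f≤g x y

  ∑₂-nonneg : ∀ {m n} {f : Fin m → Fin n → ℚ} → (∀ x y → 0ℚ ≤ f x y) → 0ℚ ≤ ∑₂ f
  ∑₂-nonneg 0≤f = ∑-nonneg λ x → ∑-nonneg λ y → 0≤f x y

  ∑₂-product : ∀ {m n} (f : Fin m → ℚ) (g : Fin n → ℚ) → ∑₂ (λ x y → f x * g y) ≡ ∑ f * ∑ g
  ∑₂-product f g = trans (∑-cong λ x → sym (∑-*ˡ (f x) g)) (sym (∑-*ʳ (∑ g) f))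

-- Poincaré inequality, contraction and ℓ¹ convergence for reversible lazy chains.

module SpectralGap where

  open import Data.Nat.Base using (ℕ; zero; suc)
  open import Data.Product using (_×_; _,_; proj₁; proj₂; ∃-syntax)
  open import Data.Sum using (inj₁; inj₂)
  open import Data.Fin.Base using (Fin; zero; suc)
  open import Data.Rational.Base
  open import Data.Rational.Properties
  open import Data.Rational.Solver using (module +-*-Solver)
  open import Relation.Binary.PropositionalEquality using (_≡_; refl; sym; trans; cong; cong₂; subst₂)
  open import Defs using (∑; Matrix; recip; _^ᴹ_; module RationalLemmas)
  open RationalLemmas using (*-nonneg; *-recip; >⇒≢; *-pos)
  open +-*-Solver using (solve; _:=_; _:+_; _:*_; _:-_; :-_; con)
  open RationalArithmetic
  open FiniteSums

  module WeightedGraph {N} (a : Matrix N) (a-sym : ∀ x y → a x y ≡ a y x) (0≤a : ∀ x y → 0ℚ ≤ a x y) where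

    d : Fin N → ℚ
    d x = ∑ (a x)

    0≤d : ∀ x → 0ℚ ≤ d x
    0≤d x = ∑-nonneg (0≤a x)

    volume : ℚ
    volume = ∑ d

    0≤volume : 0ℚ ≤ volume
    0≤volume = ∑-nonneg 0≤d

    mean : (Fin N → ℚ) → ℚ
    mean f = ∑ λ x → d x * f x

    normSq : (Fin N → ℚ) → ℚ
    normSq f = ∑ λ x → d x * (f x * f x)

    -- Equal to 2⟨Pf, g⟩ in the inner product with weights `d`, for the lazy walk P on the weights
    -- `a` (see `inner-apply`).
    form : (Fin N → ℚ) → (Fin N → ℚ) → ℚ
    form f g = ∑₂ λ x y → a x y * ((f x + f y) * g x)

    -- Equal to 4⟨(I - P)f, f⟩: one factor 2 comes from laziness, the other from counting each edge
    -- in both directions.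
    energy : (Fin N → ℚ) → ℚ
    energy f = ∑₂ λ x y → a x y * ((f x - f y) * (f x - f y))

    ∑₂-sym : ∀ (F : Fin N → Fin N → ℚ) → ∑₂ (λ x y → a x y * F x y) ≡ ∑₂ λ x y → a x y * F y x
    ∑₂-sym F = trans (∑-swap (λ x y → a x y * F x y))
      (∑₂-cong λ x y → cong (_* F y x) (a-sym y x))

    ∑₂-sym-avg : ∀ (F : Fin N → Fin N → ℚ) →
      ∑₂ (λ x y → a x y * F x y) + ∑₂ (λ x y → a x y * F x y) ≡ ∑₂ λ x y → a x y * (F x y + F y x)
    ∑₂-sym-avg F = trans (cong (∑₂ (λ x y → a x y * F x y) +_) (∑₂-sym F))
      (trans (sym (∑₂-+ (λ x y → a x y * F x y) (λ x y → a x y * F y x)))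
        (∑₂-cong λ x y → sym (*-distribˡ-+ (a x y) (F x y) (F y x))))

    ∑-d : ∀ (f : Fin N → ℚ) → (∑ λ x → d x * f x) ≡ ∑₂ λ x y → a x y * f x
    ∑-d f = ∑-cong λ x → ∑-*ʳ (f x) (a x)

    form-sym : ∀ f g → form f g ≡ form g f
    form-sym f g = trans (split f g) (trans
      (cong₂ _+_ {∑₂ (λ x y → a x y * (f x * g x))} {∑₂ (λ x y → a x y * (g x * f x))}
        (∑₂-cong λ x y → cong (a x y *_) (*-comm (f x) (g x)))
        (trans (∑₂-sym (λ x y → f y * g x)) (∑₂-cong λ x y → cong (a x y *_) (*-comm (f x) (g y)))))
      (sym (split g f)))
      where
      split : ∀ f g → form f g ≡ ∑₂ (λ x y → a x y * (f x * g x)) + ∑₂ (λ x y → a x y * (f y * g x))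
      split f g = trans
        (∑₂-cong λ x y → solve 4 (λ a p q r → a :* ((p :+ q) :* r) := a :* (p :* r) :+ a :* (q :* r)) refl
          (a x y) (f x) (f y) (g x))
        (∑₂-+ (λ x y → a x y * (f x * g x)) (λ x y → a x y * (f y * g x)))

    -- Symmetrising turns twice the form into a sum of `a x y (f x + f y)²`. Laziness is what makes
    -- these squares appear, and so makes P positive semidefinite.
    form-nonneg : ∀ f → 0ℚ ≤ form f f
    form-nonneg f = *-cancelˡ-≤-pos (1ℚ + 1ℚ) (subst₂ _≤_ (sym (*-zeroʳ (1ℚ + 1ℚ)))
      (sym eq) (∑₂-nonneg λ x y → *-nonneg (0≤a x y) (square-nonneg (f x + f y))))
      where
      eq : (1ℚ + 1ℚ) * form f f ≡ ∑₂ λ x y → a x y * ((f x + f y) * (f x + f y))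
      eq = trans (solve 1 (λ p → (con 1ℚ :+ con 1ℚ) :* p := p :+ p) refl (form f f))
        (trans (∑₂-sym-avg (λ x y → (f x + f y) * f x))
          (∑₂-cong λ x y → cong (a x y *_)
            (solve 2 (λ p q → (p :+ q) :* p :+ (q :+ p) :* q := (p :+ q) :* (p :+ q)) refl (f x) (f y))))

    energy-nonneg : ∀ f → 0ℚ ≤ energy f
    energy-nonneg f = ∑₂-nonneg λ x y → *-nonneg (0≤a x y) (square-nonneg (f x - f y))

    -- The identity ⟨(I - P)f, f⟩ + ⟨Pf, f⟩ = ‖f‖², times 4; termwise it is
    -- `(p − q)² + (p + q)² = 2 (p² + q²)`.
    energy+form : ∀ f → energy f + (form f f + form f f) ≡ (normSq f + normSq f) + (normSq f + normSq f)
    energy+form f = trans (cong (energy f +_) (∑₂-sym-avg (λ x y → (f x + f y) * f x)))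
      (trans (sym (∑₂-+ (λ x y → a x y * ((f x - f y) * (f x - f y)))
                        (λ x y → a x y * ((f x + f y) * f x + (f y + f x) * f y))))
        (trans (∑₂-cong λ x y → solve 3 (λ a p q → a :* ((p :- q) :* (p :- q)) :+ a :* ((p :+ q) :* p :+ (q :+ p) :* q)
                 := a :* (p :* p :+ q :* q) :+ a :* (p :* p :+ q :* q)) refl (a x y) (f x) (f y))
          (trans (∑₂-+ (λ x y → a x y * (f x * f x + f y * f y)) (λ x y → a x y * (f x * f x + f y * f y)))
            (cong₂ _+_ {∑₂ λ x y → a x y * (f x * f x + f y * f y)} {normSq f + normSq f} eq eq))))
      where
      eq : (∑₂ λ x y → a x y * (f x * f x + f y * f y)) ≡ normSq f + normSq f
      eq = trans (sym (∑₂-sym-avg (λ x y → f x * f x)))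
        (sym (cong₂ _+_ {normSq f} {∑₂ (λ x y → a x y * (f x * f x))} (∑-d (λ x → f x * f x)) (∑-d (λ x → f x * f x))))

    form-expand : ∀ c f g → form (λ x → c * f x - g x) (λ x → c * f x - g x)
      ≡ c * c * form f f + (- c * form f g + (- c * form g f + form g g))
    form-expand c f g = trans
      (∑₂-cong λ x y → solve 6 (λ a c p q r s → a :* ((c :* p :- r :+ (c :* q :- s)) :* (c :* p :- r))
          := c :* c :* (a :* ((p :+ q) :* p)) :+ (:- c :* (a :* ((p :+ q) :* r))
             :+ (:- c :* (a :* ((r :+ s) :* p)) :+ a :* ((r :+ s) :* r)))) refl
        (a x y) c (f x) (f y) (g x) (g y))
      (trans (∑₂-+ {N} {N} (λ x y → c * c * F x y) (λ x y → - c * G x y + (- c * H x y + I x y)))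
      (cong₂ _+_ {∑₂ λ x y → c * c * F x y} {c * c * form f f} (sym (∑₂-*ˡ (c * c) F))
        (trans (∑₂-+ {N} {N} (λ x y → - c * G x y) (λ x y → - c * H x y + I x y))
          (cong₂ _+_ {∑₂ λ x y → - c * G x y} {(- c) * form f g} (sym (∑₂-*ˡ (- c) G))
            (trans (∑₂-+ {N} {N} (λ x y → - c * H x y) I) (cong (_+ form g g) (sym (∑₂-*ˡ (- c) H))))))))
      where
      F G H I : Fin N → Fin N → ℚ
      F x y = a x y * ((f x + f y) * f x)
      G x y = a x y * ((f x + f y) * g x)
      H x y = a x y * ((g x + g y) * f x)
      I x y = a x y * ((g x + g y) * g x)

    -- Expanding the square leaves the cross term -2 `(mean f)²`, which vanishes.
    variance-identity : ∀ f → mean f ≡ 0ℚ →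
      (∑₂ λ x y → d x * d y * ((f x - f y) * (f x - f y))) ≡ volume * normSq f + volume * normSq f
    variance-identity f mean≡0 = trans
      (∑₂-cong λ x y → solve 4 (λ p q u v → p :* q :* ((u :- v) :* (u :- v))
          := p :* (u :* u) :* q :+ (p :* (q :* (v :* v)) :+ (:- con 1ℚ :- con 1ℚ) :* (p :* u :* (q :* v)))) refl
        (d x) (d y) (f x) (f y))
      (trans (∑₂-+ {N} {N} F (λ x y → G x y + (- 1ℚ - 1ℚ) * H x y))
        (trans (cong₂ _+_ {∑₂ F} {normSq f * volume} (∑₂-product (λ x → d x * (f x * f x)) d)
          (trans (∑₂-+ {N} {N} G (λ x y → (- 1ℚ - 1ℚ) * H x y))
            (cong₂ _+_ {∑₂ G} {volume * normSq f} (∑₂-product d (λ x → d x * (f x * f x)))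
              (trans (sym (∑₂-*ˡ (- 1ℚ - 1ℚ) H))
                (cong ((- 1ℚ - 1ℚ) *_) (trans (∑₂-product (λ x → d x * f x) (λ x → d x * f x))
                  (cong (_* mean f) mean≡0)))))))
          (solve 3 (λ v n m → n :* v :+ (v :* n :+ (:- con 1ℚ :- con 1ℚ) :* (con 0ℚ :* m)) := v :* n :+ v :* n) refl
            volume (normSq f) (mean f))))
      where
      F G H : Fin N → Fin N → ℚ
      F x y = d x * (f x * f x) * d y
      G x y = d x * (d y * (f y * f y))
      H x y = d x * f x * (d y * f y)

    -- Averaging the path bound over all pairs with weights `d x * d y` produces the variance on the
    -- left and `volume`² on the right, and one `volume` cancels. The factor 2 in the path bound
    -- reflects that `energy` contains every edge twice.
    poincare : ∀ {L} → 0ℚ < volume → ∀ f → mean f ≡ 0ℚ →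
      (∀ x y → (1ℚ + 1ℚ) * ((f x - f y) * (f x - f y)) ≤ L * energy f) →
      (1ℚ + 1ℚ) * (1ℚ + 1ℚ) * normSq f ≤ volume * L * energy f
    poincare {L} 0<vol f mean≡0 path = *-cancelˡ-≤-pos volume {{positive 0<vol}} (subst₂ _≤_ lhs rhs
      (∑₂-mono-≤ λ x y → *-monoˡ-≤-nonNeg (d x * d y) {{nonNegative (*-nonneg (0≤d x) (0≤d y))}} (path x y)))
      where
      lhs : (∑₂ λ x y → d x * d y * ((1ℚ + 1ℚ) * ((f x - f y) * (f x - f y))))
            ≡ volume * ((1ℚ + 1ℚ) * (1ℚ + 1ℚ) * normSq f)
      lhs = trans
        (∑₂-cong λ x y → solve 2 (λ p q → p :* ((con 1ℚ :+ con 1ℚ) :* q) := (con 1ℚ :+ con 1ℚ) :* (p :* q)) refl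
          (d x * d y) ((f x - f y) * (f x - f y)))
        (trans (sym (∑₂-*ˡ {N} {N} (1ℚ + 1ℚ) (λ x y → d x * d y * ((f x - f y) * (f x - f y)))))
          (trans (cong ((1ℚ + 1ℚ) *_) (variance-identity f mean≡0))
            (solve 2 (λ v n → (con 1ℚ :+ con 1ℚ) :* (v :* n :+ v :* n)
                      := v :* ((con 1ℚ :+ con 1ℚ) :* (con 1ℚ :+ con 1ℚ) :* n)) refl volume (normSq f))))
      rhs : (∑₂ λ x y → d x * d y * (L * energy f)) ≡ volume * (volume * L * energy f)
      rhs = trans (∑₂-cong λ x y → solve 3 (λ p q l → p :* q :* l := l :* (p :* q)) refl (d x) (d y) (L * energy f))
        (trans (sym (∑₂-*ˡ {N} {N} (L * energy f) (λ x y → d x * d y)))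
          (trans (cong (L * energy f *_) (∑₂-product d d))
            (solve 3 (λ l e v → l :* e :* (v :* v) := v :* (v :* l :* e)) refl L (energy f) volume)))

    -- The hypothesis `lazy` is P = ½ (I + D⁻¹A) multiplied through by the degrees, so that it
    -- expresses both laziness and reversibility without division.
    module Contraction
      {R L} (0<R : 0ℚ < R) (0<volume : 0ℚ < volume) (vol*L≤R : volume * L ≤ R)
      (path : ∀ f x y → (1ℚ + 1ℚ) * ((f x - f y) * (f x - f y)) ≤ L * energy f)
      (0<d : ∀ x → 0ℚ < d x)
      (P : Matrix N) (lazy : ∀ x y → d x * P x y ≡ ½ * (δ x y * d x + a x y)) where

      rate : ℚ
      rate = 1ℚ - recip R

      -- Replacing `energy f` by 4‖f‖² - 2 `form f f` in the Poincaré inequality and solving for the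
      -- form gives ⟨Pf, f⟩ ≤ (1 - 1/R)‖f‖².
      spectral-gap : ∀ f → mean f ≡ 0ℚ → form f f ≤ (rate + rate) * normSq f
      spectral-gap f mean≡0 = *-cancelˡ-≤-pos (R + R) {{positive (+-mono-< 0<R 0<R)}}
        (≤-by (R * energy f - (1ℚ + 1ℚ) * (1ℚ + 1ℚ) * normSq f) eq (≤⇒0≤- (≤-trans
          (poincare 0<volume f mean≡0 (path f))
          (*-monoʳ-≤-nonNeg (energy f) {{nonNegative (energy-nonneg f)}} vol*L≤R))))
        where
        eq : (R + R) * form f f + (R * energy f - (1ℚ + 1ℚ) * (1ℚ + 1ℚ) * normSq f)
             ≡ (R + R) * ((rate + rate) * normSq f)
        eq = trans
          (solve 4 (λ r b e n → (r :+ r) :* b :+ (r :* e :- (con 1ℚ :+ con 1ℚ) :* (con 1ℚ :+ con 1ℚ) :* n)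
              := r :* (e :+ (b :+ b)) :- (n :+ n :+ (n :+ n)) :* con 1ℚ) refl R (form f f) (energy f) (normSq f))
          (trans (cong₂ (λ u v → R * u - (normSq f + normSq f + (normSq f + normSq f)) * v)
              (energy+form f) (sym (*-recip (>⇒≢ 0<R))))
            (solve 3 (λ r n s → r :* (n :+ n :+ (n :+ n)) :- (n :+ n :+ (n :+ n)) :* (r :* s)
               := (r :+ r) :* ((con 1ℚ :- s :+ (con 1ℚ :- s)) :* n)) refl R (normSq f) (recip R)))

      apply : (Fin N → ℚ) → Fin N → ℚ
      apply f x = ∑ λ y → P x y * f y

      inner-apply : ∀ f g → (∑ λ x → d x * (apply f x * g x)) ≡ ½ * form f g
      inner-apply f g = trans (∑-cong pointwise) (sym (∑-*ˡ ½ (λ x → ∑ λ y → a x y * ((f x + f y) * g x))))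
        where
        pointwise : ∀ x → d x * (apply f x * g x) ≡ ½ * ∑ (λ y → a x y * ((f x + f y) * g x))
        pointwise x = trans (cong (λ z → d x * z) (∑-*ʳ (g x) (λ y → P x y * f y)))
          (trans (∑-*ˡ (d x) (λ y → P x y * f y * g x))
          (trans (∑-cong λ y → trans
              (solve 4 (λ d p u v → d :* (p :* u :* v) := d :* p :* (u :* v)) refl (d x) (P x y) (f y) (g x))
              (trans (cong (_* (f y * g x)) (lazy x y))
                (solve 5 (λ e d a u v → con ½ :* (e :* d :+ a) :* (u :* v)
                     := con ½ :* (e :* (d :* (u :* v)) :+ a :* (u :* v))) refl
                  (δ x y) (d x) (a x y) (f y) (g x))))
          (trans (sym (∑-*ˡ ½ (λ y → δ x y * (d x * (f y * g x)) + a x y * (f y * g x))))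
            (cong (½ *_) (trans (∑-+ (λ y → δ x y * (d x * (f y * g x))) (λ y → a x y * (f y * g x)))
              (trans (cong (_+ ∑ (λ y → a x y * (f y * g x))) (trans (∑-δ x (λ y → d x * (f y * g x)))
                  (∑-*ʳ (f x * g x) (a x))))
                (trans (sym (∑-+ (λ y → a x y * (f x * g x)) (λ y → a x y * (f y * g x))))
                  (∑-cong λ y → solve 4 (λ a p q r → a :* (p :* r) :+ a :* (q :* r) := a :* ((p :+ q) :* r)) refl
                    (a x y) (f x) (f y) (g x)))))))))

      -- Self-adjointness against the constant function: ⟨Pf, 1⟩ = ⟨f, P1⟩ = ⟨f, 1⟩. It keeps the
      -- iterates in the space on which the spectral gap holds.
      mean-apply : ∀ f → mean f ≡ 0ℚ → mean (apply f) ≡ 0ℚ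
      mean-apply f mean≡0 = trans (∑-cong λ x → cong (d x *_) (sym (*-identityʳ (apply f x))))
        (trans (inner-apply f (λ _ → 1ℚ))
          (trans (cong (½ *_) (form-sym f (λ _ → 1ℚ))) (trans (cong (½ *_) eq)
            (trans (solve 1 (λ m → con ½ :* (m :+ m) := m) refl (mean f)) mean≡0))))
        where
        eq : form (λ _ → 1ℚ) f ≡ mean f + mean f
        eq = trans (∑₂-cong λ x y → solve 2 (λ a p → a :* ((con 1ℚ :+ con 1ℚ) :* p) := a :* p :+ a :* p) refl
                     (a x y) (f x))
          (trans (∑₂-+ {N} {N} (λ x y → a x y * f x) (λ x y → a x y * f x))
            (sym (cong₂ _+_ {mean f} {∑₂ λ x y → a x y * f x} (∑-d f) (∑-d f))))

      -- Cauchy–Schwarz for the positive semidefinite form ⟨P·,·⟩, in the shape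
      -- 0 ≤ ⟨P(cf − Pf), cf − Pf⟩, upgrades ⟨Pf,f⟩ ≤ c‖f‖² to ‖Pf‖² ≤ c²‖f‖².
      contraction : 0ℚ < rate → ∀ f → mean f ≡ 0ℚ → normSq (apply f) ≤ rate * rate * normSq f
      contraction 0<c f mean≡0 = *-cancelˡ-≤-pos (c + c) {{positive (+-mono-< 0<c 0<c)}}
        -- The gap enters for `f` and for `Pf`, to bound the two diagonal terms of `form h h`; the
        -- mixed terms contribute -4c‖Pf‖², of which 2c‖Pf‖² goes into the second use of the gap.
        (≤-by (form h h + c * c * ((c + c) * normSq f - form f f) + ((c + c) * normSq g - form g g))
          eq
          (+-nonneg (+-nonneg (form-nonneg h)
            (*-nonneg (<⇒≤ (*-pos 0<c 0<c)) (≤⇒0≤- (spectral-gap f mean≡0))))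
            (≤⇒0≤- (spectral-gap g (mean-apply f mean≡0)))))
        where
        c = rate
        g = apply f
        h : Fin N → ℚ
        h x = c * f x - g x
        norm-g : normSq g + normSq g ≡ form f g
        norm-g = trans (cong (λ z → z + z) (inner-apply f g)) (RationalLemmas.half+half (form f g))
        eq : (c + c) * normSq g
               + (form h h + c * c * ((c + c) * normSq f - form f f) + ((c + c) * normSq g - form g g))
             ≡ (c + c) * (c * c * normSq f)
        eq = trans (cong (λ z → (c + c) * normSq g
               + (z + c * c * ((c + c) * normSq f - form f f) + ((c + c) * normSq g - form g g)))
               (trans (form-expand c f g)
                 (cong₂ (λ u v → c * c * form f f + (- c * u + (- c * v + form g g)))
                   (sym norm-g) (trans (form-sym g f) (sym norm-g)))))
          (solve 5 (λ c n ff m gg → (c :+ c) :* n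
               :+ (c :* c :* ff :+ (:- c :* (n :+ n) :+ (:- c :* (n :+ n) :+ gg))
                   :+ c :* c :* ((c :+ c) :* m :- ff) :+ ((c :+ c) :* n :- gg))
              := (c :+ c) :* (c :* c :* m)) refl c (normSq g) (form f f) (normSq f) (form g g))

      power : ℕ → (Fin N → ℚ) → Fin N → ℚ
      power ℓ f x = ∑ λ y → (P ^ᴹ ℓ) x y * f y

      power-suc : ∀ ℓ f x → power (suc ℓ) f x ≡ apply (power ℓ f) x
      power-suc ℓ f x = trans (∑-cong λ y → ∑-*ʳ (f y) (λ z → P x z * (P ^ᴹ ℓ) z y))
        (trans (∑-swap (λ y z → P x z * (P ^ᴹ ℓ) z y * f y))
          (∑-cong λ z → trans (∑-cong λ y → *-assoc (P x z) ((P ^ᴹ ℓ) z y) (f y))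
            (sym (∑-*ˡ (P x z) (λ y → (P ^ᴹ ℓ) z y * f y)))))

      decay : 0ℚ < rate → ∀ ℓ f → mean f ≡ 0ℚ →
        mean (power ℓ f) ≡ 0ℚ × normSq (power ℓ f) ≤ rate ^ ℓ * rate ^ ℓ * normSq f
      decay 0<c zero f mean≡0 =
        trans (∑-cong λ x → cong (d x *_) (∑-δ x f)) mean≡0 ,
        ≤-reflexive (trans (∑-cong λ x → cong (λ z → d x * (z * z)) (∑-δ x f))
          (sym (*-identityˡ (normSq f))))
      decay 0<c (suc ℓ) f mean≡0 with decay 0<c ℓ f mean≡0
      ... | mean≡0′ , bound =
        trans (∑-cong λ x → cong (d x *_) (power-suc ℓ f x)) (mean-apply (power ℓ f) mean≡0′) ,
        subst₂ _≤_ (sym (∑-cong λ x → cong (λ z → d x * (z * z)) (power-suc ℓ f x)))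
          (solve 3 (λ c p n → c :* c :* (p :* p :* n) := c :* p :* (c :* p) :* n) refl rate (rate ^ ℓ) (normSq f))
          (≤-trans (contraction 0<c (power ℓ f) mean≡0′)
            (*-monoˡ-≤-nonNeg (rate * rate) {{nonNegative (square-nonneg rate)}} bound))

      -- Lets the constant subtracted from a sign pattern pass unchanged through Pˡ.
      row-sum : ∀ ℓ x → ∑ ((P ^ᴹ ℓ) x) ≡ 1ℚ
      row-sum zero    x = trans (∑-cong λ y → sym (*-identityʳ (δ x y))) (∑-δ x (λ _ → 1ℚ))
      row-sum (suc ℓ) x = trans (∑-swap (λ y z → P x z * (P ^ᴹ ℓ) z y))
        (trans (∑-cong λ z → trans (sym (∑-*ˡ (P x z) ((P ^ᴹ ℓ) z)))
                  (trans (cong (P x z *_) (row-sum ℓ z)) (*-identityʳ (P x z))))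
          (*-cancelˡ-≡ (d x) (0<d x) (trans (trans (∑-*ˡ (d x) (P x)) (trans (∑-cong (lazy x))
            (trans (sym (∑-*ˡ ½ (λ y → δ x y * d x + a x y)))
              (trans (cong (½ *_) (trans (∑-+ (λ y → δ x y * d x) (a x)) (cong (_+ d x) (∑-δ x (λ _ → d x)))))
                (solve 1 (λ d → con ½ :* (d :+ d) := d) refl (d x)))))) (sym (*-identityʳ (d x))))))
        where
        *-cancelˡ-≡ : ∀ r {p q} → 0ℚ < r → r * p ≡ r * q → p ≡ q
        *-cancelˡ-≡ r 0<r eq = ≤-antisym (*-cancelˡ-≤-pos r {{positive 0<r}} (≤-reflexive eq))
          (*-cancelˡ-≤-pos r {{positive 0<r}} (≤-reflexive (sym eq)))

      stationary-law : Fin N → ℚ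
      stationary-law y = d y * recip volume

      -- Makes an absolute sum linear: it becomes a pairing with a fixed ±1 pattern, to which the
      -- decay of mean-zero functions applies.
      signs : ∀ {n} (q : Fin n → ℚ) → ∃[ s ] (∀ y → s y * s y ≡ 1ℚ) × (∀ y → ∣ q y ∣ ≡ q y * s y)
      signs q = (λ y → proj₁ (sign (q y))) , (λ y → proj₁ (proj₂ (sign (q y)))) , (λ y → proj₂ (proj₂ (sign (q y))))
        where
        sign : ∀ p → ∃[ s ] s * s ≡ 1ℚ × ∣ p ∣ ≡ p * s
        sign p with ∣p∣≡p∨∣p∣≡-p p
        ... | inj₁ eq = 1ℚ , refl , trans eq (sym (*-identityʳ p))
        ... | inj₂ eq = - 1ℚ , refl , trans eq (solve 1 (λ p → :- p := p :* (:- con 1ℚ)) refl p)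

      -- The ℓ¹ distance is the value at x of Pˡ applied to the centred sign pattern of Pˡ(x,·) − π.
      ℓ¹-bound : 0ℚ < rate → ∀ x → 1ℚ ≤ d x → ∀ {X} → 0ℚ ≤ X → volume ≤ X * X → ∀ ℓ →
        (∑ λ y → ∣ (P ^ᴹ ℓ) x y - stationary-law y ∣) ≤ rate ^ ℓ * X
      ℓ¹-bound 0<c x 1≤dx {X} 0≤X vol≤X² ℓ with signs (λ y → (P ^ᴹ ℓ) x y - stationary-law y)
      -- Squares are compared, so that `X` can stand for the square root of `volume`.
      ... | s , s² , abs = square-cancel-≤ (*-nonneg (^-nonneg ℓ (<⇒≤ 0<c)) 0≤X) (begin
          T * T                              ≡⟨ cong (λ z → z * z) T≡ ⟩
          u * u                              ≡⟨ *-identityˡ (u * u) ⟨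
          -- A value at one vertex is controlled by the whole weighted norm because the weight there
          -- is at least 1.
          1ℚ * (u * u)                       ≤⟨ *-monoʳ-≤-nonNeg (u * u) {{nonNegative (square-nonneg u)}} 1≤dx ⟩
          d x * (u * u)                      ≤⟨ ∑≥term (λ z → *-nonneg (0≤d z) (square-nonneg (power ℓ g z))) x ⟩
          normSq (power ℓ g)                 ≤⟨ proj₂ (decay 0<c ℓ g mean-g) ⟩
          r * r * normSq g                   ≤⟨ *-monoˡ-≤-nonNeg (r * r) {{nonNegative (square-nonneg r)}}
                                                  (≤-trans norm-g vol≤X²) ⟩
          r * r * (X * X)                    ≡⟨ solve 2 (λ r x → r :* r :* (x :* x) := r :* x :* (r :* x)) refl r X ⟩
          r * X * (r * X)                    ∎)
        where
        open ≤-Reasoning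
        r = rate ^ ℓ
        T = ∑ λ y → ∣ (P ^ᴹ ℓ) x y - stationary-law y ∣
        m = ∑ λ y → stationary-law y * s y
        g : Fin N → ℚ
        g y = s y - m
        u = power ℓ g x
        mean-s : mean s ≡ volume * m
        mean-s = sym (trans (∑-*ˡ volume (λ y → stationary-law y * s y)) (∑-cong λ y → trans
          (solve 4 (λ v d r s → v :* (d :* r :* s) := v :* (d :* s :* r)) refl volume (d y) (recip volume) (s y))
          (recip-cancel (d y * s y) 0<volume)))
        sum-const : ∀ c → (∑ λ y → d y * c) ≡ volume * c
        sum-const c = sym (∑-*ʳ c d)
        mean-g : mean g ≡ 0ℚ
        mean-g = trans (∑-cong λ y → solve 3 (λ d s m → d :* (s :- m) := d :* s :+ d :* (:- m)) refl (d y) (s y) m)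
          (trans (∑-+ (λ y → d y * s y) (λ y → d y * (- m)))
            (trans (cong₂ _+_ {mean s} {volume * m} mean-s (sum-const (- m)))
              (solve 2 (λ v m → v :* m :+ v :* (:- m) := con 0ℚ) refl volume m)))
        -- A pattern of signs has squared norm `volume`, and centring lowers it by
        -- `volume * (m * m)`.
        norm-g : normSq g ≤ volume
        norm-g = ≤-by (volume * (m * m)) (trans (cong (_+ volume * (m * m)) (trans
            (∑-cong λ y → trans
              (solve 3 (λ d s m → d :* ((s :- m) :* (s :- m))
                 := d :* (s :* s) :+ (d :* s :* (:- m :- m) :+ d :* (m :* m))) refl (d y) (s y) m)
              (cong (λ z → d y * z + (d y * s y * (- m - m) + d y * (m * m))) (s² y)))
            (trans (∑-+ (λ y → d y * 1ℚ) (λ y → d y * s y * (- m - m) + d y * (m * m)))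
              (cong₂ _+_ {∑ λ y → d y * 1ℚ} {volume * 1ℚ} (sum-const 1ℚ)
                (trans (∑-+ (λ y → d y * s y * (- m - m)) (λ y → d y * (m * m)))
                  (cong₂ _+_ {∑ λ y → d y * s y * (- m - m)} {volume * m * (- m - m)}
                    (trans (sym (∑-*ʳ (- m - m) (λ y → d y * s y))) (cong (_* (- m - m)) mean-s))
                    (sum-const (m * m))))))))
            (solve 2 (λ v m → v :* con 1ℚ :+ (v :* m :* (:- m :- m) :+ v :* (m :* m)) :+ v :* (m :* m) := v) refl
              volume m))
          (*-nonneg 0≤volume (square-nonneg m))
        T≡ : T ≡ u
        T≡ = trans (∑-cong λ y → trans (abs y)
               (solve 3 (λ p w s → (p :- w) :* s := p :* s :+ (:- con 1ℚ) :* (w :* s)) refl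
                 ((P ^ᴹ ℓ) x y) (stationary-law y) (s y)))
          (trans (∑-+ (λ y → (P ^ᴹ ℓ) x y * s y) (λ y → - 1ℚ * (stationary-law y * s y)))
            (trans (cong (∑ (λ y → (P ^ᴹ ℓ) x y * s y) +_)
                (trans (sym (∑-*ˡ (- 1ℚ) (λ y → stationary-law y * s y)))
                  (trans (solve 1 (λ m → (:- con 1ℚ) :* m := con 1ℚ :* (:- m)) refl m)
                    (trans (cong (_* (- m)) (sym (row-sum ℓ x))) (∑-*ʳ (- m) ((P ^ᴹ ℓ) x))))))
              (trans (sym (∑-+ (λ y → (P ^ᴹ ℓ) x y * s y) (λ y → (P ^ᴹ ℓ) x y * (- m))))
                (∑-cong λ y → sym (*-distribˡ-+ ((P ^ᴹ ℓ) x y) (s y) (- m))))))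

-- Simple walks and Cauchy-Schwarz along them.

module Walks where

  open import Data.Bool.Base using (if_then_else_)
  open import Data.Nat.Base as ℕ using (ℕ; suc)
  open import Data.Fin.Base using (Fin; suc)
  import Data.Nat.Properties as ℕ
  import Data.Fin.Properties as Fin
  open import Data.Rational.Base
  open import Data.Rational.Properties
  open import Data.Rational.Solver using (module +-*-Solver)
  open import Data.Product using (_×_; _,_; ∃-syntax; Σ-syntax)
  open import Data.Sum using (_⊎_; inj₁; inj₂)
  open import Data.Unit.Base using (⊤; tt)
  open import Level using (0ℓ)
  open import Relation.Binary.Core using (Rel)
  open import Relation.Binary.PropositionalEquality using (_≡_; _≢_; refl; sym; trans; cong; cong₂)
  open import Relation.Nullary using (does; yes; no; contradiction)
  open import Defs using (ℕ→ℚ; recip; Matrix; module RationalLemmas; module DyadicLemmas)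
  open RationalLemmas using (*-nonneg)
  open +-*-Solver using (solve; _:=_; _:+_; _:*_; _:-_; :-_; con)
  open RationalArithmetic
  open FiniteSums

  -- Walks of length at most L.
  data Walk {A : Set} (R : Rel A 0ℓ) : ℕ → Rel A 0ℓ where
    stop : ∀ {L x} → Walk R L x x
    step : ∀ {L x y z} → R x y → Walk R L y z → Walk R (suc L) x z

  module _ {A : Set} {R : Rel A 0ℓ} where

    weaken : ∀ {L M x y} → L ℕ.≤ M → Walk R L x y → Walk R M x y
    weaken _           stop       = stop
    weaken (ℕ.s≤s L≤M) (step r w) = step r (weaken L≤M w)

    infixr 5 _++ʷ_

    _++ʷ_ : ∀ {L M x y z} → Walk R L x y → Walk R M y z → Walk R (L ℕ.+ M) x z
    _++ʷ_ {L} {M} stop v = weaken (ℕ.m≤n+m M L) v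
    step r w ++ʷ v = step r (w ++ʷ v)

    Avoids : ∀ {L x y} → A → Walk R L x y → Set
    Avoids u (stop {x = x})     = u ≢ x
    Avoids u (step {x = x} _ w) = u ≢ x × Avoids u w

    avoids-source : ∀ {L x y u} (w : Walk R L x y) → Avoids u w → u ≢ x
    avoids-source stop       u≢x       = u≢x
    avoids-source (step _ _) (u≢x , _) = u≢x

    Simple : ∀ {L x y} → Walk R L x y → Set
    Simple stop               = ⊤
    Simple (step {x = x} _ w) = Avoids x w × Simple w

    weaken-avoids : ∀ {L M x y u} (L≤M : L ℕ.≤ M) (w : Walk R L x y) → Avoids u w → Avoids u (weaken L≤M w)
    weaken-avoids _           stop       av         = av
    weaken-avoids (ℕ.s≤s L≤M) (step r w) (u≢x , av) = u≢x , weaken-avoids L≤M w av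

    weaken-simple : ∀ {L M x y} (L≤M : L ℕ.≤ M) (w : Walk R L x y) → Simple w → Simple (weaken L≤M w)
    weaken-simple _           stop       _         = tt
    weaken-simple (ℕ.s≤s L≤M) (step r w) (av , si) = weaken-avoids L≤M w av , weaken-simple L≤M w si

  module _ {N} {R : Rel (Fin N) 0ℓ} where

    -- The dichotomy behind `loop-erase`: either `u` may be put in front without spoiling
    -- simplicity, or the walk already visits `u` and is cut there.
    suffix : ∀ {L x z} u (w : Walk R L x z) → Simple w → Avoids u w ⊎ Σ[ w′ ∈ Walk R L u z ] Simple w′
    suffix u (stop {x = x}) _ with u Fin.≟ x
    ... | yes refl = inj₂ (stop , tt)
    ... | no  u≢x  = inj₁ u≢x
    suffix {suc L} u (step {x = x} r w) si@(_ , si′) with u Fin.≟ x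
    ... | yes refl = inj₂ (step r w , si)
    ... | no  u≢x  with suffix u w si′
    ...   | inj₁ av        = inj₁ (u≢x , av)
    ...   | inj₂ (w′ , s′) = inj₂ (weaken (ℕ.n≤1+n L) w′ , weaken-simple (ℕ.n≤1+n L) w′ s′)

    loop-erase : ∀ {L x z} → Walk R L x z → Σ[ w ∈ Walk R L x z ] Simple w
    loop-erase stop = stop , tt
    loop-erase {suc L} (step {x = x} r w) with loop-erase w
    ... | w′ , s′ with suffix x w′ s′
    ...   | inj₁ av        = step r w′ , av , s′
    ...   | inj₂ (v , s″)  = weaken (ℕ.n≤1+n L) v , weaken-simple (ℕ.n≤1+n L) v s″

    cost : Matrix N → ∀ {L x z} → Walk R L x z → ℚ
    cost q stop                       = 0ℚ
    cost q (step {x = x} {y = y} _ w) = q x y + cost q w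

    -- Deletes the vertex `x` from the weights. The part of a simple walk after `x` keeps its cost,
    -- while the weights at `x` become free to pay for the first edge.
    mask : Fin N → Matrix N → Matrix N
    mask x q u v = if does (x Fin.≟ u) then 0ℚ else if does (x Fin.≟ v) then 0ℚ else q u v

    mask-nonneg : ∀ x q → (∀ u v → 0ℚ ≤ q u v) → ∀ u v → 0ℚ ≤ mask x q u v
    mask-nonneg x q 0≤q u v with x Fin.≟ u | x Fin.≟ v
    ... | yes _ | _     = ≤-refl
    ... | no  _ | yes _ = ≤-refl
    ... | no  _ | no  _ = 0≤q u v

    mask-sym : ∀ x q → (∀ u v → q u v ≡ q v u) → ∀ u v → mask x q u v ≡ mask x q v u
    mask-sym x q q-sym u v with x Fin.≟ u | x Fin.≟ v
    ... | yes _ | yes _ = refl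
    ... | yes _ | no  _ = refl
    ... | no  _ | yes _ = refl
    ... | no  _ | no  _ = q-sym u v

    mask-≢ : ∀ x q {u v} → x ≢ u → x ≢ v → mask x q u v ≡ q u v
    mask-≢ x q {u} {v} x≢u x≢v with x Fin.≟ u | x Fin.≟ v
    ... | yes x≡u | _       = contradiction x≡u x≢u
    ... | no  _   | yes x≡v = contradiction x≡v x≢v
    ... | no  _   | no  _   = refl

    cost-mask : ∀ u q {L x z} (w : Walk R L x z) → Avoids u w → cost (mask u q) w ≡ cost q w
    cost-mask u q stop       _          = refl
    cost-mask u q (step r w) (u≢x , av) =
      cong₂ _+_ (mask-≢ u q u≢x (avoids-source w av)) (cost-mask u q w av)

    -- Both `(x , y)` and `(y , x)` are masked entries, and `x ≢ y` makes them different, so each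
    -- can be given back once.
    mask-remove : ∀ {x y} → x ≢ y → ∀ q → (∀ u v → 0ℚ ≤ q u v) → (∀ u v → q u v ≡ q v u) → ∀ u v →
      mask x q u v + (δ x u * (δ y v * q x y) + δ y u * (δ x v * q x y)) ≤ q u v
    mask-remove {x} {y} x≢y q 0≤q q-sym u v with x Fin.≟ u | x Fin.≟ v | y Fin.≟ u | y Fin.≟ v
    ... | yes refl | yes refl | yes refl | _        = contradiction refl x≢y
    ... | yes refl | yes refl | no _     | yes refl = contradiction refl x≢y
    ... | yes refl | no  _    | yes refl | _        = contradiction refl x≢y
    ... | no  _    | yes refl | _        | yes refl = contradiction refl x≢y
    ... | yes refl | yes refl | no _     | no _     = ≤-trans (≤-reflexive
      (solve 1 (λ p → con 0ℚ :+ (con 1ℚ :* (con 0ℚ :* p) :+ con 0ℚ :* (con 1ℚ :* p)) := con 0ℚ) refl (q x y))) (0≤q x x)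
    ... | yes refl | no  _    | no _     | yes refl = ≤-reflexive
      (solve 1 (λ p → con 0ℚ :+ (con 1ℚ :* (con 1ℚ :* p) :+ con 0ℚ :* (con 0ℚ :* p)) := p) refl (q x y))
    ... | yes refl | no  _    | no _     | no  _    = ≤-trans (≤-reflexive
      (solve 1 (λ p → con 0ℚ :+ (con 1ℚ :* (con 0ℚ :* p) :+ con 0ℚ :* (con 0ℚ :* p)) := con 0ℚ) refl (q x y))) (0≤q x v)
    ... | no  _    | yes refl | yes refl | no _     = ≤-reflexive (trans
      (solve 1 (λ p → con 0ℚ :+ (con 0ℚ :* (con 0ℚ :* p) :+ con 1ℚ :* (con 1ℚ :* p)) := p) refl (q x y)) (q-sym x y))
    ... | no  _    | yes refl | no _     | no _     = ≤-trans (≤-reflexive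
      (solve 1 (λ p → con 0ℚ :+ (con 0ℚ :* (con 0ℚ :* p) :+ con 0ℚ :* (con 1ℚ :* p)) := con 0ℚ) refl (q x y))) (0≤q u x)
    ... | no  _    | no  _    | yes _    | yes _    = ≤-reflexive
      (solve 2 (λ r p → r :+ (con 0ℚ :* (con 1ℚ :* p) :+ con 1ℚ :* (con 0ℚ :* p)) := r) refl (q u v) (q x y))
    ... | no  _    | no  _    | yes _    | no  _    = ≤-reflexive
      (solve 2 (λ r p → r :+ (con 0ℚ :* (con 0ℚ :* p) :+ con 1ℚ :* (con 0ℚ :* p)) := r) refl (q u v) (q x y))
    ... | no  _    | no  _    | no  _    | yes _    = ≤-reflexive
      (solve 2 (λ r p → r :+ (con 0ℚ :* (con 1ℚ :* p) :+ con 0ℚ :* (con 0ℚ :* p)) := r) refl (q u v) (q x y))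
    ... | no  _    | no  _    | no  _    | no  _    = ≤-reflexive
      (solve 2 (λ r p → r :+ (con 0ℚ :* (con 0ℚ :* p) :+ con 0ℚ :* (con 0ℚ :* p)) := r) refl (q u v) (q x y))

    -- A simple walk uses an edge at most once, whereas the double sum of a symmetric `q` contains
    -- it in both directions; hence two copies of the cost fit. The induction masks the vertex just
    -- left.
    cost≤total : ∀ {L x z} (w : Walk R L x z) → Simple w → ∀ q →
      (∀ u v → 0ℚ ≤ q u v) → (∀ u v → q u v ≡ q v u) → cost q w + cost q w ≤ ∑₂ q
    cost≤total stop _ q 0≤q _ = ∑₂-nonneg 0≤q
    cost≤total (step {x = x} {y = y} _ w) (av , si) q 0≤q q-sym = begin
        q x y + cost q w + (q x y + cost q w)
          ≡⟨ solve 2 (λ p c → p :+ c :+ (p :+ c) := c :+ c :+ (p :+ p)) refl (q x y) (cost q w) ⟩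
        cost q w + cost q w + (q x y + q x y)
          ≡⟨ cong (λ c → c + c + (q x y + q x y)) (cost-mask x q w av) ⟨
        cost q′ w + cost q′ w + (q x y + q x y)
          ≤⟨ +-monoˡ-≤ (q x y + q x y) (cost≤total w si q′ (mask-nonneg x q 0≤q) (mask-sym x q q-sym)) ⟩
        ∑₂ q′ + (q x y + q x y)
          ≡⟨ cong (∑₂ q′ +_) (trans (∑₂-+ {N} {N} (E x y) (E y x)) (cong₂ _+_ (∑₂-E x y) (∑₂-E y x))) ⟨
        ∑₂ q′ + ∑₂ (λ u v → E x y u v + E y x u v)
          ≡⟨ ∑₂-+ q′ (λ u v → E x y u v + E y x u v) ⟨
        ∑₂ (λ u v → q′ u v + (E x y u v + E y x u v))
          ≤⟨ ∑₂-mono-≤ (mask-remove (avoids-source w av) q 0≤q q-sym) ⟩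
        ∑₂ q ∎
      where
      open ≤-Reasoning
      q′ = mask x q
      E : Fin N → Fin N → Fin N → Fin N → ℚ
      E s t u v = δ s u * (δ t v * q x y)
      ∑₂-E : ∀ s t → ∑₂ (E s t) ≡ q x y
      ∑₂-E s t = trans (∑-cong λ u → trans (sym (∑-*ˡ (δ s u) (λ v → δ t v * q x y)))
        (cong (δ s u *_) (∑-δ t (λ _ → q x y)))) (∑-δ s (λ _ → q x y))

    -- Dual form of (f x − f z)² ≤ L · cost, which telescopes without division.
    increment-dual : ∀ (f : Fin N → ℚ) q → (∀ {u v} → R u v → (f u - f v) * (f u - f v) ≤ q u v) →
      ∀ {L x z} (w : Walk R L x z) s → (s + s) * (f x - f z) ≤ s * s * ℕ→ℚ L + cost q w
    increment-dual f q edge {L} {x} stop s = ≤-by (s * s * ℕ→ℚ L)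
      (solve 3 (λ s a b → (s :+ s) :* (a :- a) :+ s :* s :* b := s :* s :* b :+ con 0ℚ) refl s (f x) (ℕ→ℚ L))
      (*-nonneg (square-nonneg s) (ℕ→ℚ-nonneg L))
    increment-dual f q edge {suc L} {z = z} (step {x = x} {y = y} r w) s = ≤-by
      -- For the first edge, with increment `a`, the bound is `2 s a ≤ s² + a²`; its defect is the
      -- square `(s − a)²`.
      ((s - (f x - f y)) * (s - (f x - f y)) + (q x y - (f x - f y) * (f x - f y))
        + (s * s * ℕ→ℚ L + cost q w - (s + s) * (f y - f z)))
      (trans
        (solve 7 (λ s a b c l p k → (s :+ s) :* (a :- c)
            :+ ((s :- (a :- b)) :* (s :- (a :- b)) :+ (p :- (a :- b) :* (a :- b))
              :+ (s :* s :* l :+ k :- (s :+ s) :* (b :- c)))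
          := s :* s :* (con 1ℚ :+ l) :+ (p :+ k)) refl s (f x) (f y) (f z) (ℕ→ℚ L) (q x y) (cost q w))
        (cong (λ l → s * s * l + (q x y + cost q w)) (sym (DyadicLemmas.ℕ→ℚ-suc L))))
      (+-nonneg (+-nonneg (square-nonneg (s - (f x - f y))) (≤⇒0≤- (edge r)))
        (≤⇒0≤- (increment-dual f q edge w s)))

    increment-bound : ∀ (f : Fin N → ℚ) q → (∀ {u v} → R u v → (f u - f v) * (f u - f v) ≤ q u v) →
      (∀ u v → 0ℚ ≤ q u v) → (∀ u v → q u v ≡ q v u) →
      ∀ {L x z} → 0 ℕ.< L → Walk R L x z → (1ℚ + 1ℚ) * ((f x - f z) * (f x - f z)) ≤ ℕ→ℚ L * ∑₂ q
    increment-bound f q edge 0≤q q-sym {L} {x} {z} 0<L w with loop-erase w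
    ... | w′ , si = begin
        (1ℚ + 1ℚ) * (b * b)                                     ≡⟨ cong (λ c → (1ℚ + 1ℚ) * (c * b)) (recip-cancel b (ℕ→ℚ-pos 0<L)) ⟨
        (1ℚ + 1ℚ) * (l * s * b)                                 ≡⟨ solve 3 (λ l s b → (con 1ℚ :+ con 1ℚ) :* (l :* s :* b)
                                                                     := l :* ((s :+ s) :* b :+ (s :+ s) :* b :- (s :+ s) :* b)) refl l s b ⟩
        l * ((s + s) * b + (s + s) * b - (s + s) * b)           ≤⟨ *-monoˡ-≤-nonNeg l {{nonNegative 0≤l}} (+-monoˡ-≤ (- ((s + s) * b)) (+-mono-≤ dual dual)) ⟩
        l * (s * s * l + k + (s * s * l + k) - (s + s) * b)     ≡⟨ solve 4 (λ l s k b → l :* (s :* s :* l :+ k :+ (s :* s :* l :+ k) :- (s :+ s) :* b)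
                                                                     := l :* (k :+ k) :+ l :* (s :+ s) :* (l :* s :- b)) refl l s k b ⟩
        l * (k + k) + l * (s + s) * (l * s - b)                 ≡⟨ cong (λ c → l * (k + k) + l * (s + s) * (c - b)) (recip-cancel b (ℕ→ℚ-pos 0<L)) ⟩
        l * (k + k) + l * (s + s) * (b - b)                     ≡⟨ solve 3 (λ m c b → m :+ c :* (b :- b) := m) refl (l * (k + k)) (l * (s + s)) b ⟩
        l * (k + k)                                             ≤⟨ *-monoˡ-≤-nonNeg l {{nonNegative 0≤l}} (cost≤total w′ si q 0≤q q-sym) ⟩
        l * ∑₂ q                                                ∎
      where
      open ≤-Reasoning
      b = f x - f z
      l = ℕ→ℚ L
      0≤l = ℕ→ℚ-nonneg L
      -- The optimal parameter: `s² L` becomes `s b`, so the dual bound reduces to `s b ≤ k`, that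
      -- is `b² ≤ L k`.
      s = b * recip l
      k = cost q w′
      dual : (s + s) * b ≤ s * s * l + k
      dual = increment-dual f q edge w′ s

-- The lazy random walk as a weighted graph.

module LazyRandomWalk where

  open import Data.Bool.Base using (if_then_else_)
  open import Data.Nat.Base as ℕ using (ℕ; zero; suc)
  import Data.Nat.Properties as ℕ
  open import Data.Fin.Base using (Fin; zero; suc)
  import Data.Fin.Base as Fin
  import Data.Fin.Properties as Fin
  open import Data.List.Base using (_++_; cartesianProduct; filter; length; map; tabulate)
  open import Data.List.Properties using (filter-++; length-++; map-tabulate)
  open import Data.Rational.Base
  open import Data.Rational.Properties
  open import Data.Rational.Solver using (module +-*-Solver)
  open import Data.Product using (_×_; _,_)
  open import Function.Base using (id; _∘_)
  open import Level using (0ℓ)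
  open import Relation.Binary.PropositionalEquality using (_≡_; refl; sym; trans; cong; cong₂; subst; subst₂)
  open import Relation.Nullary using (Dec; does; yes; no; contradiction; _×-dec_)
  open import Relation.Unary using (Pred) renaming (Decidable to Decidable₁)
  open import Defs using (ℕ→ℚ; recip; ∑; _^ᴹ_; Matrix; Graph; degree; edgeCount; lazyWalk; stationary; totalVariation;
    module RationalLemmas; module DyadicLemmas)
  open RationalLemmas using (*-nonneg; *-recip; >⇒≢; recip>0; 0≤1)
  open DyadicLemmas using (ℕ→ℚ-suc)
  open +-*-Solver using (solve; _:=_; _:+_; _:*_; _:-_; :-_; con)
  open RationalArithmetic
  open FiniteSums
  open SpectralGap
  open Walks

  indicator : ∀ {P : Set} → Dec P → ℚ
  indicator P? = if does P? then 1ℚ else 0ℚ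

  indicator-nonneg : ∀ {P : Set} (P? : Dec P) → 0ℚ ≤ indicator P?
  indicator-nonneg (yes _) = 0≤1
  indicator-nonneg (no  _) = ≤-refl

  module _ {A : Set} {P : Pred A 0ℓ} (P? : Decidable₁ P) where

    length-filter-tabulate : ∀ {n} (f : Fin n → A) →
      ℕ→ℚ (length (filter P? (tabulate f))) ≡ ∑ λ i → indicator (P? (f i))
    length-filter-tabulate {zero}  f = refl
    length-filter-tabulate {suc n} f with P? (f zero)
    ... | yes _ = trans (ℕ→ℚ-suc (length (filter P? (tabulate (f ∘ suc)))))
                    (cong (1ℚ +_) (length-filter-tabulate (f ∘ suc)))
    ... | no  _ = trans (length-filter-tabulate (f ∘ suc)) (sym (+-identityˡ (∑ λ i → indicator (P? (f (suc i))))))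

    length-filter-++ : ∀ xs ys → ℕ→ℚ (length (filter P? (xs ++ ys)))
      ≡ ℕ→ℚ (length (filter P? xs)) + ℕ→ℚ (length (filter P? ys))
    length-filter-++ xs ys = trans
      (cong ℕ→ℚ (trans (cong length (filter-++ P? xs ys)) (length-++ (filter P? xs))))
      (ℕ→ℚ-+ (length (filter P? xs)) (length (filter P? ys)))

  length-filter-product : ∀ {A B : Set} {P : Pred (A × B) 0ℓ} (P? : Decidable₁ P) {m n} (f : Fin m → A) (g : Fin n → B) →
    ℕ→ℚ (length (filter P? (cartesianProduct (tabulate f) (tabulate g)))) ≡ ∑₂ λ i j → indicator (P? (f i , g j))
  length-filter-product P? {zero}  f g = refl
  length-filter-product P? {suc m} f g = trans
    (length-filter-++ P? (map (f zero ,_) (tabulate g)) (cartesianProduct (tabulate (f ∘ suc)) (tabulate g)))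
    (cong₂ _+_ {ℕ→ℚ (length (filter P? (map (f zero ,_) (tabulate g))))} {∑ λ j → indicator (P? (f zero , g j))}
      (trans (cong (λ xs → ℕ→ℚ (length (filter P? xs))) (map-tabulate g (f zero ,_)))
        (length-filter-tabulate P? (λ j → f zero , g j)))
      (length-filter-product P? (f ∘ suc) g))

  ∑-const : ∀ n c → (∑ {n} λ _ → c) ≡ ℕ→ℚ n * c
  ∑-const zero    c = sym (*-zeroˡ c)
  ∑-const (suc n) c = trans (cong (c +_) (∑-const n c))
    (trans (solve 2 (λ c n → c :+ n :* c := (con 1ℚ :+ n) :* c) refl c (ℕ→ℚ n)) (cong (_* c) (sym (ℕ→ℚ-suc n))))

  module _ {N} (H : Graph N) where
    open Graph H

    adjacency : Matrix N
    adjacency u v = indicator (u ~? v)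

    adjacency-sym : ∀ u v → adjacency u v ≡ adjacency v u
    adjacency-sym u v with u ~? v | v ~? u
    ... | yes _   | yes _   = refl
    ... | yes u~v | no  v≁u = contradiction (~-sym u~v) v≁u
    ... | no  u≁v | yes v~u = contradiction (~-sym v~u) u≁v
    ... | no  _   | no  _   = refl

    adjacency-nonneg : ∀ u v → 0ℚ ≤ adjacency u v
    adjacency-nonneg u v = indicator-nonneg (u ~? v)

    open WeightedGraph adjacency adjacency-sym adjacency-nonneg

    degree-sum : ∀ u → ℕ→ℚ (degree H u) ≡ d u
    degree-sum u = length-filter-tabulate (u ~?_) id

    -- Exactly one of the two orders of an edge is increasing, so the indicator of increasing edges
    -- and its transpose add up to the adjacency matrix.
    handshake : ℕ→ℚ (2 ℕ.* edgeCount H) ≡ volume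
    handshake = trans (ℕ→ℚ-* 2 (edgeCount H))
      (trans (cong (ℕ→ℚ 2 *_) (length-filter-product ordered? id id))
        (trans (solve 1 (λ s → con (ℕ→ℚ 2) :* s := s :+ s) refl (∑₂ λ u v → indicator (ordered? (u , v))))
          (trans (cong (∑₂ (λ u v → indicator (ordered? (u , v))) +_) (∑-swap λ u v → indicator (ordered? (u , v))))
            (trans (sym (∑₂-+ {N} {N} (λ u v → indicator (ordered? (u , v))) (λ u v → indicator (ordered? (v , u)))))
              (∑₂-cong pointwise)))))
      where
      ordered? : Decidable₁ (λ ((u , v) : Fin N × Fin N) → u Fin.< v × u ~ v)
      ordered? (u , v) = (u Fin.<? v) ×-dec (u ~? v)
      pointwise : ∀ u v → indicator (ordered? (u , v)) + indicator (ordered? (v , u)) ≡ adjacency u v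
      pointwise u v = split (u Fin.<? v) (v Fin.<? u) (u ~? v) (v ~? u)
        where
        split : (p? : Dec (u Fin.< v)) (q? : Dec (v Fin.< u)) (r? : Dec (u ~ v)) (s? : Dec (v ~ u)) →
          indicator (p? ×-dec r?) + indicator (q? ×-dec s?) ≡ indicator r?
        split (yes u<v) (yes v<u) _         _         = contradiction v<u (ℕ.<-asym u<v)
        split _         _         (yes u~v) (no  v≁u) = contradiction (~-sym u~v) v≁u
        split _         _         (no  u≁v) (yes v~u) = contradiction (~-sym v~u) u≁v
        split (no  u≮v) (no  v≮u) (yes u~v) (yes _)   = contradiction
          (subst (u ~_) (sym (Fin.toℕ-injective (ℕ.≤-antisym (ℕ.≮⇒≥ v≮u) (ℕ.≮⇒≥ u≮v)))) u~v) ~-irrefl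
        split (no  _)   (no  _)   (no  _)   (no  _)   = refl
        split (yes _)   (no  _)   (yes _)   (yes _)   = refl
        split (yes _)   (no  _)   (no  _)   (no  _)   = refl
        split (no  _)   (yes _)   (yes _)   (yes _)   = refl
        split (no  _)   (yes _)   (no  _)   (no  _)   = refl

    lazyWalk-balance : (∀ x → 0ℚ < d x) → ∀ x y → d x * lazyWalk H x y ≡ ½ * (δ x y * d x + adjacency x y)
    lazyWalk-balance 0<d x y with x Fin.≟ y | x ~? y
    ... | yes refl | yes x~x = contradiction x~x ~-irrefl
    ... | yes refl | no  _   = solve 1 (λ d → d :* con ½ := con ½ :* (con 1ℚ :* d :+ con 0ℚ)) refl (d x)
    ... | no  _    | yes _   = trans (cong (λ z → d x * (½ * recip z)) (degree-sum x))
      (trans (recip-cancel ½ (0<d x)) (solve 1 (λ d → con ½ := con ½ :* (con 0ℚ :* d :+ con 1ℚ)) refl (d x)))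
    ... | no  _    | no  _   = solve 1 (λ d → d :* con 0ℚ := con ½ :* (con 0ℚ :* d :+ con 0ℚ)) refl (d x)

    -- The product `N * B` serves twice as a bound on the degree sum: times `L` for the relaxation
    -- constant `R`, and below `X * X` for the initial norm.
    totalVariation-bound : ∀ {L B R X} → (∀ u v → Walk _~_ L u v) → 0 ℕ.< L →
      (∀ u → 1 ℕ.≤ degree H u) → (∀ u → degree H u ℕ.≤ B) → N ℕ.* B ℕ.* L ℕ.≤ R → N ℕ.* B ℕ.≤ X ℕ.* X → 1 ℕ.< R →
      ∀ x ℓ → totalVariation (lazyWalk H) (stationary H) x ℓ ≤ ½ * ((1ℚ - recip (ℕ→ℚ R)) ^ ℓ * ℕ→ℚ X)
    totalVariation-bound {L} {B} {R} {X} walks 0<L 1≤deg deg≤B NBL≤R NB≤X² 1<R x ℓ =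
      *-monoˡ-≤-nonNeg ½ (subst (_≤ (1ℚ - recip (ℕ→ℚ R)) ^ ℓ * ℕ→ℚ X)
        (∑-cong λ y → cong (λ z → ∣ (lazyWalk H ^ᴹ ℓ) x y - z ∣)
          (cong₂ (λ p q → p * recip q) (sym (degree-sum y)) (sym handshake)))
        (C.ℓ¹-bound 0<rate x (1≤d x) (ℕ→ℚ-nonneg X)
          (≤-trans volume≤NB (subst (ℕ→ℚ (N ℕ.* B) ≤_) (ℕ→ℚ-* X X) (ℕ→ℚ-mono-≤ NB≤X²))) ℓ))
      where
      1≤d : ∀ u → 1ℚ ≤ d u
      1≤d u = subst (1ℚ ≤_) (degree-sum u) (ℕ→ℚ-mono-≤ (1≤deg u))
      0<d : ∀ u → 0ℚ < d u
      0<d u = <-≤-trans RationalLemmas.0<1 (1≤d u)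
      volume≤NB : volume ≤ ℕ→ℚ (N ℕ.* B)
      volume≤NB = subst (volume ≤_) (trans (∑-const N (ℕ→ℚ B)) (sym (ℕ→ℚ-* N B)))
        (∑-mono-≤ λ u → subst (_≤ ℕ→ℚ B) (degree-sum u) (ℕ→ℚ-mono-≤ (deg≤B u)))
      volume*L≤R : volume * ℕ→ℚ L ≤ ℕ→ℚ R
      volume*L≤R = ≤-trans (*-monoʳ-≤-nonNeg (ℕ→ℚ L) {{nonNegative (ℕ→ℚ-nonneg L)}} volume≤NB)
        (subst (_≤ ℕ→ℚ R) (ℕ→ℚ-* (N ℕ.* B) L) (ℕ→ℚ-mono-≤ NBL≤R))
      path : ∀ f u v → (1ℚ + 1ℚ) * ((f u - f v) * (f u - f v)) ≤ ℕ→ℚ L * energy f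
      path f u v = increment-bound f q edge q-nonneg q-sym 0<L (walks u v)
        where
        q : Matrix N
        q s t = adjacency s t * ((f s - f t) * (f s - f t))
        edge : ∀ {s t} → s ~ t → (f s - f t) * (f s - f t) ≤ q s t
        edge {s} {t} s~t with s ~? t
        ... | yes _   = ≤-reflexive (sym (*-identityˡ ((f s - f t) * (f s - f t))))
        ... | no  s≁t = contradiction s~t s≁t
        q-nonneg : ∀ s t → 0ℚ ≤ q s t
        q-nonneg s t = *-nonneg (adjacency-nonneg s t) (square-nonneg (f s - f t))
        q-sym : ∀ s t → q s t ≡ q t s
        q-sym s t = cong₂ _*_ {adjacency s t} {adjacency t s} (adjacency-sym s t)
          (solve 2 (λ a b → (a :- b) :* (a :- b) := (b :- a) :* (b :- a)) refl (f s) (f t))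
      0<R = ℕ→ℚ-pos {R} (ℕ.<-trans (ℕ.s≤s ℕ.z≤n) 1<R)
      module C = Contraction 0<R (<-≤-trans (0<d x) (∑≥term 0≤d x)) volume*L≤R path 0<d
                   (lazyWalk H) (lazyWalk-balance 0<d)
      -- Strict positivity allows `contraction` to cancel a factor of the rate.
      0<rate : 0ℚ < 1ℚ - recip (ℕ→ℚ R)
      0<rate = subst (_< 1ℚ - recip (ℕ→ℚ R)) (+-inverseʳ (recip (ℕ→ℚ R))) (+-monoˡ-< (- recip (ℕ→ℚ R))
        (subst₂ _<_ (*-identityˡ (recip (ℕ→ℚ R))) (*-recip (>⇒≢ 0<R))
          (*-monoˡ-<-pos (recip (ℕ→ℚ R)) {{positive (recip>0 0<R)}} 1<ℚR)))
        where
        1<ℚR : 1ℚ < ℕ→ℚ R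
        1<ℚR = <-≤-trans (subst (1ℚ <_) (sym (ℕ→ℚ-suc 1)) (+-monoʳ-< 1ℚ RationalLemmas.0<1)) (ℕ→ℚ-mono-≤ 1<R)

-- Connected vertex sets and single-vertex exchanges.

module ConnectedSets where

  open import Data.Nat.Base using (ℕ; zero; suc; _+_; _∸_; _≤_; _<_)
  import Data.Nat.Properties as ℕ
  open import Data.Fin.Base using (Fin; zero; suc)
  open import Data.Fin.Subset
  open import Data.Fin.Subset.Properties
  open import Data.Product using (_×_; _,_; proj₁; proj₂; ∃-syntax)
  open import Data.Sum using (_⊎_; inj₁; inj₂)
  open import Data.Vec.Base using (_∷_; here; there)
  open import Level using (0ℓ)
  open import Relation.Binary.Construct.Closure.ReflexiveTransitive as Star using (Star; ε; _◅_; _◅◅_)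
  open import Relation.Binary.Core using (Rel)
  open import Relation.Binary.PropositionalEquality using (_≡_; refl; sym; trans; cong; subst; subst₂)
  open import Relation.Nullary using (yes; no; contradiction)
  open import Defs using (Graph; Connected; InducedAdjacency; ConnectedOn; IsConnectedSubgraph; walkLength)
  open Walks

  infixl 6 _▷_

  _▷_ : ∀ {n} → Subset n → Fin n → Subset n
  S ▷ w = S ∪ ⁅ w ⁆

  module _ {n : ℕ} where

    ∈-▷ˡ : ∀ {S : Subset n} {u} w → u ∈ S → u ∈ S ▷ w
    ∈-▷ˡ w u∈S = p⊆p∪q ⁅ w ⁆ u∈S

    ∈-▷ʳ : ∀ (S : Subset n) w → w ∈ S ▷ w
    ∈-▷ʳ S w = q⊆p∪q S ⁅ w ⁆ (x∈⁅x⁆ w)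

    ∈-▷⁻ : ∀ {S : Subset n} {u} w → u ∈ S ▷ w → u ∈ S ⊎ u ≡ w
    ∈-▷⁻ {S} w u∈ with x∈p∪q⁻ S ⁅ w ⁆ u∈
    ... | inj₁ u∈S = inj₁ u∈S
    ... | inj₂ u∈w = inj₂ (x∈⁅y⁆⇒x≡y w u∈w)

    ▷-⊆ : ∀ {S T : Subset n} {w} → S ⊆ T → w ∈ T → S ▷ w ⊆ T
    ▷-⊆ {w = w} S⊆T w∈T u∈ with ∈-▷⁻ w u∈
    ... | inj₁ u∈S  = S⊆T u∈S
    ... | inj₂ refl = w∈T

  ∣▷∣ : ∀ {n} {S : Subset n} {w} → w ∉ S → ∣ S ▷ w ∣ ≡ suc ∣ S ∣
  ∣▷∣ {S = inside  ∷ S} {zero}  w∉S = contradiction here w∉S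
  ∣▷∣ {S = outside ∷ S} {zero}  _   = cong (λ T → suc ∣ T ∣) (∪-identityʳ S)
  ∣▷∣ {S = inside  ∷ S} {suc w} w∉S = cong suc (∣▷∣ (λ w∈S → w∉S (there w∈S)))
  ∣▷∣ {S = outside ∷ S} {suc w} w∉S = ∣▷∣ (λ w∈S → w∉S (there w∈S))

  module _ {n : ℕ} where

    ⊆∧∣≥∣⇒≡ : ∀ {S T : Subset n} → S ⊆ T → ∣ T ∣ ≤ ∣ S ∣ → S ≡ T
    ⊆∧∣≥∣⇒≡ {S} {T} S⊆T T≤S = ⊆-antisym S⊆T T⊆S
      where
      T⊆S : T ⊆ S
      T⊆S {x} x∈T with x ∈? S
      ... | yes x∈S = x∈S
      ... | no  x∉S = contradiction (p⊂q⇒∣p∣<∣q∣ (S⊆T , x , x∈T , x∉S)) (ℕ.≤⇒≯ T≤S)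

    ∣<∣⇒∃∉ : ∀ {S T : Subset n} → ∣ S ∣ < ∣ T ∣ → ∃[ x ] x ∈ T × x ∉ S
    ∣<∣⇒∃∉ {S} {T} S<T with nonempty? (T ∩ ∁ S)
    ... | yes (x , x∈) = x , proj₁ (x∈p∩q⁻ T (∁ S) x∈) , x∈∁p⇒x∉p (proj₂ (x∈p∩q⁻ T (∁ S) x∈))
    ... | no  empty    = contradiction (p⊆q⇒∣p∣≤∣q∣ T⊆S) (ℕ.<⇒≱ S<T)
      where
      T⊆S : T ⊆ S
      T⊆S {x} x∈T with x ∈? S
      ... | yes x∈S = x∈S
      ... | no  x∉S = contradiction (x , x∈p∩q⁺ (x∈T , x∉p⇒x∈∁p x∉S)) empty

    crossing-edge : ∀ {R : Rel (Fin n) 0ℓ} (S : Subset n) {u v} → Star R u v → u ∈ S → v ∉ S →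
      ∃[ x ] ∃[ y ] x ∈ S × y ∉ S × R x y
    crossing-edge S ε u∈S u∉S = contradiction u∈S u∉S
    crossing-edge S (_◅_ {i = u} {j = w} r rs) u∈S v∉S with w ∈? S
    ... | yes w∈S = crossing-edge S rs w∈S v∉S
    ... | no  w∉S = u , w , u∈S , w∉S , r

  module _ {n} (G : Graph n) where
    open Graph G

    rooted⇒connectedOn : ∀ {S} r → (∀ {u} → u ∈ S → Star (InducedAdjacency G S) r u) → ConnectedOn G S
    rooted⇒connectedOn r reach u u∈S v v∈S =
      Star.reverse (λ (a , b , a~b) → b , a , ~-sym a~b) (reach u∈S) ◅◅ reach v∈S

    singleton-connected : ∀ v → ConnectedOn G ⁅ v ⁆
    singleton-connected v = rooted⇒connectedOn v λ u∈ → subst (Star _ v) (sym (x∈⁅y⁆⇒x≡y v u∈)) ε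

    induced-mono : ∀ {S T} → S ⊆ T → ∀ {u v} → InducedAdjacency G S u v → InducedAdjacency G T u v
    induced-mono S⊆T (u∈S , v∈S , u~v) = S⊆T u∈S , S⊆T v∈S , u~v

    ▷-connected : ∀ {S u w} → ConnectedOn G S → u ∈ S → u ~ w → ConnectedOn G (S ▷ w)
    ▷-connected {S} {u} {w} conn u∈S u~w = rooted⇒connectedOn u reach
      where
      reach : ∀ {v} → v ∈ S ▷ w → Star (InducedAdjacency G (S ▷ w)) u v
      reach v∈ with ∈-▷⁻ w v∈
      ... | inj₁ v∈S  = Star.map (induced-mono (∈-▷ˡ w)) (conn u u∈S _ v∈S)
      ... | inj₂ refl = (∈-▷ˡ w u∈S , ∈-▷ʳ S w , u~w) ◅ ε

    -- An ordering of the vertices of `S` outside `T` in which each is adjacent to `T` or to an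
    -- earlier one. Read backwards it tells which vertices can be removed without disconnecting the
    -- set, provided `T` is connected.
    data GrownFrom (T : Subset n) : Subset n → Set where
      base : GrownFrom T T
      grow : ∀ {S u w} → GrownFrom T S → u ∈ S → u ~ w → w ∉ S → GrownFrom T (S ▷ w)

    grown-⊇ : ∀ {T S} → GrownFrom T S → T ⊆ S
    grown-⊇ base                   x∈T = x∈T
    grown-⊇ (grow {w = w} g _ _ _) x∈T = ∈-▷ˡ w (grown-⊇ g x∈T)

    grown-connected : ∀ {T S} → ConnectedOn G T → GrownFrom T S → ConnectedOn G S
    grown-connected conn base               = conn
    grown-connected conn (grow g u∈S u~w _) = ▷-connected (grown-connected conn g) u∈S u~w

    -- While the growing set misses a vertex of `S`, a path inside `S` from `t` to that vertex
    -- leaves it, and the edge of exit supplies the next vertex. The fuel bounds the number of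
    -- vertices still missing.
    grow-within : ∀ {T S t} → t ∈ T → T ⊆ S → ConnectedOn G S → GrownFrom T S
    grow-within {T} {S} {t} t∈T T⊆S conn = go (∣ S ∣ ∸ ∣ T ∣) base T⊆S (ℕ.m≤n+m∸n ∣ S ∣ ∣ T ∣)
      where
      go : ∀ fuel {X} → GrownFrom T X → X ⊆ S → ∣ S ∣ ≤ ∣ X ∣ + fuel → GrownFrom T S
      go zero {X} g X⊆S S≤X = subst (GrownFrom T)
        (⊆∧∣≥∣⇒≡ X⊆S (subst (∣ S ∣ ≤_) (ℕ.+-identityʳ ∣ X ∣) S≤X)) g
      go (suc fuel) {X} g X⊆S S≤X with ∣ X ∣ ℕ.<? ∣ S ∣
      ... | no  X≮S = subst (GrownFrom T) (⊆∧∣≥∣⇒≡ X⊆S (ℕ.≮⇒≥ X≮S)) g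
      ... | yes X<S with ∣<∣⇒∃∉ X<S
      ...   | v , v∈S , v∉X with crossing-edge X (conn t (X⊆S (grown-⊇ g t∈T)) v v∈S) (grown-⊇ g t∈T) v∉X
      ...     | x , y , x∈X , y∉X , (_ , y∈S , x~y) = go fuel (grow g x∈X x~y y∉X) (▷-⊆ X⊆S y∈S)
        (subst (∣ S ∣ ≤_) (trans (ℕ.+-suc ∣ X ∣ fuel) (cong (_+ fuel) (sym (∣▷∣ y∉X)))) S≤X)

    outgoing-edge : Connected G → ∀ {S v} → v ∈ S → ∣ S ∣ < n → ∃[ u ] ∃[ w ] u ∈ S × w ∉ S × u ~ w
    outgoing-edge conn {S} {v} v∈S S<n with ∣<∣⇒∃∉ {S = S} {T = ⊤} (subst (∣ S ∣ <_) (sym (∣⊤∣≡n n)) S<n)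
    ... | x , _ , x∉S = crossing-edge S (conn v x) v∈S x∉S

    connectedSubgraph-exists : Connected G → Fin n → ∀ j → suc j ≤ n →
      ∃[ S ] IsConnectedSubgraph G (suc j) S × Nonempty S
    connectedSubgraph-exists conn v zero    _     = ⁅ v ⁆ , (∣⁅x⁆∣≡1 v , singleton-connected v) , v , x∈⁅x⁆ v
    connectedSubgraph-exists conn v (suc j) j+2≤n
      with connectedSubgraph-exists conn v j (ℕ.<⇒≤ j+2≤n)
    ... | S , (size , connS) , s , s∈S with outgoing-edge conn s∈S (subst (_< n) (sym size) j+2≤n)
    ...   | u , w , u∈S , w∉S , u~w =
      S ▷ w , (trans (∣▷∣ w∉S) (cong suc size) , ▷-connected connS u∈S u~w) , s , ∈-▷ˡ w s∈S

    -- Includes the validity of the target, so that every set reached along a walk of swaps is again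
    -- a state.
    Swap : ℕ → Rel (Subset n) 0ℓ
    Swap j S T = IsConnectedSubgraph G j T × suc ∣ S ∩ T ∣ ≡ j

    -- The vertex dropped from S is the last one in a growth of S from T, so the rest stays connected.
    exchange : ∀ {j S T t u b} → ConnectedOn G T → t ∈ T → T ⊆ S → ∣ T ∣ < ∣ S ∣ → IsConnectedSubgraph G j S →
      u ∈ T → u ~ b → b ∉ S → ∃[ S′ ] T ▷ b ⊆ S′ × Swap j S S′
    exchange {j} {S} {T} {t} {u} {b} connT t∈T T⊆S T<S (size , connS) u∈T u~b b∉S
      with grow-within t∈T T⊆S connS
    ... | base = contradiction T<S (ℕ.<-irrefl refl)
    ... | grow {S = S₀} {w = x} g _ _ x∉S₀ = S₀ ▷ b
        , ▷-⊆ (λ y∈T → ∈-▷ˡ b (grown-⊇ g y∈T)) (∈-▷ʳ S₀ b)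
        , (trans (∣▷∣ b∉S₀) (trans (sym (∣▷∣ x∉S₀)) size)
          , ▷-connected (grown-connected connT g) (grown-⊇ g u∈T) u~b)
        , trans (cong (λ I → suc ∣ I ∣) common) (trans (sym (∣▷∣ x∉S₀)) size)
      where
      b∉S₀ : b ∉ S₀
      b∉S₀ b∈S₀ = b∉S (∈-▷ˡ x b∈S₀)
      common : (S₀ ▷ x) ∩ (S₀ ▷ b) ≡ S₀
      common = ⊆-antisym ⊆₁ (λ y∈ → x∈p∩q⁺ (∈-▷ˡ x y∈ , ∈-▷ˡ b y∈))
        where
        ⊆₁ : (S₀ ▷ x) ∩ (S₀ ▷ b) ⊆ S₀
        ⊆₁ y∈ with x∈p∩q⁻ (S₀ ▷ x) (S₀ ▷ b) y∈
        ... | y∈x , y∈b with ∈-▷⁻ b y∈b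
        ...   | inj₁ y∈S₀ = y∈S₀
        ...   | inj₂ refl = contradiction y∈x b∉S

    -- A step to a vertex outside the current set costs one exchange that protects only the present
    -- vertex; `1 < j` guarantees another vertex to drop. Steps inside the set cost nothing.
    slide : ∀ {j L u v} → 1 < j → Walk _~_ L u v → ∀ {S} → IsConnectedSubgraph G j S → u ∈ S →
      ∃[ S′ ] v ∈ S′ × IsConnectedSubgraph G j S′ × Walk (Swap j) L S S′
    slide 1<j stop S-ok u∈S = _ , u∈S , S-ok , stop
    slide {j} {suc L} {u} 1<j (step {y = w} u~w ws) {S} S-ok u∈S with w ∈? S
    ... | yes w∈S with slide 1<j ws S-ok w∈S
    ...   | S′ , v∈S′ , ok , path = S′ , v∈S′ , ok , weaken (ℕ.n≤1+n L) path
    slide {j} {suc L} {u} 1<j (step {y = w} u~w ws) {S} S-ok@(size , _) u∈S | no w∉S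
      with exchange (singleton-connected u) (x∈⁅x⁆ u)
             (λ x∈ → subst (_∈ S) (sym (x∈⁅y⁆⇒x≡y u x∈)) u∈S)
             (subst₂ _<_ (sym (∣⁅x⁆∣≡1 u)) (sym size) 1<j) S-ok (x∈⁅x⁆ u) u~w w∉S
    ... | S₁ , ⊆S₁ , swap with slide 1<j ws (proj₁ swap) (⊆S₁ (∈-▷ʳ ⁅ u ⁆ w))
    ...   | S′ , v∈S′ , ok , path = S′ , v∈S′ , ok , step swap path

    -- Each exchange protects the part already filled, which is connected as a growth from `b` and
    -- still smaller than `j`. The vertex `b` is there from the start, hence one swap less than the
    -- size of `X`.
    fill : ∀ {j b X} → GrownFrom ⁅ b ⁆ X → ∣ X ∣ ≤ j → ∀ {S} → IsConnectedSubgraph G j S → b ∈ S →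
      ∃[ S′ ] X ⊆ S′ × IsConnectedSubgraph G j S′ × Walk (Swap j) (∣ X ∣ ∸ 1) S S′
    fill {b = b} base _ {S} S-ok b∈S = S , (λ x∈ → subst (_∈ S) (sym (x∈⁅y⁆⇒x≡y b x∈)) b∈S) , S-ok , stop
    fill {j} {b} (grow {S = X} {u = u} {w = w} g u∈X u~w w∉X) Xw≤j {S} S-ok b∈S
      with fill g (ℕ.≤-trans (ℕ.n≤1+n ∣ X ∣) (subst (_≤ j) (∣▷∣ w∉X) Xw≤j)) S-ok b∈S
    ... | S₁ , X⊆S₁ , S₁-ok , path with w ∈? S₁
    ...   | yes w∈S₁ = S₁ , ▷-⊆ X⊆S₁ w∈S₁ , S₁-ok
      , weaken (ℕ.∸-monoˡ-≤ 1 (subst (∣ X ∣ ≤_) (sym (∣▷∣ w∉X)) (ℕ.n≤1+n ∣ X ∣))) path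
    ...   | no  w∉S₁
      with exchange (grown-connected (singleton-connected b) g) u∈X X⊆S₁
             (subst (∣ X ∣ <_) (sym (proj₁ S₁-ok)) (subst (_≤ j) (∣▷∣ w∉X) Xw≤j)) S₁-ok u∈X u~w w∉S₁
    ...   | S₂ , ⊆S₂ , swap = S₂ , ⊆S₂ , proj₁ swap
      , weaken (ℕ.≤-reflexive eq) (path ++ʷ step swap (stop {L = 0}))
      where
      1≤∣X∣ : 1 ≤ ∣ X ∣
      1≤∣X∣ = subst (_≤ ∣ X ∣) (∣⁅x⁆∣≡1 b) (p⊆q⇒∣p∣≤∣q∣ (grown-⊇ g))
      eq : ∣ X ∣ ∸ 1 + 1 ≡ ∣ X ▷ w ∣ ∸ 1
      eq = trans (ℕ.m∸n+n≡m 1≤∣X∣) (sym (cong (_∸ 1) (∣▷∣ w∉X)))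

    swap-walk : ∀ {D} → (∀ u v → Walk _~_ D u v) → ∀ {j S T} → 1 < j →
      IsConnectedSubgraph G j S → IsConnectedSubgraph G j T → Nonempty S → Nonempty T →
      Walk (Swap j) (D + (j ∸ 1)) S T
    swap-walk {D} walks {j} {S} {T} 1<j S-ok T-ok (a , a∈S) (b , b∈T)
      with slide 1<j (walks a b) S-ok a∈S
    ... | S₁ , b∈S₁ , S₁-ok , path
      with fill (grow-within (x∈⁅x⁆ b) (λ x∈ → subst (_∈ T) (sym (x∈⁅y⁆⇒x≡y b x∈)) b∈T) (proj₂ T-ok))
             (ℕ.≤-reflexive (proj₁ T-ok)) S₁-ok b∈S₁
    ... | S₂ , T⊆S₂ , S₂-ok , path′ = subst (Walk (Swap j) (D + (j ∸ 1)) S)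
      (sym (⊆∧∣≥∣⇒≡ T⊆S₂ (ℕ.≤-reflexive (trans (proj₁ S₂-ok) (sym (proj₁ T-ok))))))
      (path ++ʷ subst (λ s → Walk (Swap j) (s ∸ 1) S₁ S₂) (proj₁ T-ok) path′)

    swap-exists : Connected G → ∀ {j S v} → 1 < j → j < n → IsConnectedSubgraph G j S → v ∈ S → ∃[ T ] Swap j S T
    swap-exists conn 1<j j<n S-ok@(size , _) v∈S with outgoing-edge conn v∈S (subst (_< n) (sym size) j<n)
    ... | u , w , u∈S , w∉S , u~w with exchange (singleton-connected u) (x∈⁅x⁆ u)
             (λ x∈ → subst (_∈ _) (sym (x∈⁅y⁆⇒x≡y u x∈)) u∈S)
             (subst₂ _<_ (sym (∣⁅x⁆∣≡1 u)) (sym size) 1<j) S-ok (x∈⁅x⁆ u) u~w w∉S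
    ...   | T , _ , swap = T , swap

    star⇒walk : ∀ {R : Rel (Fin n) 0ℓ} {u v} (s : Star R u v) → Walk R (walkLength s) u v
    star⇒walk ε       = stop
    star⇒walk (r ◅ s) = step r (star⇒walk s)

-- Size, degrees and walks of the state graphs.

module StateGraphs where

  open import Data.Nat.Base using (ℕ; zero; suc; _+_; _*_; _^_; _⊔_; _≤_; _<_; z≤n; s≤s; _!)
  import Data.Nat.Properties as ℕ
  open import Data.Nat.Tactic.RingSolver using (solve-∀)
  open import Data.Fin.Base as Fin using (Fin; zero; suc)
  import Data.Fin.Properties as Fin
  open import Data.Fin.Subset hiding (_-_)
  open import Data.Fin.Subset.Properties
  open import Data.List.Base using (List; []; _∷_; allFin; filter; foldr; length; lookup; map; concatMap)
  open import Data.List.Properties using (length-map; length-++; length-tabulate)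
  open import Data.List.Membership.Propositional using (lose) renaming (_∈_ to _∈ˡ_)
  open import Data.List.Membership.Propositional.Properties
    using (∈-allFin; ∈-lookup; ∈-map⁺; ∈-map⁻; ∈-++⁺ˡ; ∈-++⁺ʳ; ∈-concatMap⁺; ∈-filter⁺; ∈-filter⁻; ∈-length)
  open import Data.List.Relation.Unary.All as All using (All; []; _∷_)
  open import Data.List.Relation.Unary.AllPairs using ([]; _∷_)
  open import Data.List.Relation.Unary.Any as Any using (here; there)
  open import Data.List.Relation.Unary.Any.Properties using (lookup-index)
  open import Data.List.Relation.Unary.Unique.Propositional using (Unique)
  import Data.List.Relation.Unary.Unique.Propositional.Properties as Unique
  open import Data.Product using (_×_; _,_; proj₁; proj₂; ∃-syntax)
  open import Data.Sum using (inj₁; inj₂)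
  open import Data.Vec.Base as Vec using ([]; _∷_)
  open import Data.Vec.Properties using (∷-injectiveʳ)
  open import Relation.Binary.PropositionalEquality using (_≡_; refl; sym; trans; cong; subst)
  open import Relation.Nullary using (¬_; contradiction)
  open import Defs hiding (_<ᴿ_; _+ᴿ_)
  open Walks
  open ConnectedSets

  module _ {A : Set} where

    lookup-injective : ∀ {xs : List A} → Unique xs → ∀ {i j} → lookup xs i ≡ lookup xs j → i ≡ j
    lookup-injective (_  ∷ _) {zero}  {zero}  _  = refl
    lookup-injective {x ∷ xs} (x∉ ∷ _) {zero}  {suc j} eq = contradiction eq (All.lookup x∉ (∈-lookup j))
    lookup-injective {x ∷ xs} (x∉ ∷ _) {suc i} {zero}  eq = contradiction (sym eq) (All.lookup x∉ (∈-lookup i))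
    lookup-injective (_  ∷ u) {suc i} {suc j} eq = cong suc (lookup-injective u eq)

    -- Pigeonhole on list positions. The cardinality bounds below cover a repetition-free list by an
    -- explicit one that may well repeat.
    unique-⊆⇒length-≤ : ∀ {xs ys : List A} → Unique xs → (∀ {x} → x ∈ˡ xs → x ∈ˡ ys) → length xs ≤ length ys
    unique-⊆⇒length-≤ {xs} {ys} u xs⊆ys = Fin.injective⇒≤ {f = λ i → Any.index (member i)} λ {i} {j} eq →
      lookup-injective u (trans (lookup-index (member i))
        (trans (cong (lookup ys) eq) (sym (lookup-index (member j)))))
      where
      member : ∀ i → lookup xs i ∈ˡ ys
      member i = xs⊆ys (∈-lookup i)

    length-concatMap-≤ : ∀ {B : Set} (f : A → List B) {m} xs → (∀ {x} → x ∈ˡ xs → length (f x) ≤ m) →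
      length (concatMap f xs) ≤ length xs * m
    length-concatMap-≤ f []       _     = z≤n
    length-concatMap-≤ f {m} (x ∷ xs) bound = subst (_≤ m + length xs * m) (sym (length-++ (f x)))
      (ℕ.+-mono-≤ (bound (here refl)) (length-concatMap-≤ f xs (λ x∈ → bound (there x∈))))

  elements : ∀ {n} → Subset n → List (Fin n)
  elements []            = []
  elements (inside  ∷ S) = zero ∷ map suc (elements S)
  elements (outside ∷ S) = map suc (elements S)

  length-elements : ∀ {n} (S : Subset n) → length (elements S) ≡ ∣ S ∣
  length-elements []            = refl
  length-elements (inside  ∷ S) = cong suc (trans (length-map suc (elements S)) (length-elements S))
  length-elements (outside ∷ S) = trans (length-map suc (elements S)) (length-elements S)

  ∈-elements : ∀ {n} {S : Subset n} {x} → x ∈ S → x ∈ˡ elements S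
  ∈-elements {S = inside  ∷ S} Vec.here        = here refl
  ∈-elements {S = inside  ∷ S} (Vec.there x∈S) = there (∈-map⁺ suc (∈-elements x∈S))
  ∈-elements {S = outside ∷ S} (Vec.there x∈S) = ∈-map⁺ suc (∈-elements x∈S)

  ∈-subsets : ∀ {n} (S : Subset n) → S ∈ˡ subsets n
  ∈-subsets []                    = here refl
  ∈-subsets (outside ∷ S)         = ∈-++⁺ˡ (∈-map⁺ (outside ∷_) (∈-subsets S))
  ∈-subsets {suc n} (inside  ∷ S) = ∈-++⁺ʳ (map (outside ∷_) (subsets n)) (∈-map⁺ (inside ∷_) (∈-subsets S))

  subsets-unique : ∀ n → Unique (subsets n)
  subsets-unique zero    = [] ∷ []
  subsets-unique (suc n) = Unique.++⁺ (Unique.map⁺ ∷-injectiveʳ (subsets-unique n))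
    (Unique.map⁺ ∷-injectiveʳ (subsets-unique n)) disjoint
    where
    disjoint : ∀ {S} → ¬ (S ∈ˡ map (outside ∷_) (subsets n) × S ∈ˡ map (inside ∷_) (subsets n))
    disjoint (p , q) with ∈-map⁻ (outside ∷_) p | ∈-map⁻ (inside ∷_) q
    ... | _ , _ , refl | _ , _ , ()

  module _ {n} (G : Graph n) where
    open Graph G

    neighbours : Fin n → List (Fin n)
    neighbours u = filter (u ~?_) (allFin n)

    ∈-neighbours : ∀ {u v} → u ~ v → v ∈ˡ neighbours u
    ∈-neighbours {u} {v} u~v = ∈-filter⁺ (u ~?_) (∈-allFin v) u~v

    degree≤maxDegree : ∀ u → degree G u ≤ maxDegree G
    degree≤maxDegree u = go (allFin n) (∈-allFin u)
      where
      go : ∀ xs → u ∈ˡ xs → degree G u ≤ foldr _⊔_ 0 (map (degree G) xs)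
      go (x ∷ xs) (here refl) = ℕ.m≤m⊔n (degree G x) _
      go (x ∷ xs) (there u∈)  = ℕ.≤-trans (go xs u∈) (ℕ.m≤n⊔m (degree G x) _)

    degree≥ : ∀ {u} xs → Unique xs → (∀ {v} → v ∈ˡ xs → u ~ v) → length xs ≤ degree G u
    degree≥ xs unique adj = unique-⊆⇒length-≤ unique (λ v∈ → ∈-neighbours (adj v∈))

    maxDegree≤n : maxDegree G ≤ n
    maxDegree≤n = go (allFin n)
      where
      go : ∀ xs → foldr _⊔_ 0 (map (degree G) xs) ≤ n
      go []       = z≤n
      go (x ∷ xs) = ℕ.⊔-lub (subst (degree G x ≤_) (length-tabulate {n = n} (λ i → i))
        (unique-⊆⇒length-≤ {ys = allFin n} (Unique.filter⁺ (x ~?_) (Unique.allFin⁺ n)) (λ v∈ → proj₁ (∈-filter⁻ (x ~?_) v∈)))) (go xs)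

    connectedSubgraphs-unique : ∀ j → Unique (connectedSubgraphs G j)
    connectedSubgraphs-unique j = Unique.filter⁺ (isConnectedSubgraph? G j) (subsets-unique n)

    ∈-connectedSubgraphs : ∀ {j S} → IsConnectedSubgraph G j S → S ∈ˡ connectedSubgraphs G j
    ∈-connectedSubgraphs {j} {S} ok = ∈-filter⁺ (isConnectedSubgraph? G j) (∈-subsets S) ok

    connectedSubgraph-ok : ∀ {j S} → S ∈ˡ connectedSubgraphs G j → IsConnectedSubgraph G j S
    connectedSubgraph-ok {j} S∈ = proj₂ (∈-filter⁻ (isConnectedSubgraph? G j) {xs = subsets n} S∈)

    nonempty : ∀ {S : Subset n} → 0 < ∣ S ∣ → Nonempty S
    nonempty {S} 0<S with ∣<∣⇒∃∉ {S = ⊥} {T = S} (subst (_< ∣ S ∣) (sym (∣⊥∣≡0 n)) 0<S)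
    ... | x , x∈S , _ = x , x∈S

    -- Generous on purpose: sets may recur, and `S` itself appears when a neighbour already lies in
    -- it. This keeps the length estimate a plain product.
    enlargements : Subset n → List (Subset n)
    enlargements S = concatMap (λ u → map (S ▷_) (neighbours u)) (elements S)

    ∈-enlargements : ∀ {S u w} → u ∈ S → u ~ w → S ▷ w ∈ˡ enlargements S
    ∈-enlargements {S} {u} u∈S u~w = ∈-concatMap⁺ (λ u → map (S ▷_) (neighbours u))
      (lose (∈-elements u∈S) (∈-map⁺ (S ▷_) (∈-neighbours u~w)))

    length-enlargements : ∀ S → length (enlargements S) ≤ ∣ S ∣ * maxDegree G
    length-enlargements S = subst (λ k → length (enlargements S) ≤ k * maxDegree G) (length-elements S)
      (length-concatMap-≤ (λ u → map (S ▷_) (neighbours u)) (elements S)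
        (λ {u} _ → subst (_≤ maxDegree G) (sym (length-map (S ▷_) (neighbours u))) (degree≤maxDegree u)))

    -- Removing the last vertex of a growth from a single vertex exhibits a connected set as an
    -- enlargement of a connected set with one vertex less. Passing from `j + 1` to `j + 2` vertices
    -- multiplies the count by at most `(j + 1) Δ`.
    connectedSubgraph-count : ∀ j → length (connectedSubgraphs G (suc j)) ≤ n * j ! * maxDegree G ^ j
    connectedSubgraph-count zero = subst (length (connectedSubgraphs G 1) ≤_)
      (trans (trans (length-map ⁅_⁆ (allFin n)) (length-tabulate {n = n} (λ i → i))) (solve-n n))
      (unique-⊆⇒length-≤ (connectedSubgraphs-unique 1) cover)
      where
      solve-n : ∀ n → n ≡ n * 1 * 1
      solve-n = solve-∀
      cover : ∀ {S} → S ∈ˡ connectedSubgraphs G 1 → S ∈ˡ map ⁅_⁆ (allFin n)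
      cover {S} S∈ with connectedSubgraph-ok S∈
      ... | size , _ with nonempty (subst (0 <_) (sym size) (s≤s z≤n))
      ...   | x , x∈S = subst (_∈ˡ map ⁅_⁆ (allFin n))
        (⊆∧∣≥∣⇒≡ (λ y∈ → subst (_∈ S) (sym (x∈⁅y⁆⇒x≡y x y∈)) x∈S)
          (ℕ.≤-reflexive (trans size (sym (∣⁅x⁆∣≡1 x)))))
        (∈-map⁺ ⁅_⁆ (∈-allFin x))
    connectedSubgraph-count (suc j) = ℕ.≤-trans
      (unique-⊆⇒length-≤ (connectedSubgraphs-unique (suc (suc j))) cover)
      (ℕ.≤-trans
        (length-concatMap-≤ enlargements (connectedSubgraphs G (suc j))
          (λ {S} S∈ → subst (λ k → length (enlargements S) ≤ k * Δ) (proj₁ (connectedSubgraph-ok S∈))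
            (length-enlargements S)))
        (ℕ.≤-trans (ℕ.*-monoˡ-≤ (suc j * Δ) (connectedSubgraph-count j))
          (ℕ.≤-reflexive (eq n (j !) (Δ ^ j) (suc j) Δ))))
      where
      Δ = maxDegree G
      eq : ∀ a b c d e → a * b * c * (d * e) ≡ a * (d * b) * (e * c)
      eq = solve-∀
      cover : ∀ {S} → S ∈ˡ connectedSubgraphs G (suc (suc j)) → S ∈ˡ concatMap enlargements (connectedSubgraphs G (suc j))
      cover {S} S∈ with connectedSubgraph-ok S∈
      ... | size , conn with nonempty (subst (0 <_) (sym size) (s≤s z≤n))
      ...   | x , x∈S with grow-within G (x∈⁅x⁆ x) (λ y∈ → subst (_∈ S) (sym (x∈⁅y⁆⇒x≡y x y∈)) x∈S) conn
      ...     | base = contradiction (trans (sym size) (∣⁅x⁆∣≡1 x)) λ ()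
      ...     | grow {S = T} g u∈T u~w w∉T = ∈-concatMap⁺ enlargements
        (lose (∈-connectedSubgraphs (ℕ.suc-injective (trans (sym (∣▷∣ w∉T)) size)
                                    , grown-connected G (singleton-connected G x) g))
          (∈-enlargements u∈T u~w))

    -- Here `x` is the vertex given up and `u` an old vertex next to the new one, which accounts for
    -- the two factors `∣ S ∣` and for `Δ` in the length.
    swaps : Subset n → List (Subset n)
    swaps S = concatMap (λ x → concatMap (λ u → map ((S ∩ ∁ ⁅ x ⁆) ▷_) (neighbours u)) (elements S)) (elements S)

    length-swaps : ∀ S → length (swaps S) ≤ ∣ S ∣ * (∣ S ∣ * maxDegree G)
    length-swaps S = subst (λ k → length (swaps S) ≤ k * (k * maxDegree G)) (length-elements S)
      (length-concatMap-≤ _ (elements S) λ {x} _ →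
        length-concatMap-≤ (λ u → map ((S ∩ ∁ ⁅ x ⁆) ▷_) (neighbours u)) (elements S) λ {u} _ →
          subst (_≤ maxDegree G) (sym (length-map ((S ∩ ∁ ⁅ x ⁆) ▷_) (neighbours u))) (degree≤maxDegree u))

    -- By counting, `S ∩ T` is `S` without `x` and `T` without `w`. It is nonempty because `1 < j`,
    -- so connectedness of `T` yields an edge from it to the only other vertex `w`, and `w` is a
    -- neighbour of a vertex of `S`.
    ∈-swaps : ∀ {j S T} → 1 < j → ∣ S ∣ ≡ j → Swap G j S T → T ∈ˡ swaps S
    ∈-swaps {j} {S} {T} 1<j sizeS ((sizeT , connT) , common)
      with ∣<∣⇒∃∉ {S = S ∩ T} {T = T} (ℕ.≤-reflexive (trans common (sym sizeT)))
         | ∣<∣⇒∃∉ {S = S ∩ T} {T = S} (ℕ.≤-reflexive (trans common (sym sizeS)))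
         | nonempty {S ∩ T} (ℕ.≤-pred (subst (1 <_) (sym common) 1<j))
    ... | w , w∈T , w∉I | x , x∈S , x∉I | y , y∈I
      with crossing-edge (S ∩ T) (connT y (proj₂ (x∈p∩q⁻ S T y∈I)) w w∈T) y∈I w∉I
    ... | a , b , a∈I , b∉I , (_ , b∈T , a~b) = subst (_∈ˡ swaps S) T≡
      (∈-concatMap⁺ _ (lose (∈-elements x∈S)
        (∈-concatMap⁺ (λ u → map ((S ∩ ∁ ⁅ x ⁆) ▷_) (neighbours u))
          (lose (∈-elements (proj₁ (x∈p∩q⁻ S T a∈I))) (∈-map⁺ ((S ∩ ∁ ⁅ x ⁆) ▷_) (∈-neighbours a~w))))))
      where
      I▷w≡T : (S ∩ T) ▷ w ≡ T
      I▷w≡T = ⊆∧∣≥∣⇒≡ (▷-⊆ (p∩q⊆q S T) w∈T)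
        (ℕ.≤-reflexive (trans sizeT (trans (sym common) (sym (∣▷∣ w∉I)))))
      a~w : a ~ w
      a~w with ∈-▷⁻ w (subst (b ∈_) (sym I▷w≡T) b∈T)
      ... | inj₁ b∈I  = contradiction b∈I b∉I
      ... | inj₂ refl = a~b
      I≡S-x : S ∩ T ≡ S ∩ ∁ ⁅ x ⁆
      I≡S-x = ⊆∧∣≥∣⇒≡
        (λ z∈I → x∈p∩q⁺ (proj₁ (x∈p∩q⁻ S T z∈I) ,
          x∉p⇒x∈∁p λ z∈x → x∉I (subst (_∈ S ∩ T) (x∈⁅y⁆⇒x≡y x z∈x) z∈I)))
        (ℕ.≤-pred (subst (∣ S ∩ ∁ ⁅ x ⁆ ∣ <_) (trans sizeS (sym common))
          (p⊂q⇒∣p∣<∣q∣ (p∩q⊆p S (∁ ⁅ x ⁆) , x , x∈S , λ x∈ → x∈∁p⇒x∉p (proj₂ (x∈p∩q⁻ S (∁ ⁅ x ⁆) x∈)) (x∈⁅x⁆ x)))))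
      T≡ : (S ∩ ∁ ⁅ x ⁆) ▷ w ≡ T
      T≡ = trans (cong (_▷ w) (sym I≡S-x)) I▷w≡T

    module _ {j : ℕ} where
      open Graph (overlapGraph G j) using () renaming (_~_ to _≈_; _~?_ to _≈?_)

      vertexSet : Fin (length (connectedSubgraphs G j)) → Subset n
      vertexSet = lookup (connectedSubgraphs G j)

      vertexSet-ok : ∀ a → IsConnectedSubgraph G j (vertexSet a)
      vertexSet-ok a = connectedSubgraph-ok (∈-lookup a)

      overlap-degree : 1 < j → ∀ a → degree (overlapGraph G j) a ≤ j * (j * maxDegree G)
      overlap-degree 1<j a = ℕ.≤-trans
        (subst (_≤ length (swaps (vertexSet a))) (length-map vertexSet (filter (a ≈?_) (allFin _)))
          (unique-⊆⇒length-≤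
            (Unique.map⁺ (lookup-injective (connectedSubgraphs-unique j)) (Unique.filter⁺ (a ≈?_) (Unique.allFin⁺ _)))
            cover))
        (subst (λ k → length (swaps (vertexSet a)) ≤ k * (k * maxDegree G)) (proj₁ (vertexSet-ok a))
          (length-swaps (vertexSet a)))
        where
        cover : ∀ {T} → T ∈ˡ map vertexSet (filter (a ≈?_) (allFin _)) → T ∈ˡ swaps (vertexSet a)
        cover T∈ with ∈-map⁻ vertexSet T∈
        ... | b , b∈ , refl = ∈-swaps {S = vertexSet a} 1<j (proj₁ (vertexSet-ok a))
          (vertexSet-ok b , proj₂ (∈-filter⁻ (a ≈?_) {xs = allFin _} b∈))

      index-of : ∀ {S} → IsConnectedSubgraph G j S → ∃[ a ] vertexSet a ≡ S
      index-of ok = Any.index (∈-connectedSubgraphs ok) , sym (lookup-index (∈-connectedSubgraphs ok))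

      swap-walk⇒overlap-walk : ∀ {L S T} → Walk (Swap G j) L S T → ∀ a b → vertexSet a ≡ S → vertexSet b ≡ T →
        Walk _≈_ L a b
      swap-walk⇒overlap-walk stop a b refl eq =
        subst (Walk _≈_ _ a) (lookup-injective (connectedSubgraphs-unique j) (sym eq)) stop
      swap-walk⇒overlap-walk (step (ok , common) w) a b refl eq with index-of ok
      ... | c , refl = step common (swap-walk⇒overlap-walk w c b refl eq)

      overlap-neighbour : Connected G → 1 < j → j < n → ∀ a → 1 ≤ degree (overlapGraph G j) a
      overlap-neighbour conn 1<j j<n a
        with nonempty (subst (0 <_) (sym (proj₁ (vertexSet-ok a))) (ℕ.<-trans (s≤s z≤n) 1<j))
      ... | v , v∈ with swap-exists G conn 1<j j<n (vertexSet-ok a) v∈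
      ...   | T , ok , common with index-of ok
      ...     | b , refl = ∈-length (∈-filter⁺ (a ≈?_) (∈-allFin b) common)

    diameter-walk : ∀ {D} → IsDiameter G D → ∀ u v → Walk _~_ D u v
    diameter-walk (distances , _) u v with distances (u , v)
    ... | k , ((w , len≡k) , _) , k≤D = weaken (subst (_≤ _) (sym len≡k) k≤D) (star⇒walk G w)

    module _ (conn : Connected G) where

      stateGraph-walk : ∀ {D} → IsDiameter G D → ∀ i (a b : Fin (stateCount G (suc i))) →
        Walk (Graph._~_ (stateGraph G (suc i))) (D + i) a b
      stateGraph-walk {D} diam zero    a b = weaken (ℕ.m≤m+n D 0) (diameter-walk diam a b)
      stateGraph-walk     diam (suc i) a b = swap-walk⇒overlap-walk
        (swap-walk G (diameter-walk diam) (s≤s (s≤s z≤n)) (vertexSet-ok a) (vertexSet-ok b) (inhabited a) (inhabited b))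
        a b refl refl
        where
        inhabited : ∀ (a : Fin (length (connectedSubgraphs G (suc (suc i))))) → Nonempty (vertexSet {suc (suc i)} a)
        inhabited a = nonempty (subst (0 <_) (sym (proj₁ (vertexSet-ok {suc (suc i)} a))) (s≤s z≤n))

      stateGraph-degree-≤ : ∀ i a → degree (stateGraph G (suc i)) a ≤ suc i * (suc i * maxDegree G)
      stateGraph-degree-≤ zero    a = ℕ.≤-trans (degree≤maxDegree a) (ℕ.≤-reflexive (eq (maxDegree G)))
        where
        eq : ∀ m → m ≡ 1 * (1 * m)
        eq = solve-∀
      stateGraph-degree-≤ (suc i) a = overlap-degree (s≤s (s≤s z≤n)) a

      degree≥1 : 1 < n → ∀ u → 1 ≤ degree G u
      degree≥1 1<n u with outgoing-edge G conn (x∈⁅x⁆ u) (subst (_< n) (sym (∣⁅x⁆∣≡1 u)) 1<n)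
      ... | x , w , x∈ , _ , x~w rewrite x∈⁅y⁆⇒x≡y u x∈ = ∈-length (∈-neighbours x~w)

      stateGraph-degree-≥ : ∀ i → suc i < n → ∀ a → 1 ≤ degree (stateGraph G (suc i)) a
      stateGraph-degree-≥ zero    i<n a = degree≥1 i<n a
      stateGraph-degree-≥ (suc i) i<n a = overlap-neighbour conn (s≤s (s≤s z≤n)) i<n a

      stateCount-≤ : ∀ i → stateCount G (suc i) ≤ n * i ! * maxDegree G ^ i
      stateCount-≤ zero    = ℕ.≤-reflexive (eq n)
        where
        eq : ∀ m → m ≡ m * 1 * 1
        eq = solve-∀
      stateCount-≤ (suc i) = connectedSubgraph-count (suc i)

      state-exists : ∀ i → suc i < n → Fin (stateCount G (suc i))
      state-exists zero    i<n = Fin.fromℕ< (ℕ.<-trans (s≤s z≤n) i<n)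
      state-exists (suc i) i<n
        with connectedSubgraph-exists G conn (Fin.fromℕ< (ℕ.<-trans (s≤s z≤n) i<n)) (suc i) (ℕ.<⇒≤ i<n)
      ... | _ , ok , _ = proj₁ (index-of ok)

      -- Grow an edge `u v` by a third vertex: whichever end it attaches to has two neighbours.
      2≤maxDegree : 2 < n → 2 ≤ maxDegree G
      2≤maxDegree 2<n
        with outgoing-edge G conn (x∈⁅x⁆ v₀) (subst (_< n) (sym (∣⁅x⁆∣≡1 v₀)) (ℕ.<-trans (s≤s (s≤s z≤n)) 2<n))
        where
        v₀ = Fin.fromℕ< (ℕ.<-trans (s≤s z≤n) 2<n)
      ... | u , v , u∈ , v∉ , u~v
        with outgoing-edge G conn (∈-▷ˡ v (x∈⁅x⁆ u)) (subst (_< n) (sym (trans (∣▷∣ v∉u) (cong suc (∣⁅x⁆∣≡1 u)))) 2<n)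
        where
        v∉u : v ∉ ⁅ u ⁆
        v∉u v∈u = ~-irrefl (subst (u ~_) (x∈⁅y⁆⇒x≡y u v∈u) u~v)
      ... | x , w , x∈ , w∉ , x~w with ∈-▷⁻ v x∈
      ...   | inj₂ refl = ℕ.≤-trans
        (degree≥ (u ∷ w ∷ []) (((λ { refl → w∉ (∈-▷ˡ v (x∈⁅x⁆ u)) }) ∷ []) ∷ [] ∷ [])
          λ { (here refl) → ~-sym u~v ; (there (here refl)) → x~w })
        (degree≤maxDegree v)
      ...   | inj₁ x∈u with x∈⁅y⁆⇒x≡y u x∈u
      ...     | refl = ℕ.≤-trans
        (degree≥ (v ∷ w ∷ []) (((λ { refl → w∉ (∈-▷ʳ ⁅ u ⁆ v) }) ∷ []) ∷ [] ∷ [])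
          λ { (here refl) → u~v ; (there (here refl)) → x~w })
        (degree≤maxDegree u)

-- From decay of the distance to bounds on the mixing time.

module MixingTimes where

  open import Data.Nat.Base as ℕ using (ℕ; zero; suc; _!)
  import Data.Nat.Properties as ℕ
  open import Data.Nat.Tactic.RingSolver using (solve-∀)
  open import Data.Integer.Base as ℤ using (+_; ∣_∣)
  import Data.Integer.Properties as ℤ
  open import Data.Fin.Base as Fin using (Fin; zero; suc)
  import Data.Fin.Properties as Fin
  open import Data.Rational.Base hiding (∣_∣)
  open import Data.Rational.Properties
  open import Data.Rational.Solver using (module +-*-Solver)
  import Data.Rational.Unnormalised.Base as ℚᵘ
  import Data.Rational.Unnormalised.Properties as ℚᵘ
  open import Data.Product using (_,_; proj₁; proj₂; ∃-syntax)
  open import Data.Sum using (inj₁; inj₂)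
  open import Relation.Binary.PropositionalEquality using (_≡_; refl; sym; trans; cong; subst; subst₂)
  open import Relation.Nullary using (¬_; contradiction)
  open import Defs
  open RationalLemmas using (*-nonneg; *-mono-≤₀; *-recip; >⇒≢; recip>0; recip-antimono; 0≤1; 0<1)
  open DyadicLemmas using (p≤∣↥p∣)
  open RiemannLemmas using (width; 0≤width; riemann-lower; 1≤t+)
  open +-*-Solver using (solve; _:=_; _:+_; _:*_; _:-_; :-_; con)
  open RationalArithmetic
  open LogarithmBounds
  open Walks using (Walk; stop)
  open LazyRandomWalk using (totalVariation-bound)
  open StateGraphs

  -- Without decidability of `P` a least element cannot be searched for; but if none existed,
  -- induction would refute `P` everywhere.
  ¬¬-least : ∀ {P : ℕ → Set} {t} → P t → ¬ ¬ (∃[ m ] IsLeast P m)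
  ¬¬-least {P} {t} Pt none = below (suc t) t ℕ.≤-refl Pt
    where
    below : ∀ n m → m ℕ.< n → ¬ P m
    below (suc n) m (ℕ.s≤s m≤n) Pm = none (m , Pm , λ k Pk → ℕ.≮⇒≥ λ k<m → below n k (ℕ.<-≤-trans k<m m≤n) Pk)

  -- Double negation commutes with a finite universal quantifier, so the least times for all
  -- starting states may be assumed simultaneously.
  ¬¬-∀ : ∀ {N} {Q : Fin N → Set} → (∀ a → ¬ ¬ Q a) → ¬ ¬ (∀ a → Q a)
  ¬¬-∀ {zero}  h k = k λ ()
  ¬¬-∀ {suc N} h k = h zero λ q → ¬¬-∀ (λ a → h (suc a)) λ qs → k λ { zero → q ; (suc a) → qs a }

  argmax : ∀ {N} → Fin N → (f : Fin N → ℕ) → ∃[ a ] (∀ b → f b ℕ.≤ f a)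
  argmax {suc zero}    _ f = zero , λ { zero → ℕ.≤-refl }
  argmax {suc (suc N)} _ f with argmax zero (λ b → f (suc b))
  ... | a , max with ℕ.≤-total (f zero) (f (suc a))
  ...   | inj₁ le = suc a , λ { zero → le ; (suc b) → max b }
  ...   | inj₂ ge = zero  , λ { zero → ℕ.≤-refl ; (suc b) → ℕ.≤-trans (max b) ge }

  ¬¬-isMax-least : ∀ {N} {P : Fin N → ℕ → Set} → Fin N → ∀ {T} → (∀ a → P a T) → ¬ ¬ (∃[ τ ] IsMax (λ a → IsLeast (P a)) τ)
  ¬¬-isMax-least a₀ h k = ¬¬-∀ (λ a → ¬¬-least (h a)) λ least →
    let (a , max) = argmax a₀ (λ a → proj₁ (least a))
    in k (proj₁ (least a) , (λ b → proj₁ (least b) , proj₂ (least b) , max b) , a , proj₂ (least a))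

  !-≤-^ : ∀ {n} i → i ℕ.≤ n → i ! ℕ.≤ n ℕ.^ i
  !-≤-^ zero    _   = ℕ.≤-refl
  !-≤-^ (suc i) i<n = ℕ.*-mono-≤ i<n (!-≤-^ i (ℕ.<⇒≤ i<n))

  -- The factor ½ ≤ 1 − 1/R absorbs the rounding of the mixing time to an integer.
  decay-bound : ∀ {R X e σ} → 1 ℕ.< R → 0ℚ ≤ X → 0ℚ < e → X * e ≤exp σ → ∀ ℓ → ℕ→ℚ R * σ ≤ ℕ→ℚ (suc ℓ) →
    ½ * ((1ℚ - recip (ℕ→ℚ R)) ^ ℓ * X) ≤ recip e
  decay-bound {R} {X} {e} {σ} 1<R 0≤X 0<e Xe≤σ ℓ Rσ≤ = subst₂ _≤_ lhs (*-identityˡ (recip e))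
      (*-monoʳ-≤-nonNeg (recip e) {{nonNegative (<⇒≤ (recip>0 0<e))}} (≤-trans
        (*-monoʳ-≤-nonNeg (c ^ ℓ * (X * e)) {{nonNegative (*-nonneg (^-nonneg ℓ 0≤c) (*-nonneg 0≤X (<⇒≤ 0<e)))}} ½≤c)
        (subst (_≤ 1ℚ) (*-assoc c (c ^ ℓ) (X * e)) product≤1)))
    where
    0<R = ℕ→ℚ-pos {R} (ℕ.<-trans (ℕ.s≤s ℕ.z≤n) 1<R)
    r = recip (ℕ→ℚ R)
    c = 1ℚ - r
    ½≤c : ½ ≤ c
    ½≤c = +-monoʳ-≤ 1ℚ (neg-antimono-≤ (recip-antimono (ℕ→ℚ-pos {2} (ℕ.s≤s ℕ.z≤n)) (ℕ→ℚ-mono-≤ 1<R)))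
    0≤c : 0ℚ ≤ c
    0≤c = ≤-trans RationalLemmas.0≤½ ½≤c
    rate≤ : c ≤exp - r
    rate≤ = subst (c ≤exp_) (solve 1 (λ r → con 1ℚ :- r :- con 1ℚ := :- r) refl r) (≤exp-factor 0≤c)
    -- In exponents this is `− (ℓ + 1) / R + σ ≤ 0`.
    product≤1 : c ^ suc ℓ * (X * e) ≤ 1ℚ
    product≤1 = ≤exp⇒≤1 (≤exp-* (*-nonneg 0≤X (<⇒≤ 0<e)) (≤exp-^ (suc ℓ) 0≤c rate≤) Xe≤σ)
      (subst (_≤ 0ℚ) eq (
        (RationalLemmas.p-q≤r (≤-trans (*-monoˡ-≤-nonNeg r {{nonNegative (<⇒≤ (recip>0 0<R))}} Rσ≤)
          (≤-reflexive (sym (+-identityˡ (r * ℕ→ℚ (suc ℓ)))))))))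
      where
      eq : r * (ℕ→ℚ R * σ) - r * ℕ→ℚ (suc ℓ) ≡ ℕ→ℚ (suc ℓ) * - r + σ
      eq = trans (solve 4 (λ r R s l → r :* (R :* s) :- r :* l := l :* (:- r) :+ R :* (s :* r)) refl
                   r (ℕ→ℚ R) σ (ℕ→ℚ (suc ℓ)))
        (cong (λ z → ℕ→ℚ (suc ℓ) * - r + z) (recip-cancel σ 0<R))
    lhs : ½ * (c ^ ℓ * (X * e)) * recip e ≡ ½ * (c ^ ℓ * X)
    lhs = trans (solve 4 (λ p X e r → con ½ :* (p :* (X :* e)) :* r := con ½ :* (p :* X) :* (e :* r)) refl
                  (c ^ ℓ) X e (recip e))
      (trans (cong (½ * (c ^ ℓ * X) *_) (*-recip (>⇒≢ 0<e))) (*-identityʳ (½ * (c ^ ℓ * X))))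

  recip-involutive : ∀ {q} → 0ℚ < q → recip (recip q) ≡ q
  recip-involutive {q} 0<q = trans (sym (*-identityˡ (recip (recip q))))
    (trans (cong (_* recip (recip q)) (sym (*-recip (>⇒≢ 0<q))))
      (trans (*-assoc q (recip q) (recip (recip q)))
        (trans (cong (q *_) (*-recip (>⇒≢ (recip>0 0<q)))) (*-identityʳ q))))

  ≤-half : ∀ {a b} → 2 ℕ.* b ℕ.≤ a → ℕ→ℚ b ≤ + a / 2
  ≤-half {a} {b} 2b≤a = toℚᵘ-cancel-≤ (ℚᵘ.≤-trans (ℚᵘ.≤-reflexive (toℚᵘ-fromℚᵘ (ℚᵘ.mkℚᵘ (+ b) 0)))
    (ℚᵘ.≤-trans (ℚᵘ.*≤* (subst₂ ℤ._≤_ (ℤ.pos-* b 2) (ℤ.pos-* a 1)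
        (ℤ.+≤+ (subst₂ ℕ._≤_ (ℕ.*-comm 2 b) (sym (ℕ.*-identityʳ a)) 2b≤a))))
      (ℚᵘ.≤-reflexive (ℚᵘ.≃-sym (toℚᵘ-fromℚᵘ (ℚᵘ.mkℚᵘ (+ a) 1))))))

  -- Since c witnesses 0 < ε, eventually seq ε m ⊔ c is seq ε m.
  ≤⊔⇒≤ᴿ : ∀ ε (0<ε : ℚ→ℝ 0ℚ <ᴿ ε) {q} N → (∀ m → N ℕ.≤ m → q ≤ seq ε m ⊔ proj₁ 0<ε) → ℚ→ℝ q ≤ᴿ ε
  ≤⊔⇒≤ᴿ ε (c , 0<c , N₀ , c≤ε) {q} N q≤ (δ , 0<δ , M , ε+δ≤q) = contradiction
    (≤-<-trans (ε+δ≤q m (ℕ.m≤n⊔m (N₀ ℕ.⊔ N) M)) (≤-<-trans q≤εₘ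
      (subst (_< seq ε m + δ) (+-identityʳ (seq ε m)) (+-monoʳ-< (seq ε m) 0<δ))))
    (<-irrefl refl)
    where
    m = N₀ ℕ.⊔ N ℕ.⊔ M
    N₀⊔N≤m = ℕ.m≤m⊔n (N₀ ℕ.⊔ N) M
    q≤εₘ : q ≤ seq ε m
    q≤εₘ = subst (q ≤_)
      (p≥q⇒p⊔q≡p (subst (_≤ seq ε m) (+-identityˡ c) (c≤ε m (ℕ.≤-trans (ℕ.m≤m⊔n N₀ N) N₀⊔N≤m))))
      (q≤ m (ℕ.≤-trans (ℕ.m≤n⊔m N₀ N) N₀⊔N≤m))

  -- The `m`-th term of `ln (ℚ→ℝ q)`, so that estimates in terms of it match the stated real bounds
  -- term by term.
  log : ℕ → ℚ → ℚ
  log m q = riemann m 1ℚ (width q)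

  log-nonneg : ∀ m q → 0ℚ ≤ log m q
  log-nonneg m q = ≤-trans
    (*-nonneg (0≤width q) (<⇒≤ (recip>0 (<-≤-trans 0<1 (1≤t+ ≤-refl (0≤width q))))))
    (riemann-lower m ≤-refl (0≤width q))

  -- Every Riemann sum is at least `(q − 1) / q`. With `q = n` this lets constants be absorbed into
  -- the logarithm of the number of vertices.
  ½≤log : ∀ m {q} → ℕ→ℚ 2 ≤ q → ½ ≤ log m q
  ½≤log m {q} 2≤q = ≤-trans ½≤ (riemann-lower m ≤-refl (0≤width q))
    where
    1≤q : 1ℚ ≤ q
    1≤q = ≤-trans (ℕ→ℚ-mono-≤ {1} {2} (ℕ.s≤s ℕ.z≤n)) 2≤q
    0<q = <-≤-trans 0<1 1≤q
    r = recip q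
    ½≤ : ½ ≤ width q * recip (1ℚ + width q)
    ½≤ = subst (λ z → ½ ≤ (z - 1ℚ) * recip (1ℚ + (z - 1ℚ))) (sym (p≥q⇒p⊔q≡p 1≤q))
      (subst (λ z → ½ ≤ (q - 1ℚ) * recip z) (solve 1 (λ q → q := con 1ℚ :+ (q :- con 1ℚ)) refl q)
        (subst (_≤ (q - 1ℚ) * r) (trans (*-assoc ½ q r) (trans (cong (½ *_) (*-recip (>⇒≢ 0<q))) (*-identityʳ ½)))
          (*-monoʳ-≤-nonNeg r {{nonNegative (<⇒≤ (recip>0 0<q))}}
            (≤-by {½ * q} (½ * (q - ℕ→ℚ 2)) (solve 1 (λ q → con ½ :* q :+ con ½ :* (q :- con (ℕ→ℚ 2)) := q :- con 1ℚ) refl q)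
              (*-nonneg RationalLemmas.0≤½ (≤⇒0≤- 2≤q))))))

  module StateWalk {n} (G : Graph n) (conn : Connected G) {D} (diam : IsDiameter G D) (i : ℕ) (k<n : suc (suc i) ℕ.< n) where

    j Δ : ℕ
    j = suc i
    Δ = maxDegree G

    relaxation : ℕ
    relaxation = j ! ℕ.* j ℕ.* Δ ℕ.^ j ℕ.* (D ℕ.+ i) ℕ.* n

    -- Stands for the square root of the degree sum, in a shape whose logarithm consists of the
    -- terms of the stated bound.
    scale : ℕ
    scale = n ℕ.^ j ℕ.* j ℕ.* Δ

    H : Graph (stateCount G j)
    H = stateGraph G j

    i<n : i ℕ.< n
    i<n = ℕ.<-trans (ℕ.n<1+n i) (ℕ.<-trans (ℕ.n<1+n j) k<n)

    2<n : 2 ℕ.< n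
    2<n = ℕ.≤-<-trans (ℕ.s≤s (ℕ.s≤s ℕ.z≤n)) k<n

    1<n : 1 ℕ.< n
    1<n = ℕ.<-trans (ℕ.n<1+n 1) 2<n

    2≤Δ : 2 ℕ.≤ Δ
    2≤Δ = 2≤maxDegree G conn 2<n

    1≤Δ : 1 ℕ.≤ Δ
    1≤Δ = ℕ.<⇒≤ 2≤Δ

    0<D : 0 ℕ.< D
    0<D = ℕ.n≢0⇒n>0 λ { refl → contradiction (no-move (diameter-walk G diam v₀ v₁)) v₀≢v₁ }
      where
      v₀ = Fin.fromℕ< (ℕ.<-trans (ℕ.s≤s ℕ.z≤n) 1<n)
      v₁ = Fin.fromℕ< 1<n
      v₀≢v₁ : ¬ v₀ ≡ v₁
      v₀≢v₁ eq = contradiction (trans (sym (Fin.toℕ-fromℕ< _)) (trans (cong Fin.toℕ eq) (Fin.toℕ-fromℕ< 1<n))) λ ()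
      no-move : ∀ {u v} → Walk (Graph._~_ G) 0 u v → u ≡ v
      no-move stop = refl

    n≤relaxation : n ℕ.≤ relaxation
    n≤relaxation = subst (ℕ._≤ relaxation) (ℕ.*-identityˡ n) (ℕ.*-monoˡ-≤ n
      (ℕ.*-mono-≤ (ℕ.*-mono-≤ (ℕ.*-mono-≤ (ℕ.1≤n! j) (ℕ.s≤s (ℕ.z≤n {i}))) (ℕ.m^n>0 Δ {{ℕ.>-nonZero 1≤Δ}} j))
        (ℕ.≤-trans 0<D (ℕ.m≤m+n D i))))

    1<relaxation : 1 ℕ.< relaxation
    1<relaxation = ℕ.<-≤-trans 1<n n≤relaxation

    distance-bound : ∀ a ℓ →
      totalVariation (lazyWalk H) (stationary H) a ℓ ≤ ½ * ((1ℚ - recip (ℕ→ℚ relaxation)) ^ ℓ * ℕ→ℚ scale)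
    distance-bound = totalVariation-bound H {L = D ℕ.+ i} {B = j ℕ.* (j ℕ.* Δ)} {R = relaxation} {X = scale}
      (stateGraph-walk G conn diam i) (ℕ.≤-trans 0<D (ℕ.m≤m+n D i))
      (stateGraph-degree-≥ G conn i (ℕ.<-trans (ℕ.n<1+n j) k<n)) (stateGraph-degree-≤ G conn i)
      (ℕ.≤-trans (ℕ.*-monoˡ-≤ (D ℕ.+ i) (ℕ.*-monoˡ-≤ (j ℕ.* (j ℕ.* Δ)) (stateCount-≤ G conn i)))
        (ℕ.≤-reflexive (eq₁ n (i !) (Δ ℕ.^ i) j Δ (D ℕ.+ i))))
      (ℕ.≤-trans (ℕ.*-monoˡ-≤ (j ℕ.* (j ℕ.* Δ)) (stateCount-≤ G conn i))
        (ℕ.≤-trans (ℕ.*-monoˡ-≤ (j ℕ.* (j ℕ.* Δ)) (ℕ.*-mono-≤ (ℕ.*-monoʳ-≤ n (!-≤-^ i (ℕ.<⇒≤ i<n)))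
            (ℕ.^-monoˡ-≤ i (maxDegree≤n G))))
          -- After `i !` and `Δ ^ i` have been replaced by `n ^ i`, a spare factor `n * Δ` completes
          -- the square of `scale`.
          (ℕ.≤-trans (ℕ.m≤m*n _ (n ℕ.* Δ) {{ℕ.m*n≢0 n Δ {{ℕ.>-nonZero (ℕ.<⇒≤ 1<n)}} {{ℕ.>-nonZero 1≤Δ}}}})
            (ℕ.≤-reflexive (eq₂ n (n ℕ.^ i) j Δ)))))
      1<relaxation
      where
      eq₁ : ∀ n f d j e l → n ℕ.* f ℕ.* d ℕ.* (j ℕ.* (j ℕ.* e)) ℕ.* l ≡ j ℕ.* f ℕ.* j ℕ.* (e ℕ.* d) ℕ.* l ℕ.* n
      eq₁ = solve-∀
      eq₂ : ∀ n p j e → n ℕ.* p ℕ.* p ℕ.* (j ℕ.* (j ℕ.* e)) ℕ.* (n ℕ.* e) ≡ n ℕ.* p ℕ.* j ℕ.* e ℕ.* (n ℕ.* p ℕ.* j ℕ.* e)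
      eq₂ = solve-∀

    distance-≤ : ∀ {e σ} → 0ℚ < e → ℕ→ℚ scale * e ≤exp σ → ∀ {t ℓ} → t ℕ.≤ ℓ → ℕ→ℚ relaxation * σ ≤ ℕ→ℚ (suc t) →
      ∀ a → totalVariation (lazyWalk H) (stationary H) a ℓ ≤ recip e
    distance-≤ 0<e Xe≤σ {t} {ℓ} t≤ℓ Rσ≤ a = ≤-trans (distance-bound a ℓ)
      (decay-bound 1<relaxation (ℕ→ℚ-nonneg scale) 0<e Xe≤σ ℓ (≤-trans Rσ≤ (ℕ→ℚ-mono-≤ (ℕ.s≤s t≤ℓ))))

    module _ (ε : ℝ) (0<ε : ℚ→ℝ 0ℚ <ᴿ ε) where

      c : ℚ
      c = proj₁ 0<ε

      0<c : 0ℚ < c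
      0<c = proj₁ (proj₂ 0<ε)

      precision : ℕ → ℚ
      precision m = recip (seq ε m ⊔ c)

      0<ε⊔c : ∀ m → 0ℚ < seq ε m ⊔ c
      0<ε⊔c m = <-≤-trans 0<c (p≤q⊔p (seq ε m) c)

      mixingTime-exists : ¬ ¬ (∃[ τ ] IsMixingTime (lazyWalk H) (stationary H) ε τ)
      mixingTime-exists = ¬¬-isMax-least (state-exists G conn i (ℕ.<-trans (ℕ.n<1+n j) k<n)) {T = T} λ a ℓ T≤ℓ →
        ≤⊔⇒≤ᴿ ε 0<ε 0 λ m _ → ≤-trans
          (distance-≤ (recip>0 0<c) (≤exp-factor 0≤Xe) T≤ℓ
            (≤-trans (p≤∣↥p∣ (ℕ→ℚ relaxation * σ)) (ℕ→ℚ-mono-≤ (ℕ.n≤1+n T))) a)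
          (≤-trans (≤-reflexive (recip-involutive 0<c)) (p≤q⊔p (seq ε m) c))
        where
        0≤Xe : 0ℚ ≤ ℕ→ℚ scale * recip c
        0≤Xe = *-nonneg (ℕ→ℚ-nonneg scale) (<⇒≤ (recip>0 0<c))
        -- Existence needs only some time that works, so the one-factor bound is good enough; the
        -- numerator of a rational bounds it from above.
        σ = ℕ→ℚ scale * recip c - 1ℚ
        T = ∣ ↥ (ℕ→ℚ relaxation * σ) ∣

      -- If `y` were below `suc t`, then for every large `m` the bound `R σ m ≤ y m` would bring the
      -- distance from time `t` on below the clamped `m`-th term of `ε`, against the minimality of
      -- `suc t` at the worst starting state.
      mixingTime-bound : ∀ {τ} → IsMixingTime (lazyWalk H) (stationary H) ε τ → (σ : ℕ → ℚ) →
        (∀ m → 0ℚ ≤ σ m) → (∀ m → ℕ→ℚ scale * precision m ≤exp σ m) →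
        ∀ (y : ℝ) → (∀ m → ℕ→ℚ relaxation * σ m ≤ seq y m) → ℕ→ℝ τ ≤ᴿ y
      -- There is no earlier time to contradict here; the claim is that `y` is not negative.
      mixingTime-bound {zero} _ σ 0≤σ _ y Rσ≤y (δ , 0<δ , N , y+δ≤0) = contradiction
        (<-≤-trans (+-mono-≤-< (≤-trans (*-nonneg (ℕ→ℚ-nonneg relaxation) (0≤σ N)) (Rσ≤y N)) 0<δ) (y+δ≤0 N ℕ.≤-refl))
        (<-irrefl refl)
      mixingTime-bound {suc t} (_ , a , _ , least) σ _ Xe≤σ y Rσ≤y (δ , 0<δ , N , y+δ≤τ) = contradiction
        (least t λ ℓ t≤ℓ → ≤⊔⇒≤ᴿ ε 0<ε N λ m N≤m → ≤-trans
          (distance-≤ (recip>0 (0<ε⊔c m)) (Xe≤σ m) t≤ℓ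
            (≤-trans (Rσ≤y m) (≤-trans (≤-by δ refl (<⇒≤ 0<δ)) (y+δ≤τ m N≤m))) a)
          (≤-reflexive (recip-involutive (0<ε⊔c m))))
        (ℕ.<⇒≱ (ℕ.n<1+n t))

      scale-≤exp : ∀ m → ℕ→ℚ scale * precision m ≤exp
        ℕ→ℚ j * log m (ℕ→ℚ n) + log m (ℕ→ℚ j) + log m (ℕ→ℚ Δ) + log m (precision m)
      scale-≤exp m = subst (λ z → z * precision m ≤exp
          ℕ→ℚ j * log m (ℕ→ℚ n) + log m (ℕ→ℚ j) + log m (ℕ→ℚ Δ) + log m (precision m)) (sym scale≡)
        (≤exp-* (<⇒≤ (recip>0 (0<ε⊔c m)))
          (≤exp-* (ℕ→ℚ-nonneg Δ)
            (≤exp-* (ℕ→ℚ-nonneg j)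
              (≤exp-^ j (ℕ→ℚ-nonneg n) (≤exp-width m (ℕ→ℚ n)))
              (≤exp-width m (ℕ→ℚ j)))
            (≤exp-width m (ℕ→ℚ Δ)))
          (≤exp-width m (precision m)))
        where
        scale≡ : ℕ→ℚ scale ≡ ℕ→ℚ n ^ j * ℕ→ℚ j * ℕ→ℚ Δ
        scale≡ = trans (ℕ→ℚ-* (n ℕ.^ j ℕ.* j) Δ) (cong (_* ℕ→ℚ Δ)
          (trans (ℕ→ℚ-* (n ℕ.^ j) j) (cong (_* ℕ→ℚ j) (ℕ→ℚ-^ n j))))

      explicitTime : ℝ
      explicitTime = (+ (j ! ℕ.* j ℕ.* Δ ℕ.^ suc j ℕ.* (D ℕ.+ suc j ℕ.∸ 2) ℕ.* n) / 2) ·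
          (ℕ→ℚ j · ln (ℕ→ℝ n) +ᴿ ln (ℕ→ℝ j) +ᴿ ln (ℕ→ℝ Δ) +ᴿ ln (inverse ε 0<ε))

      explicit-bound : ∀ {τ} → IsMixingTime (lazyWalk H) (stationary H) ε τ → ℕ→ℝ τ ≤ᴿ explicitTime
      explicit-bound mixing = mixingTime-bound mixing σ 0≤σ scale-≤exp explicitTime
        λ m → *-monoʳ-≤-nonNeg (σ m) {{nonNegative (0≤σ m)}} (≤-half {b = relaxation} relaxation≤)
        where
        σ : ℕ → ℚ
        σ m = ℕ→ℚ j * log m (ℕ→ℚ n) + log m (ℕ→ℚ j) + log m (ℕ→ℚ Δ) + log m (precision m)
        0≤σ : ∀ m → 0ℚ ≤ σ m
        0≤σ m = +-nonneg (+-nonneg (+-nonneg (*-nonneg (ℕ→ℚ-nonneg j) (log-nonneg m (ℕ→ℚ n)))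
          (log-nonneg m (ℕ→ℚ j))) (log-nonneg m (ℕ→ℚ Δ))) (log-nonneg m (precision m))
        D+k∸2 : D ℕ.+ suc j ℕ.∸ 2 ≡ D ℕ.+ i
        D+k∸2 = cong (ℕ._∸ 2) (trans (ℕ.+-suc D j) (cong suc (ℕ.+-suc D i)))
        eq : ∀ t f p l n → t ℕ.* (f ℕ.* p ℕ.* l ℕ.* n) ≡ f ℕ.* (t ℕ.* p) ℕ.* l ℕ.* n
        eq = solve-∀
        relaxation≤ : 2 ℕ.* relaxation ℕ.≤ j ! ℕ.* j ℕ.* Δ ℕ.^ suc j ℕ.* (D ℕ.+ suc j ℕ.∸ 2) ℕ.* n
        relaxation≤ = subst (λ l → 2 ℕ.* relaxation ℕ.≤ j ! ℕ.* j ℕ.* Δ ℕ.^ suc j ℕ.* l ℕ.* n) (sym D+k∸2)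
          (ℕ.≤-trans (ℕ.*-monoˡ-≤ relaxation 2≤Δ) (ℕ.≤-reflexive (eq Δ (j ! ℕ.* j) (Δ ℕ.^ j) (D ℕ.+ i) n)))

      asymptoticTime : ℕ → ℝ
      asymptoticTime C = ℕ→ℚ (C ℕ.* (j ! ℕ.* j ℕ.^ 2 ℕ.* Δ ℕ.^ suc j ℕ.* (D ℕ.+ suc j) ℕ.* n)) · ln (ℕ→ℝ n)

      -- As `j` and `Δ` are at most `n`, `scale` is at most `n ^ (j + 2)`. The part depending on `ε`
      -- is bounded by `A ≤ 2 A L`, because `L ≥ ½`. The constant then comes from
      -- `j + 2 + 2A ≤ j (3 + 2A)`, whose factor `j` gives the square in the statement.
      asymptotic-bound : ∀ {A τ} → recip c ≤ ℕ→ℚ A → IsMixingTime (lazyWalk H) (stationary H) ε τ →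
        ℕ→ℝ τ ≤ᴿ asymptoticTime (3 ℕ.+ 2 ℕ.* A)
      asymptotic-bound {A} rc≤A mixing = mixingTime-bound mixing σ 0≤σ scale≤ (asymptoticTime (3 ℕ.+ 2 ℕ.* A)) bound
        where
        -- The summand 1 keeps the exponent `E − 1` nonnegative while `E` still bounds every
        -- `precision m`.
        E = 1ℚ + recip c
        0≤rc = <⇒≤ (recip>0 0<c)
        1≤E : 1ℚ ≤ E
        1≤E = ≤-by (recip c) refl 0≤rc
        L : ℕ → ℚ
        L m = log m (ℕ→ℚ n)
        σ : ℕ → ℚ
        σ m = ℕ→ℚ (j ℕ.+ 2) * L m + (E - 1ℚ)
        0≤σ : ∀ m → 0ℚ ≤ σ m
        0≤σ m = +-nonneg (*-nonneg (ℕ→ℚ-nonneg (j ℕ.+ 2)) (log-nonneg m (ℕ→ℚ n))) (≤⇒0≤- 1≤E)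
        scale≤n^ : scale ℕ.≤ n ℕ.^ (j ℕ.+ 2)
        scale≤n^ = subst (scale ℕ.≤_)
          (trans (ℕ.*-assoc (n ℕ.^ j) n n) (trans (cong (λ z → n ℕ.^ j ℕ.* (n ℕ.* z)) (sym (ℕ.*-identityʳ n)))
            (sym (ℕ.^-distribˡ-+-* n j 2))))
          (ℕ.*-mono-≤ (ℕ.*-monoʳ-≤ (n ℕ.^ j) i<n) (maxDegree≤n G))
        precision≤E : ∀ m → precision m ≤ E
        precision≤E m = ≤-trans (recip-antimono 0<c (p≤q⊔p (seq ε m) c))
          (≤-by {recip c} 1ℚ (+-comm (recip c) 1ℚ) 0≤1)
        scale≤ : ∀ m → ℕ→ℚ scale * precision m ≤exp σ m
        scale≤ m = ≤exp-monoˡ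
          (*-mono-≤₀ (ℕ→ℚ-nonneg scale) (<⇒≤ (recip>0 (0<ε⊔c m)))
            (subst (ℕ→ℚ scale ≤_) (ℕ→ℚ-^ n (j ℕ.+ 2)) (ℕ→ℚ-mono-≤ scale≤n^)) (precision≤E m))
          (≤exp-* (≤-trans 0≤1 1≤E) (≤exp-^ (j ℕ.+ 2) (ℕ→ℚ-nonneg n) (≤exp-width m (ℕ→ℚ n))) (≤exp-factor (≤-trans 0≤1 1≤E)))
        coefficient : ℕ
        coefficient = (3 ℕ.+ 2 ℕ.* A) ℕ.* (j ! ℕ.* j ℕ.^ 2 ℕ.* Δ ℕ.^ suc j ℕ.* (D ℕ.+ suc j) ℕ.* n)
        eq : ∀ f j d l n a → f ℕ.* j ℕ.* d ℕ.* l ℕ.* n ℕ.* (j ℕ.* a) ≡ a ℕ.* (f ℕ.* (j ℕ.* (j ℕ.* 1)) ℕ.* d ℕ.* l ℕ.* n)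
        eq = solve-∀
        eq′ : ∀ i a → suc i ℕ.* (3 ℕ.+ 2 ℕ.* a) ≡ suc i ℕ.+ 2 ℕ.+ 2 ℕ.* a ℕ.+ (i ℕ.+ i ℕ.+ i ℕ.* (2 ℕ.* a))
        eq′ = solve-∀
        relaxation≤ : relaxation ℕ.* (j ℕ.+ 2 ℕ.+ 2 ℕ.* A) ℕ.≤ coefficient
        relaxation≤ = ℕ.≤-trans
          (ℕ.*-mono-≤
            (ℕ.*-monoˡ-≤ n (ℕ.*-mono-≤ (ℕ.*-monoʳ-≤ (j ! ℕ.* j) (ℕ.m≤n*m (Δ ℕ.^ j) Δ {{ℕ.>-nonZero 1≤Δ}}))
              (ℕ.+-monoʳ-≤ D (ℕ.≤-trans (ℕ.n≤1+n i) (ℕ.n≤1+n j)))))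
            (ℕ.≤-trans (ℕ.m≤m+n (j ℕ.+ 2 ℕ.+ 2 ℕ.* A) (i ℕ.+ i ℕ.+ i ℕ.* (2 ℕ.* A))) (ℕ.≤-reflexive (sym (eq′ i A)))))
          (ℕ.≤-reflexive (eq (j !) j (Δ ℕ.^ suc j) (D ℕ.+ suc j) n (3 ℕ.+ 2 ℕ.* A)))
        bound : ∀ m → ℕ→ℚ relaxation * σ m ≤ ℕ→ℚ coefficient * L m
        bound m = ≤-trans (*-monoˡ-≤-nonNeg (ℕ→ℚ relaxation) {{nonNegative (ℕ→ℚ-nonneg relaxation)}} σ≤)
          (subst (_≤ ℕ→ℚ coefficient * L m)
            (trans (cong (_* L m) (ℕ→ℚ-* relaxation (j ℕ.+ 2 ℕ.+ 2 ℕ.* A)))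
              (*-assoc (ℕ→ℚ relaxation) (ℕ→ℚ (j ℕ.+ 2 ℕ.+ 2 ℕ.* A)) (L m)))
            (*-monoʳ-≤-nonNeg (L m) {{nonNegative (log-nonneg m (ℕ→ℚ n))}} (ℕ→ℚ-mono-≤ relaxation≤)))
          where
          E-1≤ : E - 1ℚ ≤ ℕ→ℚ (2 ℕ.* A) * L m
          E-1≤ = subst₂ _≤_ (solve 1 (λ r → r := con 1ℚ :+ r :- con 1ℚ) refl (recip c)) refl
            (≤-trans rc≤A (subst (_≤ ℕ→ℚ (2 ℕ.* A) * L m)
              (trans (cong (_* ½) (ℕ→ℚ-* 2 A)) (solve 1 (λ a → con (ℕ→ℚ 2) :* a :* con ½ := a) refl (ℕ→ℚ A)))
              (*-monoˡ-≤-nonNeg (ℕ→ℚ (2 ℕ.* A)) {{nonNegative (ℕ→ℚ-nonneg (2 ℕ.* A))}} (½≤log m (ℕ→ℚ-mono-≤ 1<n)))))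
          σ≤ : σ m ≤ ℕ→ℚ (j ℕ.+ 2 ℕ.+ 2 ℕ.* A) * L m
          σ≤ = subst (σ m ≤_)
            (trans (sym (*-distribʳ-+ (L m) (ℕ→ℚ (j ℕ.+ 2)) (ℕ→ℚ (2 ℕ.* A))))
              (cong (_* L m) (sym (ℕ→ℚ-+ (j ℕ.+ 2) (2 ℕ.* A)))))
            (+-monoʳ-≤ (ℕ→ℚ (j ℕ.+ 2) * L m) E-1≤)

open import Data.Integer.Base using (+_; ∣_∣)
open import Data.Nat.Base using (ℕ; _+_; _*_; _∸_; _^_; _<_; _!; z≤n; s≤s)
open import Data.Product using (_×_; _,_; proj₁; ∃-syntax)
open import Data.Rational.Base using (0ℚ; 1ℚ; _/_; ↥_)
open import Relation.Nullary using (¬_)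
open import Defs using (ℝ; _<ᴿ_; _≤ᴿ_; _+ᴿ_; _·_; ℕ→ℚ; ℚ→ℝ; ℕ→ℝ; inverse; ln; recip; module DyadicLemmas)
open import Defs using (Graph; Connected; IsDiameter; maxDegree; IsPSRWMixingTime)
open MixingTimes using (module StateWalk)

lemma3p7 : (ε : ℝ) (0<ε : ℚ→ℝ 0ℚ <ᴿ ε) → ε <ᴿ ℚ→ℝ 1ℚ →
    (∀ {n} (G : Graph n) (D k : ℕ) → Connected G → IsDiameter G D → 1 < k → k < n →
    let Δ = maxDegree G in
    (¬ ¬ (∃[ τ ] IsPSRWMixingTime G k ε τ)) ×
    (∀ τ → IsPSRWMixingTime G k ε τ →
    ℕ→ℝ τ ≤ᴿ
    (+ ((k ∸ 1) ! * (k ∸ 1) * Δ ^ k * (D + k ∸ 2) * n) / 2) ·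
    (ℕ→ℚ (k ∸ 1) · ln (ℕ→ℝ n) +ᴿ ln (ℕ→ℝ (k ∸ 1)) +ᴿ ln (ℕ→ℝ Δ) +ᴿ ln (inverse ε 0<ε))))
    ×
    (∃[ C ] (∀ {n} (G : Graph n) (D k : ℕ) → Connected G → IsDiameter G D → 1 < k → k < n →
    let Δ = maxDegree G in
    ∀ τ → IsPSRWMixingTime G k ε τ →
    ℕ→ℝ τ ≤ᴿ
    ℕ→ℚ (C * ((k ∸ 1) ! * (k ∸ 1) ^ 2 * Δ ^ k * (D + k) * n)) · ln (ℕ→ℝ n)))
lemma3p7 ε 0<ε _ =
  -- Matching `1 < k` writes `k` as `i + 2`, so that the walk lives on the state graph with
  -- `j = i + 1`.
  (λ { G D _ conn diam (s≤s (s≤s {n = i} z≤n)) k<n →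
       StateWalk.mixingTime-exists G conn diam i k<n ε 0<ε
     , λ τ → StateWalk.explicit-bound G conn diam i k<n ε 0<ε }) ,
  -- The constant depends on `ε` through its positive lower bound alone, hence is uniform in the
  -- graph, `D` and `k`.
  3 + 2 * A ,
  (λ { G D _ conn diam (s≤s (s≤s {n = i} z≤n)) k<n τ →
       StateWalk.asymptotic-bound G conn diam i k<n ε 0<ε {A} (DyadicLemmas.p≤∣↥p∣ (recip (proj₁ 0<ε))) })
  where
  A : ℕ
  A = ∣ ↥ recip (proj₁ 0<ε) ∣
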